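{- For every integer $k$ and every positive integer $n$, \[ \mathrm{roots}_k^{B_n}=\sum_{C\in\mathrm{Conj}(B_n)\,:\,C^k=\{1\}}\psi^C , \] where $C^k=\{x^k:x\in C\}$ and $\psi^C$ is the higher Lie character of type $B$ attached to the conjugacy class $C$ (defined below).
   Context: $\mathrm{roots}_k^G(g)=|\{h\in G:h^k=g\}|$. $B_n$ is the group of bijections $w$ of $\{\pm1,\dots,\pm n\}$ with $w(-i)=-w(i)$; $\mathrm{Conj}(B_n)$ is its set of conjugacy classes. Cycles: writing $w$ as a product of disjoint cycles on $\{\pm1,\dots,\pm n\}$, if $c=(a_1,\dots,a_\ell)$ is a cycle so is $\bar c=(-a_1,\dots,-a_\ell)$; if $c\neq\bar c$ then $c\bar c$ is called a cycle of $w$ of length $\ell$ and $\mathbb{Z}_2$-class $+1$; if $c=\bar c$ it is a cycle of length $\ell/2$ and class $-1$. Two elements are conjugate iff they have the same numbers of cycles of each length and class. Higher Lie characters: for $x\in B_n$ let $a_{i,\varepsilon}$ be the number of cycles of $x$ of length $i$ and class $\varepsilon\in\{\pm1\}$, and write $x=\prod_{i,\varepsilon}x_{i,\varepsilon}$, $x_{i,\varepsilon}$ the product of those cycles. Then $Z_{B_n}(x)=\prod_{i,\varepsilon}Z(x_{i,\varepsilon})$, where $Z(x_{i,\varepsilon})$ is the centralizer of $x_{i,\varepsilon}$ in the signed permutations of its support, and $Z(x_{i,\varepsilon})\cong G_{i,\varepsilon}\wr S_{a_{i,\varepsilon}}$; here $G_{i,+}\cong\mathbb{Z}_2\times\mathbb{Z}_i$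 is the centralizer in $B_i$ of one cycle of length $i$ and class $+1$ ($\mathbb Z_2$ generated by $w_0=[-1,\dots,-i]$, $\mathbb Z_i$ by the cycle), and $G_{i,- }\cong\mathbb{Z}_{2i}$ is the centralizer in $B_i$ of one cycle of length $i$ and class $-1$ (generated by that cycle). Let $\omega_{i,+}$ be the linear character of $G_{i,+}\wr S_{a}$ which on the base group $G_{i,+}^{a}$ is the product over the factors of (trivial on $\mathbb Z_2$)$\times$(a faithful linear character of $\mathbb Z_i$), and is trivial on the complement $S_a$; let $\omega_{i,- }$ be the linear character of $G_{i,- }\wr S_a$ which on the base group is the product of a faithful linear character of $\mathbb Z_{2i}$ over the factors and is trivial on $S_a$. Put $\omega^x=\bigotimes_{i,\varepsilon}\omega_{i,\varepsilon}$, a linear character of $Z_{B_n}(x)$, and $\psi^x=\mathrm{Ind}_{Z_{B_n}(x)}^{B_n}\omega^x$. This depends only on the conjugacy class $C$ of $x$ and is denoted $\psi^C$. -}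

module Defs where

open import Level using (Level; _⊔_) renaming (suc to lsuc)
open import Algebra.Bundles using (CommutativeRing)
open import Data.Bool using (Bool; true; false; _xor_; _∧_; _∨_; not; if_then_else_; T; T?)
open import Data.Nat using (ℕ; zero; suc; _≤ᵇ_; ⌊_/2⌋) renaming (_+_ to _+ℕ_; _*_ to _*ℕ_; _≤_ to _≤ℕ_; _<_ to _<ℕ_)
open import Data.Integer using (ℤ; +_; -[1+_])
open import Data.Fin using (Fin; toℕ)
open import Data.Fin.Properties using () renaming (_≟_ to _≟F_)
open import Data.Product using (_×_; _,_; proj₁; proj₂)
open import Data.Product.Properties using () renaming (≡-dec to ×-dec)
open import Data.Bool.Properties using () renaming (_≟_ to _≟B_)
open import Data.Vec using (Vec; []; _∷_; lookup; tabulate)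
open import Data.Vec.Properties using () renaming (≡-dec to vec-dec)
open import Data.List using (List; []; _∷_; map; concatMap; filter; length; upTo; foldr; allFin; applyUpTo)
open import Data.Bool.ListAction using (all; any)
open import Relation.Nullary using (¬_; does)
open import Relation.Nullary.Decidable using (⌊_⌋)
open import Relation.Binary.PropositionalEquality using (_≡_)

-- Fields of characteristic zero (ℂ is one).  Character values are taken
-- in an arbitrary such field; a total inverse `inv` is provided whose
-- value at 0 is irrelevant.

natR : ∀ {c ℓ} (R : CommutativeRing c ℓ) → ℕ → CommutativeRing.Carrier R
natR R zero    = CommutativeRing.0# R
natR R (suc m) = CommutativeRing._+_ R (CommutativeRing.1# R) (natR R m)

record CharZeroField (c ℓ : Level) : Set (lsuc (c ⊔ ℓ)) where
  field
    cring : CommutativeRing c ℓ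
  open CommutativeRing cring public
  field
    inv      : Carrier → Carrier
    inv-law  : ∀ x → ¬ (x ≈ 0#) → (x * inv x) ≈ 1#
    charZero : ∀ m → ¬ (natR cring (suc m) ≈ 0#)

module _ {c ℓ} (K : CharZeroField c ℓ) where
  open CharZeroField K

  powK : Carrier → ℕ → Carrier
  powK a zero    = 1#
  powK a (suc m) = a * powK a m

  fromℕK : ℕ → Carrier
  fromℕK = natR cring

  sumK : List Carrier → Carrier
  sumK = foldr _+_ 0#

  prodK : List Carrier → Carrier
  prodK = foldr _*_ 1#

  Primitive : ℕ → Carrier → Set ℓ
  Primitive m a = (powK a m ≈ 1#) × (∀ j → 1 ≤ℕ j → j <ℕ m → ¬ (powK a j ≈ 1#))

-- Signed permutations.  A letter (s , i) stands for i if s = false and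
-- for -i if s = true.  An element w of B_n is stored by the images of
-- the positive letters: lookup w i = w(+i); w(-i) = -w(i).

Letter : ℕ → Set
Letter n = Bool × Fin n

SP : ℕ → Set
SP n = Vec (Letter n) n

letterEq : ∀ {n} → Letter n → Letter n → Bool
letterEq a b = does (×-dec _≟B_ _≟F_ a b)

spEq : ∀ {n} → SP n → SP n → Bool
spEq v w = does (vec-dec (×-dec _≟B_ _≟F_) v w)

negL : ∀ {n} → Letter n → Letter n
negL (s , i) = (not s , i)

apply : ∀ {n} → SP n → Letter n → Letter n
apply w (s , i) with lookup w i
... | (t , j) = (s xor t , j)

_∘B_ : ∀ {n} → SP n → SP n → SP n
w ∘B v = tabulate (λ i → apply w (lookup v i))

idB : ∀ {n} → SP n
idB = tabulate (λ i → (false , i))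

letters : (n : ℕ) → List (Letter n)
letters n = concatMap (λ i → (false , i) ∷ (true , i) ∷ []) (allFin n)

allVecs : (m n : ℕ) → List (Vec (Letter n) m)
allVecs zero    n = [] ∷ []
allVecs (suc m) n = concatMap (λ a → map (a ∷_) (allVecs m n)) (letters n)

-- underlying map on absolute values is surjective (hence bijective)
isSignedPerm : ∀ {n} → SP n → Bool
isSignedPerm {n} w = all (λ j → any (λ i → does (proj₂ (lookup w i) ≟F j)) (allFin n)) (allFin n)

Bn : (n : ℕ) → List (SP n)
Bn n = filter (λ w → T? (isSignedPerm w)) (allVecs n n)

firstL : ∀ {A : Set} → A → (A → Bool) → List A → A
firstL d p []       = d
firstL d p (x ∷ xs) = if p x then x else firstL d p xs

invB : ∀ {n} → SP n → SP n
invB {n} w = tabulate (λ j →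
  let i = firstL j (λ i → does (proj₂ (lookup w i) ≟F j)) (allFin n)
  in (proj₁ (lookup w i) , i))

powB : ∀ {n} → SP n → ℕ → SP n
powB w zero    = idB
powB w (suc m) = w ∘B powB w m

zpowB : ∀ {n} → SP n → ℤ → SP n
zpowB w (+ m)      = powB w m
zpowB w -[1+ m ]   = powB (invB w) (suc m)

conjB : ∀ {n} → SP n → SP n → SP n
conjB h g = (h ∘B g) ∘B invB h

countL : ∀ {A : Set} → (A → Bool) → List A → ℕ
countL p []       = 0
countL p (x ∷ xs) = if p x then suc (countL p xs) else countL p xs

rootsB : ∀ {n} → ℤ → SP n → ℕ
rootsB {n} k g = countL (λ h → spEq (zpowB h k) g) (Bn n)

conjugate : ∀ {n} → SP n → SP n → Bool
conjugate {n} x y = any (λ h → spEq (conjB h x) y) (Bn n)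

firstsOf : ∀ {A : Set} → (A → A → Bool) → List A → List A → List A
firstsOf r seen []       = []
firstsOf r seen (x ∷ xs) =
  if any (λ y → r y x) seen then firstsOf r seen xs
                             else x ∷ firstsOf r (x ∷ seen) xs

classReps : (n : ℕ) → List (SP n)
classReps n = firstsOf conjugate [] (Bn n)

classPowTrivial : ∀ {n} → ℤ → SP n → Bool
classPowTrivial {n} k x = all (λ h → spEq (zpowB (conjB h x) k) idB) (Bn n)

iterL : ∀ {n} → SP n → Letter n → ℕ → Letter n
iterL x a zero    = a
iterL x a (suc t) = apply x (iterL x a t)

firstN : (ℕ → Bool) → List ℕ → ℕ
firstN p l = firstL 0 p l

orbitSize : ∀ {n} → SP n → Letter n → ℕ
orbitSize {n} x a = firstN (λ t → letterEq (iterL x a t) a) (applyUpTo suc (2 *ℕ n))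

-- does the orbit of +j contain -j  (cycle of Z₂-class -1)
negClass : ∀ {n} → SP n → Fin n → Bool
negClass {n} x j = any (λ t → letterEq (iterL x (false , j) t) (true , j)) (upTo (2 *ℕ n))

minFin : ∀ {n} → Fin n → Fin n → Fin n
minFin a b = if toℕ a ≤ᵇ toℕ b then a else b

baseIdx : ∀ {n} → SP n → Fin n → Fin n
baseIdx {n} x m = foldr (λ t acc → minFin (proj₂ (iterL x (false , m) t)) acc) m (upTo (2 *ℕ n))

isBase : ∀ {n} → SP n → Fin n → Bool
isBase x j = does (baseIdx x j ≟F j)

-- The linear character ω^x of Z_{B_n}(x).
-- ζ i : the chosen faithful character of Z_i sends the cycle to ζ i;
-- η i : the chosen faithful character of Z_{2i} sends the cycle to η i.
-- Base points b = +j (j the base index of the cycle).  For z ∈ Z(x),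
-- z(b) = x^e(b') (class -1) or z(b) = ± x^e(b') (class +1), where b' is
-- the base point of the image cycle; the factor attached to this cycle
-- is then η_i^e resp. ζ_i^e (the w₀-component being ignored).

module _ {c ℓ} (K : CharZeroField c ℓ) (ζ η : ℕ → CharZeroField.Carrier K) where
  open CharZeroField K

  cycleFactor : ∀ {n} → SP n → SP n → Fin n → Carrier
  cycleFactor {n} x z j =
    let b  = (false , j)
        o  = orbitSize x b
        zb = apply z b
        b' = (false , baseIdx x (proj₂ zb))
    in if negClass x j
       then powK K (η ⌊ o /2⌋)
              (firstN (λ e → letterEq (iterL x b' e) zb) (upTo o))
       else powK K (ζ o)
              (firstN (λ e → letterEq (iterL x b' e) zb ∨ letterEq (iterL x b' e) (negL zb)) (upTo o))

  omega : ∀ {n} → SP n → SP n → Carrier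
  omega {n} x z = prodK K (map (cycleFactor x z) (filter (λ j → T? (isBase x j)) (allFin n)))

  commutes : ∀ {n} → SP n → SP n → Bool
  commutes x z = spEq (x ∘B z) (z ∘B x)

  centralizerSize : ∀ {n} → SP n → ℕ
  centralizerSize {n} x = countL (commutes x) (Bn n)

  -- ψ^x = Ind_{Z(x)}^{B_n} ω^x :
  -- ψ^x(g) = |Z(x)|⁻¹ Σ_{h ∈ B_n, h g h⁻¹ ∈ Z(x)} ω^x(h g h⁻¹)
  psi : ∀ {n} → SP n → SP n → Carrier
  psi {n} x g = inv (fromℕK K (centralizerSize x)) *
    sumK K (map (λ h → if commutes x (conjB h g) then omega x (conjB h g) else 0#) (Bn n))

  rhs : ∀ {n} → ℤ → SP n → Carrier
  rhs {n} k g = sumK K (map (λ x → if classPowTrivial k x then psi x g else 0#) (classReps n))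

{-# OPTIONS --safe #-}
-- Averaging over B_n in the definition of ψ turns the right-hand side into the sum of ω^y(g)
-- over the y in the centralizer of g with y^k = 1.  Now ω^y(g) is a product over the orbits of
-- ⟨y,g,−1⟩: if m is the least positive number such that g^m stabilises a cycle of y, and g^m = y^e
-- there (up to sign for class +1), the orbit contributes the e-th power of the root of unity
-- attached to the cycle.  The condition y^k = 1, and likewise y^k = g, is also checked orbit by orbit.
-- So both sides are sums over the centralizer of g of products over orbits, and they agree because
-- the factors can be exchanged one orbit at a time: multiplying y by g^s on a single cycle of g,
-- of order D, leaves the orbits and all other factors unchanged.  If r is the least positive
-- number such that y^r stabilises that cycle of g, the sum over s of the factor of its orbit is
-- Σ μ(o) over the common divisors o of D and k/r (a Ramanujan sum for each order o of s in ℤ/D),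
-- which is the number of s with (k/r) s ≡ 1 modulo D, that is, of twists for which y^k = g there.
module Submission where

open import Defs
open import Algebra.Bundles using (CommutativeMonoid)
import Algebra.Properties.CommutativeSemigroup as CommSemigroup
import Algebra.Properties.Ring as RingProperties
open import Data.Bool using (Bool; true; false; _∧_; _∨_; not; _xor_; if_then_else_; T; T?)
open import Data.Bool.ListAction using (all; any)
open import Data.Bool.Properties using (xor-assoc; xor-same; not-involutive; ∨-identityʳ) renaming (_≟_ to _≟B_)
open import Data.Empty using (⊥-elim)
open import Data.Fin using (Fin; toℕ; fromℕ<; combine) renaming (zero to fzero; suc to fsuc)
import Data.Fin.Properties as Finₚ
open import Data.List using (List; []; _∷_; _++_; map; concatMap; filter; upTo; allFin; applyUpTo; cartesianProductWith; foldr)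
open import Data.List.Membership.Propositional using (_∈_)
open import Data.List.Membership.Propositional.Properties using (∈-filter⁺; ∈-filter⁻; ∈-upTo⁺; ∈-upTo⁻; ∈-allFin; ∈-cartesianProductWith⁺)
open import Data.List.Properties using (filter-≐)
open import Data.List.Relation.Unary.All using ([]; _∷_)
open import Data.List.Relation.Unary.AllPairs using ([]; _∷_)
open import Data.List.Relation.Unary.Any using (here; there)
open import Data.List.Relation.Unary.Unique.Propositional using (Unique)
open import Data.List.Relation.Unary.Unique.Propositional.Properties using (Unique[x∷xs]⇒x∉xs; upTo⁺; allFin⁺; cartesianProductWith⁺) renaming (filter⁺ to Unique-filter⁺)
open import Data.Nat using (ℕ; zero; suc; pred; _∸_; _≤_; _<_; _≤ᵇ_; z≤n; s≤s; NonZero; >-nonZero; _%_; _/_; _!; ⌊_/2⌋) renaming (_+_ to _+ℕ_; _*_ to _*ℕ_)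
import Data.Nat.Properties as ℕₚ
open import Data.Nat.Coprimality using (coprime-divisor; gcd≡1⇒coprime) renaming (sym to coprime-sym)
open import Data.Nat.Divisibility
open import Data.Nat.DivMod using (m%n<n; m≡m%n+[m/n]*n)
open import Data.Nat.GCD using (gcd; gcd-GCD; gcd[m,n]∣m; gcd[m,n]∣n; gcd-greatest; c*gcd[m,n]≡gcd[cm,cn]; module Bézout)
open import Data.Nat.Induction using (<-rec)
open import Data.Nat.Tactic.RingSolver using (solve-∀)
open import Data.Product using (∃; ∃₂; _×_; _,_; proj₁; proj₂)
open import Data.Product.Properties using () renaming (≡-dec to ×-dec)
open import Data.Sum using (_⊎_; inj₁; inj₂)
open import Data.Vec using (Vec; []; _∷_; lookup; tabulate)
open import Data.Vec.Properties using (lookup∘tabulate; tabulate∘lookup; tabulate-cong; ∷-injective) renaming (≡-dec to vec-dec)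
open import Function using (id; _∘_)
open import Function.Bundles using (mk⇔)
open import Relation.Binary using (DecidableEquality)
open import Relation.Binary.PropositionalEquality as ≡ using (_≡_; _≢_; cong; cong₂; subst)
open import Relation.Nullary using (¬_; Dec; yes; no; does)
open import Relation.Nullary.Decidable using (¬?; dec-true; does-⇔)
open import Relation.Unary using (Pred; Decidable)

-- Three points shape the proof. The character ω^x is defined through the least index of each cycle,
-- and conjugation does not preserve these base points; averaging over B_n therefore first needs the
-- product `Ω` over orbits, whose compatibility with conjugation can be checked orbit by orbit.
-- Next, a twist by g^s can change the class of a cycle of y: if y^r = -g^s on a cycle of g of class
-- +1, the cycle of y has class -1 exactly when the order o of s is odd. The contributions for
-- different s thus come from unrelated roots of unity, some from `ζ` and some from `η`. What they
-- share is that each is the e-th power of a primitive o-th root with e s congruent to gcd(s, D)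
-- modulo D; a Ramanujan sum is the same for all primitive roots of its order, and this joins them.
-- Last, a given index is the base of its orbit only for some y in the centralizer. Twisting
-- preserves this set of y, so the sum over it may be averaged over s modulo D, and D can be
-- cancelled in characteristic zero.

module Combinatorics where
  open import Data.Nat using (_+_; _*_)
  open import Data.Nat.Properties
  open import Relation.Binary.PropositionalEquality using (refl; sym; trans; subst₂; module ≡-Reasoning)

  -- Sums over lists in a commutative monoid

  module FiniteSum {c ℓ} (M : CommutativeMonoid c ℓ) where
    open CommutativeMonoid M renaming (refl to ≈-refl; sym to ≈-sym; trans to ≈-trans)
    open CommSemigroup commutativeSemigroup using (interchange)
    open import Relation.Binary.Reasoning.Setoid setoid

    ∑ : ∀ {a} {A : Set a} → List A → (A → Carrier) → Carrier
    ∑ xs f = foldr _∙_ ε (map f xs)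

    ∑-cong : ∀ {a} {A : Set a} (xs : List A) {f h} → (∀ {x} → x ∈ xs → f x ≈ h x) → ∑ xs f ≈ ∑ xs h
    ∑-cong [] e = ≈-refl
    ∑-cong (x ∷ xs) e = ∙-cong (e (here refl)) (∑-cong xs (λ p → e (there p)))

    ∑-ε : ∀ {a} {A : Set a} (xs : List A) {f} → (∀ {x} → x ∈ xs → f x ≈ ε) → ∑ xs f ≈ ε
    ∑-ε [] e = ≈-refl
    ∑-ε (x ∷ xs) e = ≈-trans (∙-cong (e (here refl)) (∑-ε xs (λ p → e (there p)))) (identityˡ ε)

    ∑-∙ : ∀ {a} {A : Set a} (xs : List A) f h → ∑ xs (λ x → f x ∙ h x) ≈ ∑ xs f ∙ ∑ xs h
    ∑-∙ [] f h = ≈-sym (identityˡ ε)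
    ∑-∙ (x ∷ xs) f h = ≈-trans (∙-congˡ (∑-∙ xs f h)) (interchange _ _ _ _)

    ∑-swap : ∀ {a b} {A : Set a} {B : Set b} (xs : List A) (ys : List B) (f : A → B → Carrier) →
             ∑ xs (λ x → ∑ ys (f x)) ≈ ∑ ys (λ y → ∑ xs (λ x → f x y))
    ∑-swap [] ys f = ≈-sym (∑-ε ys (λ _ → ≈-refl))
    ∑-swap (x ∷ xs) ys f = ≈-trans (∙-congˡ (∑-swap xs ys f)) (≈-sym (∑-∙ ys (f x) _))

    ∑-filter : ∀ {a p} {A : Set a} {P : Pred A p} (P? : Decidable P) xs f →
               ∑ (filter P? xs) f ≈ ∑ xs (λ x → if does (P? x) then f x else ε)
    ∑-filter P? [] f = ≈-refl
    ∑-filter P? (x ∷ xs) f with does (P? x)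
    ... | true  = ∙-congˡ (∑-filter P? xs f)
    ... | false = ≈-trans (∑-filter P? xs f) (≈-sym (identityˡ _))

    ∑-single : ∀ {a} {A : Set a} {xs : List A} {f y} → Unique xs → y ∈ xs →
               (∀ {x} → x ∈ xs → x ≢ y → f x ≈ ε) → ∑ xs f ≈ f y
    ∑-single {xs = x ∷ xs} u (here refl) e =
      ≈-trans (∙-congˡ (∑-ε xs (λ p → e (there p) λ { refl → Unique[x∷xs]⇒x∉xs u p }))) (identityʳ _)
    ∑-single {xs = x ∷ xs} u@(_ ∷ u′) (there p) e =
      ≈-trans (∙-cong (e (here refl) λ { refl → Unique[x∷xs]⇒x∉xs u p })
                      (∑-single u′ p (λ q → e (there q))))
              (identityˡ _)

    if-yes : ∀ {p} {P : Set p} (d : Dec P) {x y : Carrier} → P → (if does d then x else y) ≈ x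
    if-yes (yes _) p = ≈-refl
    if-yes (no ¬p) p = ⊥-elim (¬p p)

    if-no : ∀ {p} {P : Set p} (d : Dec P) {x y : Carrier} → ¬ P → (if does d then x else y) ≈ y
    if-no (yes p) ¬p = ⊥-elim (¬p p)
    if-no (no _) ¬p = ≈-refl

    module _ {a b} {A : Set a} {B : Set b} (_≟_ : DecidableEquality B) where

      -- Both sides equal the double sum of h y over the pairs with φ x = y, taken in either order;
      -- no permutation of lists has to be built.
      ∑-bij : ∀ {xs : List A} {ys : List B} {f h} → Unique xs → Unique ys →
              (φ : A → B) (ψ : B → A) →
              (∀ {x} → x ∈ xs → φ x ∈ ys × ψ (φ x) ≡ x) →
              (∀ {y} → y ∈ ys → ψ y ∈ xs × φ (ψ y) ≡ y) →
              (∀ {x} → x ∈ xs → f x ≈ h (φ x)) → ∑ xs f ≈ ∑ ys h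
      ∑-bij {xs} {ys} {f} {h} uxs uys φ ψ to from e = begin
        ∑ xs f
          ≈⟨ ∑-cong xs (λ {x} p → ≈-trans (e p) (≈-trans (≈-sym (if-yes (φ x ≟ φ x) refl))
               (≈-sym (∑-single uys (proj₁ (to p)) (λ {y} _ ne → if-no (φ x ≟ y) (λ q → ne (sym q))))))) ⟩
        ∑ xs (λ x → ∑ ys (λ y → if does (φ x ≟ y) then h y else ε))
          ≈⟨ ∑-swap xs ys _ ⟩
        ∑ ys (λ y → ∑ xs (λ x → if does (φ x ≟ y) then h y else ε))
          ≈⟨ ∑-cong ys (λ {y} q → ≈-trans
               (∑-single uxs (proj₁ (from q))
                 (λ {x} p ne → if-no (φ x ≟ y) λ r → ne (trans (sym (proj₂ (to p))) (cong ψ r))))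
               (if-yes (φ (ψ y) ≟ y) (proj₂ (from q)))) ⟩
        ∑ ys h ∎

    ∑-partition : ∀ {a p} {A : Set a} {P : Pred A p} (P? : Decidable P) xs f →
                  ∑ xs f ≈ ∑ (filter P? xs) f ∙ ∑ (filter (λ x → ¬? (P? x)) xs) f
    ∑-partition P? xs f = begin
      ∑ xs f
        ≈⟨ ∑-cong xs (λ {x} _ → split x) ⟩
      ∑ xs (λ x → (if does (P? x) then f x else ε) ∙ (if does (¬? (P? x)) then f x else ε))
        ≈⟨ ∑-∙ xs _ _ ⟩
      ∑ xs (λ x → if does (P? x) then f x else ε) ∙ ∑ xs (λ x → if does (¬? (P? x)) then f x else ε)
        ≈⟨ ∙-cong (∑-filter P? xs f) (∑-filter (λ x → ¬? (P? x)) xs f) ⟨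
      ∑ (filter P? xs) f ∙ ∑ (filter (λ x → ¬? (P? x)) xs) f ∎
      where
      split : ∀ x → f x ≈ (if does (P? x) then f x else ε) ∙ (if does (¬? (P? x)) then f x else ε)
      split x with does (P? x)
      ... | true  = ≈-sym (identityʳ _)
      ... | false = ≈-sym (identityˡ _)

    ∑-remove : ∀ {a} {A : Set a} (_≟_ : DecidableEquality A) {xs : List A} {y} f → Unique xs → y ∈ xs →
               ∑ xs f ≈ f y ∙ ∑ (filter (λ x → ¬? (x ≟ y)) xs) f
    ∑-remove _≟_ {xs} {y} f u p = ≈-trans (∑-partition (_≟ y) xs f) (∙-congʳ (begin
      ∑ (filter (_≟ y) xs) f                          ≈⟨ ∑-filter (_≟ y) xs f ⟩
      ∑ xs (λ x → if does (x ≟ y) then f x else ε)    ≈⟨ ∑-single u p (λ {x} _ ne → if-no (x ≟ y) ne) ⟩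
      (if does (y ≟ y) then f y else ε)               ≈⟨ if-yes (y ≟ y) refl ⟩
      f y                                             ∎))

    ∑-fibre : ∀ {a b} {A : Set a} {B : Set b} (_≟_ : DecidableEquality B) (key : A → B)
              (xs : List A) {ys} f → Unique ys → (∀ {x} → x ∈ xs → key x ∈ ys) →
              ∑ xs f ≈ ∑ ys (λ y → ∑ (filter (λ x → key x ≟ y) xs) f)
    ∑-fibre _≟_ key xs {ys} f u to = begin
      ∑ xs f
        ≈⟨ ∑-cong xs (λ {x} p → ≈-sym (≈-trans
             (∑-single u (to p) (λ {y} _ ne → if-no (key x ≟ y) (λ q → ne (sym q))))
             (if-yes (key x ≟ key x) refl))) ⟩
      ∑ xs (λ x → ∑ ys (λ y → if does (key x ≟ y) then f x else ε))
        ≈⟨ ∑-swap xs ys _ ⟩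
      ∑ ys (λ y → ∑ xs (λ x → if does (key x ≟ y) then f x else ε))
        ≈⟨ ∑-cong ys (λ {y} _ → ≈-sym (∑-filter (λ x → key x ≟ y) xs f)) ⟩
      ∑ ys (λ y → ∑ (filter (λ x → key x ≟ y) xs) f) ∎

  -- Congruences and the order of an element of ℤ/D

  infix 4 _≅_[mod_]

  -- This form of congruence needs neither subtraction nor D ≠ 0.
  _≅_[mod_] : ℕ → ℕ → ℕ → Set
  a ≅ b [mod D ] = ∃₂ λ x y → a + x * D ≡ b + y * D

  module _ {D : ℕ} where

    ≅-reflexive : ∀ {a b} → a ≡ b → a ≅ b [mod D ]
    ≅-reflexive refl = 0 , 0 , refl

    ≅-sym : ∀ {a b} → a ≅ b [mod D ] → b ≅ a [mod D ]
    ≅-sym (x , y , e) = y , x , sym e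

    ≅-trans : ∀ {a b d} → a ≅ b [mod D ] → b ≅ d [mod D ] → a ≅ d [mod D ]
    ≅-trans {a} {b} {d} (x , y , e) (x′ , y′ , e′) = x + x′ , y′ + y , (begin
      a + (x + x′) * D     ≡⟨ shuffle a x x′ D ⟩
      (a + x * D) + x′ * D ≡⟨ cong (_+ x′ * D) e ⟩
      (b + y * D) + x′ * D ≡⟨ shuffle′ b y x′ D ⟩
      (b + x′ * D) + y * D ≡⟨ cong (_+ y * D) e′ ⟩
      (d + y′ * D) + y * D ≡⟨ shuffle d y′ y D ⟨
      d + (y′ + y) * D     ∎)
      where
      open ≡-Reasoning
      shuffle : ∀ a x x′ D → a + (x + x′) * D ≡ (a + x * D) + x′ * D
      shuffle = solve-∀
      shuffle′ : ∀ a x x′ D → (a + x * D) + x′ * D ≡ (a + x′ * D) + x * D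
      shuffle′ = solve-∀

    ≅-+ : ∀ {a b a′ b′} → a ≅ b [mod D ] → a′ ≅ b′ [mod D ] → a + a′ ≅ b + b′ [mod D ]
    ≅-+ {a} {b} {a′} {b′} (x , y , e) (x′ , y′ , e′) = x + x′ , y + y′ ,
      trans (shuffle a a′ x x′ D) (trans (cong₂ _+_ e e′) (sym (shuffle b b′ y y′ D)))
      where
      shuffle : ∀ a a′ x x′ D → a + a′ + (x + x′) * D ≡ (a + x * D) + (a′ + x′ * D)
      shuffle = solve-∀

    ≅-+-cancelʳ : ∀ {a b} d → a + d ≅ b + d [mod D ] → a ≅ b [mod D ]
    ≅-+-cancelʳ {a} {b} d (x , y , e) = x , y ,
      +-cancelʳ-≡ d _ _ (trans (shuffle a x d D) (trans e (sym (shuffle b y d D))))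
      where
      shuffle : ∀ a x d D → a + x * D + d ≡ a + d + x * D
      shuffle = solve-∀

    ≅-*ˡ : ∀ d {a b} → a ≅ b [mod D ] → d * a ≅ d * b [mod D ]
    ≅-*ˡ d {a} {b} (x , y , e) = d * x , d * y ,
      trans (shuffle d a x D) (trans (cong (d *_) e) (sym (shuffle d b y D)))
      where
      shuffle : ∀ d a x D → d * a + d * x * D ≡ d * (a + x * D)
      shuffle = solve-∀

    ≅-*ʳ : ∀ d {a b} → a ≅ b [mod D ] → a * d ≅ b * d [mod D ]
    ≅-*ʳ d {a} {b} e = subst₂ (_≅_[mod D ]) (*-comm d a) (*-comm d b) (≅-*ˡ d e)

    ∣⇒≅0 : ∀ {a} → D ∣ a → a ≅ 0 [mod D ]
    ∣⇒≅0 {a} (divides q e) = 0 , q , trans (+-identityʳ a) e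

    ≅-∣ : ∀ {d a b} → d ∣ D → a ≅ b [mod D ] → d ∣ a → d ∣ b
    ≅-∣ {d} {a} {b} d∣D (x , y , e) d∣a =
      ∣m+n∣m⇒∣n (subst (d ∣_) (trans e (+-comm b (y * D))) (∣m∣n⇒∣m+n d∣a (∣n⇒∣m*n x d∣D))) (∣n⇒∣m*n y d∣D)

    ≅0⇒∣ : ∀ {a} → a ≅ 0 [mod D ] → D ∣ a
    ≅0⇒∣ e = ≅-∣ ∣-refl (≅-sym e) (_ ∣0)

    ≤∧≅⇒∣∸ : ∀ {a b} → a ≤ b → a ≅ b [mod D ] → D ∣ b ∸ a
    ≤∧≅⇒∣∸ {a} {b} a≤b e = ≅0⇒∣ (≅-+-cancelʳ a (subst (_≅ a [mod D ]) (sym (m∸n+n≡m a≤b)) (≅-sym e)))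

    ≅-unique : ∀ {a b} → a < D → b < D → a ≅ b [mod D ] → a ≡ b
    ≅-unique {a} {b} a<D b<D e = case-≤ (≤-total a b)
      where
      small : ∀ {a b} → a ≤ b → b < D → a ≅ b [mod D ] → a ≡ b
      small {a} {b} a≤b b<D e with b ∸ a in eq | ≤∧≅⇒∣∸ a≤b e
      ... | zero  | _ = ≤-antisym a≤b (m∸n≡0⇒m≤n eq)
      ... | suc k | D∣ = ⊥-elim (<⇒≱ (≤-<-trans (m∸n≤m b a) b<D) (subst (D ≤_) (sym eq) (∣⇒≤ D∣)))
      case-≤ : a ≤ b ⊎ b ≤ a → a ≡ b
      case-≤ (inj₁ a≤b) = small a≤b b<D e
      case-≤ (inj₂ b≤a) = sym (small b≤a a<D (≅-sym e))

    %-≅ : ∀ a .{{_ : NonZero D}} → a % D ≅ a [mod D ]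
    %-≅ a = a / D , 0 , trans (sym (m≡m%n+[m/n]*n a D)) (sym (+-identityʳ a))

  ≅-weaken : ∀ {d D a b} → d ∣ D → a ≅ b [mod D ] → a ≅ b [mod d ]
  ≅-weaken {d} {_} {a} {b} (divides q refl) (x , y , e) = x * q , y * q ,
    trans (cong (a +_) (*-assoc x q d)) (trans e (cong (b +_) (sym (*-assoc y q d))))

  ≅-unscale : ∀ d .{{_ : NonZero d}} {D a b} → d * a ≅ d * b [mod d * D ] → a ≅ b [mod D ]
  ≅-unscale d {D} {a} {b} (x , y , e) = x , y ,
    *-cancelˡ-≡ _ _ d (trans (sym (shuffle d a x D)) (trans e (shuffle d b y D)))
    where
    shuffle : ∀ d a x D → d * a + x * (d * D) ≡ d * (a + x * D)
    shuffle = solve-∀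

  abstract
    bézout : ∀ s D → 0 < D → ∃ λ u → u * s ≅ gcd s D [mod D ]
    bézout s D@(suc D′) _ with Bézout.identity (gcd-GCD s D)
    ... | Bézout.+- x y e = x , 0 , y , trans (+-identityʳ (x * s)) (sym e)
    -- The coefficient -x is represented by x (D - 1).
    ... | Bézout.-+ x y e = x * D′ , y , x * s , (begin
        x * D′ * s + y * D                  ≡⟨ cong (x * D′ * s +_) (sym e) ⟩
        x * D′ * s + (gcd s D + x * s)      ≡⟨ shuffle x D′ s (gcd s D) ⟩
        gcd s D + x * s * D                 ∎)
      where
      open ≡-Reasoning
      shuffle : ∀ x D′ s d → x * D′ * s + (d + x * s) ≡ d + x * s * suc D′
      shuffle = solve-∀

    inverse : ∀ v o → 0 < o → gcd v o ≡ 1 → ∃ λ u → u < o × u * v ≅ 1 [mod o ]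
    inverse v o@(suc _) 0<o cop =
      let u , e = bézout v o 0<o
      in u % o , m%n<n u o , ≅-trans (≅-*ʳ v (%-≅ u)) (subst (λ d → u * v ≅ d [mod o ]) cop e)

  unit⇒coprime : ∀ u v o → u * v ≅ 1 [mod o ] → gcd v o ≡ 1
  unit⇒coprime u v o e = ∣1⇒≡1 (≅-∣ (gcd[m,n]∣n v o) e (∣n⇒∣m*n u (gcd[m,n]∣m v o)))

  inverse-unique : ∀ {u w v o} → u * v ≅ 1 [mod o ] → w * v ≅ 1 [mod o ] → u ≅ w [mod o ]
  inverse-unique {u} {w} {v} {o} e e′ =
    ≅-trans (≅-reflexive (sym (*-identityʳ u))) (≅-trans (≅-*ˡ u (≅-sym e′))
      (≅-trans (≅-reflexive (shuffle u w v)) (≅-trans (≅-*ˡ w e) (≅-reflexive (*-identityʳ w)))))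
    where
    shuffle : ∀ u w v → u * (w * v) ≡ w * (u * v)
    shuffle = solve-∀

  gcd-positive : ∀ s {D} → 0 < D → 0 < gcd s D
  gcd-positive s {D} 0<D with gcd s D in eq
  ... | suc _ = s≤s z≤n
  ... | zero  = ⊥-elim (<⇒≢ 0<D (sym (0∣⇒≡0 (subst (_∣ D) eq (gcd[m,n]∣n s D)))))

  factor-positiveˡ : ∀ c {o} → 0 < c * o → 0 < c
  factor-positiveˡ (suc _) _ = s≤s z≤n

  factor-positiveʳ : ∀ c {o} → 0 < c * o → 0 < o
  factor-positiveʳ c {o} p = factor-positiveˡ o (subst (0 <_) (*-comm c o) p)

  abstract
    -- The order of s in ℤ/D.
    order : ℕ → ℕ → ℕ
    order s D = quotient (gcd[m,n]∣n s D)

    order*gcd : ∀ s D → D ≡ order s D * gcd s D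
    order*gcd s D = m∣n⇒n≡quotient*m (gcd[m,n]∣n s D)

  order-positive : ∀ s {D} → 0 < D → 0 < order s D
  order-positive s {D} 0<D with order s D in eq
  ... | suc _ = s≤s z≤n
  ... | zero  = ⊥-elim (<⇒≢ 0<D (sym (trans (order*gcd s D) (cong (_* gcd s D) eq))))

  order-multiple : ∀ {D c o v} → 0 < D → D ≡ c * o → gcd v o ≡ 1 → gcd (c * v) D ≡ c × order (c * v) D ≡ o
  order-multiple {D} {c} {o} {v} 0<D refl cop = g , *-cancelʳ-≡ _ _ c {{>-nonZero 0<c}} (begin
      order (c * v) D * c               ≡⟨ cong (order (c * v) D *_) (sym g) ⟩
      order (c * v) D * gcd (c * v) D   ≡⟨ order*gcd (c * v) D ⟨
      c * o                             ≡⟨ *-comm c o ⟩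
      o * c                             ∎)
    where
    open ≡-Reasoning
    g : gcd (c * v) (c * o) ≡ c
    g = trans (sym (c*gcd[m,n]≡gcd[cm,cn] c v o)) (trans (cong (c *_) cop) (*-identityʳ c))
    0<c : 0 < c
    0<c = factor-positiveˡ c 0<D

  -- Write s = v c and D = o c with c = gcd(s, D). Cancelling c turns D ∣ u s into o ∣ u v, and v is
  -- coprime to o.
  ∣*⇔order∣ : ∀ {D} → 0 < D → ∀ s u → (D ∣ u * s → order s D ∣ u) × (order s D ∣ u → D ∣ u * s)
  ∣*⇔order∣ {D} 0<D s u = to , from
    where
    c = gcd s D
    o = order s D
    instance
      c≢0 : NonZero c
      c≢0 = >-nonZero (gcd-positive s 0<D)
    v = quotient (gcd[m,n]∣m s D)
    s≡ : s ≡ v * c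
    s≡ = m∣n⇒n≡quotient*m (gcd[m,n]∣m s D)
    cop : gcd v o ≡ 1
    cop = *-cancelˡ-≡ _ _ c (trans (c*gcd[m,n]≡gcd[cm,cn] c v o)
      (trans (cong₂ gcd (trans (*-comm c v) (sym s≡)) (trans (*-comm c o) (sym (order*gcd s D)))) (sym (*-identityʳ c))))
    to : D ∣ u * s → o ∣ u
    to d = coprime-divisor {n = v} (coprime-sym (gcd≡1⇒coprime cop))
      (*-cancelʳ-∣ c (subst₂ _∣_ (order*gcd s D) (trans (cong (u *_) s≡) (trans (sym (*-assoc u v c)) (cong (_* c) (*-comm u v)))) d))
    from : o ∣ u → D ∣ u * s
    from (divides q refl) = divides (q * v) (begin
        q * o * s         ≡⟨ cong (q * o *_) s≡ ⟩
        q * o * (v * c)   ≡⟨ shuffle q o v c ⟩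
        q * v * (o * c)   ≡⟨ cong (q * v *_) (order*gcd s D) ⟨
        q * v * D         ∎)
      where
      open ≡-Reasoning
      shuffle : ∀ q o v c → q * o * (v * c) ≡ q * v * (o * c)
      shuffle = solve-∀

  Even Odd : ℕ → Set
  Even o = ∃ λ q → o ≡ 2 * q
  Odd o = ∃ λ q → o ≡ 1 + 2 * q

  parity : ∀ o → Even o ⊎ Odd o
  parity zero = inj₁ (0 , refl)
  parity (suc o) with parity o
  ... | inj₁ (q , refl) = inj₂ (q , refl)
  ... | inj₂ (q , refl) = inj₁ (suc q , sym (*-suc 2 q))

  -- Boolean searches

  does⇒ : ∀ {p} {P : Set p} (d : Dec P) → does d ≡ true → P
  does⇒ (yes p) _ = p

  ¬does⇒ : ∀ {p} {P : Set p} (d : Dec P) → does d ≡ false → ¬ P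
  ¬does⇒ (no ¬p) _ = ¬p

  false≢true : false ≢ true
  false≢true ()

  true⇒T : ∀ {b} → b ≡ true → T b
  true⇒T refl = _

  T⇒true : ∀ {b} → T b → b ≡ true
  T⇒true {true} _ = refl

  any-true : ∀ {a} {A : Set a} (p : A → Bool) {xs x} → x ∈ xs → p x ≡ true → any p xs ≡ true
  any-true p {x ∷ xs} (here refl) e rewrite e = refl
  any-true p {x ∷ xs} (there q) e with p x
  ... | true  = refl
  ... | false = any-true p q e

  any-witness : ∀ {a} {A : Set a} (p : A → Bool) xs → any p xs ≡ true → ∃ λ x → x ∈ xs × p x ≡ true
  any-witness p (x ∷ xs) e with p x in eq
  ... | true  = x , here refl , eq
  ... | false = let y , q , e′ = any-witness p xs e in y , there q , e′

  all-lookup : ∀ {a} {A : Set a} (p : A → Bool) {xs x} → all p xs ≡ true → x ∈ xs → p x ≡ true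
  all-lookup p {x ∷ xs} e q with p x in eq
  all-lookup p {x ∷ xs} e (here refl) | true = eq
  all-lookup p {x ∷ xs} e (there q)   | true = all-lookup p e q

  all-true : ∀ {a} {A : Set a} (p : A → Bool) xs → (∀ {x} → x ∈ xs → p x ≡ true) → all p xs ≡ true
  all-true p [] h = refl
  all-true p (x ∷ xs) h rewrite h (here refl) = all-true p xs (λ q → h (there q))

  any-cong : ∀ {a} {A : Set a} {p q : A → Bool} (xs : List A) → (∀ x → p x ≡ q x) → any p xs ≡ any q xs
  any-cong [] e = refl
  any-cong {p = p} {q} (x ∷ xs) e rewrite e x with q x
  ... | true  = refl
  ... | false = any-cong xs e

  firstL-cong : ∀ {A : Set} {d : A} {p q : A → Bool} (xs : List A) → (∀ x → p x ≡ q x) → firstL d p xs ≡ firstL d q xs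
  firstL-cong [] e = refl
  firstL-cong {p = p} {q} (x ∷ xs) e rewrite e x with q x
  ... | true  = refl
  ... | false = firstL-cong xs e

  firstL-satisfies : ∀ {A : Set} (d : A) (p : A → Bool) {xs x} → x ∈ xs → p x ≡ true → p (firstL d p xs) ≡ true
  firstL-satisfies d p {x ∷ xs} q e with p x in eq
  ... | true = eq
  firstL-satisfies d p {x ∷ xs} (here refl) e | false with trans (sym eq) e
  ... | ()
  firstL-satisfies d p {x ∷ xs} (there q) e | false = firstL-satisfies d p q e

  firstN-applyUpTo : ∀ (p : ℕ → Bool) f N {t} → t < N → p (f t) ≡ true →
    ∃ λ r → r < N × firstN p (applyUpTo f N) ≡ f r × p (f r) ≡ true × (∀ q → q < r → p (f q) ≡ false)
  firstN-applyUpTo p f (suc N) {t} t<N e with p (f 0) in eq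
  ... | true = 0 , s≤s z≤n , refl , eq , λ _ ()
  firstN-applyUpTo p f (suc N) {zero} t<N e | false with trans (sym eq) e
  ... | ()
  firstN-applyUpTo p f (suc N) {suc t} (s≤s t<N) e | false =
    let r , r<N , e₁ , e₂ , least = firstN-applyUpTo p (f ∘ suc) N t<N e
    in suc r , s≤s r<N , e₁ , e₂ , λ { zero _ → eq ; (suc q) (s≤s q<r) → least q q<r }

  -- Signed permutations as maps on letters

  infix 4 _≟L_ _≟W_

  _≟L_ : ∀ {n} → DecidableEquality (Letter n)
  _≟L_ = ×-dec _≟B_ Finₚ._≟_

  _≟W_ : ∀ {n} → DecidableEquality (SP n)
  _≟W_ = vec-dec _≟L_

  idx : ∀ {n} → Letter n → Fin n
  idx = proj₂

  module _ {n : ℕ} where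

    negL-involutive : (a : Letter n) → negL (negL a) ≡ a
    negL-involutive (s , i) = cong (_, i) (not-involutive s)

    negL≢ : (a : Letter n) → negL a ≢ a
    negL≢ (false , i) ()
    negL≢ (true , i) ()

    negL-injective : {a b : Letter n} → negL a ≡ negL b → a ≡ b
    negL-injective {a} {b} e = trans (sym (negL-involutive a)) (trans (cong negL e) (negL-involutive b))

    idx-≡ : {a b : Letter n} → idx a ≡ idx b → a ≡ b ⊎ a ≡ negL b
    idx-≡ {false , i} {false , .i} refl = inj₁ refl
    idx-≡ {false , i} {true , .i} refl = inj₂ refl
    idx-≡ {true , i} {false , .i} refl = inj₂ refl
    idx-≡ {true , i} {true , .i} refl = inj₁ refl

    apply-neg : (w : SP n) (a : Letter n) → apply w (negL a) ≡ negL (apply w a)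
    apply-neg w (false , i) = refl
    apply-neg w (true , i) = cong (_, proj₂ (lookup w i)) (sym (not-involutive (proj₁ (lookup w i))))

    apply-∘ : (w v : SP n) (a : Letter n) → apply (w ∘B v) a ≡ apply w (apply v a)
    apply-∘ w v (s , i) rewrite lookup∘tabulate (λ i → apply w (lookup v i)) i =
      cong (_, _) (sym (xor-assoc s (proj₁ (lookup v i)) (proj₁ (lookup w (proj₂ (lookup v i))))))

    apply-tabulate : (f : Letter n → Letter n) → (∀ a → f (negL a) ≡ negL (f a)) →
                     ∀ a → apply (tabulate (λ i → f (false , i))) a ≡ f a
    apply-tabulate f f-neg (false , i) = lookup∘tabulate _ i
    apply-tabulate f f-neg (true , i) = trans (cong (λ b → (true xor proj₁ b) , proj₂ b) (lookup∘tabulate (λ i → f (false , i)) i)) (sym (f-neg (false , i)))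

    apply-id : (a : Letter n) → apply idB a ≡ a
    apply-id = apply-tabulate id (λ _ → refl)

    apply-ext : {w v : SP n} → (∀ a → apply w a ≡ apply v a) → w ≡ v
    apply-ext {w} {v} e = trans (sym (tabulate∘lookup w)) (trans (tabulate-cong (λ i → e (false , i))) (tabulate∘lookup v))

    record Perm (w : SP n) : Set where
      constructor perm
      field
        apply-injective : ∀ {a b} → apply w a ≡ apply w b → a ≡ b
    open Perm public

    record Commute (x z : SP n) : Set where
      constructor commuting
      field
        apply-comm : ∀ a → apply x (apply z a) ≡ apply z (apply x a)
    open Commute public

    Commute-sym : ∀ {x z} → Commute x z → Commute z x
    Commute-sym c = commuting λ a → sym (apply-comm c a)

    commute? : (x z : SP n) → Dec (x ∘B z ≡ z ∘B x)
    commute? x z = x ∘B z ≟W z ∘B x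

    ∘B⇒Commute : ∀ {x z} → x ∘B z ≡ z ∘B x → Commute x z
    ∘B⇒Commute {x} {z} e = commuting λ a → trans (sym (apply-∘ x z a)) (trans (cong (λ w → apply w a) e) (apply-∘ z x a))

    Commute⇒∘B : ∀ {x z} → Commute x z → x ∘B z ≡ z ∘B x
    Commute⇒∘B {x} {z} c = apply-ext λ a → trans (apply-∘ x z a) (trans (apply-comm c a) (sym (apply-∘ z x a)))

    module _ (x : SP n) where

      iterL-+ : ∀ a s t → iterL x a (s + t) ≡ iterL x (iterL x a t) s
      iterL-+ a zero t = refl
      iterL-+ a (suc s) t = cong (apply x) (iterL-+ a s t)

      iterL-sucʳ : ∀ a t → iterL x a (suc t) ≡ iterL x (apply x a) t
      iterL-sucʳ a zero = refl
      iterL-sucʳ a (suc t) = cong (apply x) (iterL-sucʳ a t)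

      iterL-neg : ∀ a t → iterL x (negL a) t ≡ negL (iterL x a t)
      iterL-neg a zero = refl
      iterL-neg a (suc t) = trans (cong (apply x) (iterL-neg a t)) (apply-neg x (iterL x a t))

      apply-powB : ∀ t a → apply (powB x t) a ≡ iterL x a t
      apply-powB zero a = apply-id a
      apply-powB (suc t) a = trans (apply-∘ x (powB x t) a) (cong (apply x) (apply-powB t a))

      idx-iterL : ∀ {a b} t → idx a ≡ idx b → idx (iterL x a t) ≡ idx (iterL x b t)
      idx-iterL {a} {b} t e with idx-≡ {a} {b} e
      ... | inj₁ refl = refl
      ... | inj₂ refl = cong idx (iterL-neg b t)

    iterL-apply : ∀ {x z} → Commute x z → ∀ a t → iterL x (apply z a) t ≡ apply z (iterL x a t)
    iterL-apply c a zero = refl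
    iterL-apply {x} c a (suc t) = trans (cong (apply x) (iterL-apply c a t)) (apply-comm c (iterL x a t))

    iterL-comm : ∀ {x z} → Commute x z → ∀ a s t → iterL x (iterL z a t) s ≡ iterL z (iterL x a s) t
    iterL-comm c a s zero = refl
    iterL-comm {x} {z} c a s (suc t) = trans (iterL-apply c _ s) (cong (apply z) (iterL-comm c a s t))

    -- Serves the pigeonhole principle: among 2n + 1 iterates of a letter two coincide.
    encode : Letter n → Fin (2 * n)
    encode (false , i) = combine {2} fzero i
    encode (true , i)  = combine {2} (fsuc fzero) i

    encode-injective : ∀ a b → encode a ≡ encode b → a ≡ b
    encode-injective (false , i) (false , j) e = cong (false ,_) (proj₂ (Finₚ.combine-injective {2} fzero i fzero j e))
    encode-injective (true , i) (true , j) e = cong (true ,_) (proj₂ (Finₚ.combine-injective {2} (fsuc fzero) i (fsuc fzero) j e))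
    encode-injective (false , i) (true , j) e with proj₁ (Finₚ.combine-injective {2} fzero i (fsuc fzero) j e)
    ... | ()
    encode-injective (true , i) (false , j) e with proj₁ (Finₚ.combine-injective {2} (fsuc fzero) i fzero j e)
    ... | ()

    module _ {x : SP n} (px : Perm x) where

      iterL-injective : ∀ {a b} t → iterL x a t ≡ iterL x b t → a ≡ b
      iterL-injective zero e = e
      iterL-injective (suc t) e = iterL-injective t (apply-injective px e)

      idx-iterL-injective : ∀ {a b} t → idx (iterL x a t) ≡ idx (iterL x b t) → idx a ≡ idx b
      idx-iterL-injective {a} {b} t e with idx-≡ {iterL x a t} {iterL x b t} e
      ... | inj₁ e′ = cong idx (iterL-injective t e′)
      ... | inj₂ e′ = cong idx (iterL-injective {a} {negL b} t (trans e′ (sym (iterL-neg x b t))))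

      iterL-cancel : ∀ {a} s t → s ≤ t → iterL x a s ≡ iterL x a t → iterL x a (t ∸ s) ≡ a
      iterL-cancel {a} s t s≤t e = iterL-injective s (trans (sym (iterL-+ x a s (t ∸ s))) (trans (cong (iterL x a) (m+[n∸m]≡n s≤t)) (sym e)))

      idx-iterL-cancel : ∀ {a} s t → s ≤ t → idx (iterL x a s) ≡ idx (iterL x a t) → idx (iterL x a (t ∸ s)) ≡ idx a
      idx-iterL-cancel {a} s t s≤t e = idx-iterL-injective s (trans (cong idx (trans (sym (iterL-+ x a s (t ∸ s))) (cong (iterL x a) (m+[n∸m]≡n s≤t)))) (sym e))

      return-time : ∀ a → ∃ λ t → 0 < t × t ≤ 2 * n × iterL x a t ≡ a
      return-time a with Finₚ.pigeonhole (n<1+n (2 * n)) (λ i → encode (iterL x a (toℕ i)))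
      ... | i , j , i<j , e = toℕ j ∸ toℕ i , m<n⇒0<n∸m i<j ,
            ≤-trans (m∸n≤m (toℕ j) (toℕ i)) (≤-pred (Finₚ.toℕ<n j)) ,
            iterL-cancel (toℕ i) (toℕ j) (<⇒≤ i<j) (encode-injective _ _ e)

      -- Only n absolute values are available, so the pigeonhole principle already applies to n + 1
      -- iterates. This bounds the length of a cycle of class +1 by n.
      idx-return-time : ∀ a → ∃ λ t → 0 < t × t ≤ n × idx (iterL x a t) ≡ idx a
      idx-return-time a with Finₚ.pigeonhole (n<1+n n) (λ i → idx (iterL x a (toℕ i)))
      ... | i , j , i<j , e = toℕ j ∸ toℕ i , m<n⇒0<n∸m i<j ,
            ≤-trans (m∸n≤m (toℕ j) (toℕ i)) (≤-pred (Finₚ.toℕ<n j)) ,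
            idx-iterL-cancel (toℕ i) (toℕ j) (<⇒≤ i<j) e

      return-positive : ∀ a → ∃ λ b → apply x b ≡ a
      return-positive a with return-time a
      ... | suc t , _ , _ , e = iterL x a t , e

    -- The order counts letters: it is the length of a cycle of class +1 but twice the length of one
    -- of class -1. Stating it by divisibility makes it unique and easy to carry along maps.
    record IsOrder (x : SP n) (a : Letter n) (o : ℕ) : Set where
      constructor isOrder
      field
        positive : 0 < o
        order⇒   : ∀ {t} → iterL x a t ≡ a → o ∣ t
        ⇒order   : ∀ {t} → o ∣ t → iterL x a t ≡ a
    open IsOrder public

    iterL-multiple : ∀ (x : SP n) {a o} q → iterL x a o ≡ a → iterL x a (q * o) ≡ a
    iterL-multiple x zero e = refl
    iterL-multiple x {a} {o} (suc q) e = trans (iterL-+ x a o (q * o)) (trans (cong (λ b → iterL x b o) (iterL-multiple x q e)) e)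

    least⇒IsOrder : ∀ (x : SP n) {a o} → 0 < o → iterL x a o ≡ a → (∀ t → 0 < t → t < o → iterL x a t ≢ a) → IsOrder x a o
    least⇒IsOrder x {a} {o} 0<o e least = isOrder 0<o div (λ { (divides q refl) → iterL-multiple x q e })
      where
      instance
        o≢0 : NonZero o
        o≢0 = >-nonZero 0<o
      div : ∀ {t} → iterL x a t ≡ a → o ∣ t
      div {t} e′ with t % o in eq | m%n<n t o
      ... | zero | _ = m%n≡0⇒n∣m t o eq
      ... | suc r | r<o = ⊥-elim (least (suc r) (s≤s z≤n) r<o (trans (cong (iterL x a) (sym eq)) (trans (sym (begin
              iterL x a t                                 ≡⟨ cong (iterL x a) (m≡m%n+[m/n]*n t o) ⟩
              iterL x a (t % o + t / o * o)               ≡⟨ iterL-+ x a (t % o) (t / o * o) ⟩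
              iterL x (iterL x a (t / o * o)) (t % o)     ≡⟨ cong (λ b → iterL x b (t % o)) (iterL-multiple x (t / o) e) ⟩
              iterL x a (t % o)                           ∎)) e′)))
        where open ≡-Reasoning

    IsOrder-unique : ∀ {x a o o′} → IsOrder x a o → IsOrder x a o′ → o ≡ o′
    IsOrder-unique p q = ∣-antisym (order⇒ p (⇒order q ∣-refl)) (order⇒ q (⇒order p ∣-refl))

    orbitSize-IsOrder : ∀ {x} → Perm x → ∀ a → IsOrder x a (orbitSize x a) × orbitSize x a ≤ 2 * n
    orbitSize-IsOrder {x} px a with return-time px a
    ... | suc t , _ , t≤2n , e with firstN-applyUpTo (λ t → letterEq (iterL x a t) a) suc (2 * n) t≤2n (dec-true (iterL x a (suc t) ≟L a) e)
    ... | r , r<2n , eq , e′ , least rewrite eq =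
      least⇒IsOrder x (s≤s z≤n) (does⇒ (iterL x a (suc r) ≟L a) e′)
        (λ { (suc q) _ (s≤s q<r) → ¬does⇒ (iterL x a (suc q) ≟L a) (least q q<r) }) , r<2n

    IsOrder-orbitSize : ∀ {x} → Perm x → ∀ {a o} → IsOrder x a o → orbitSize x a ≡ o
    IsOrder-orbitSize px {a} i = IsOrder-unique (proj₁ (orbitSize-IsOrder px a)) i

    iterL-≅ : ∀ {x a o s t} → IsOrder x a o → s ≅ t [mod o ] → iterL x a s ≡ iterL x a t
    iterL-≅ {x} {a} {o} {s} {t} i (y , z , e) = trans (sym (drop s y)) (trans (cong (iterL x a) e) (drop t z))
      where
      drop : ∀ s y → iterL x a (s + y * o) ≡ iterL x a s
      drop s y = trans (iterL-+ x a s (y * o)) (cong (λ b → iterL x b s) (⇒order i (n∣m*n y)))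

    ≅-iterL : ∀ {x a o s t} → Perm x → IsOrder x a o → iterL x a s ≡ iterL x a t → s ≅ t [mod o ]
    ≅-iterL {x} {a} {o} {s} {t} px i e with ≤-total s t
    ... | inj₁ s≤t = subst (s ≅_[mod o ]) (m∸n+n≡m s≤t)
                       (≅-+ {b = t ∸ s} (≅-sym (∣⇒≅0 (order⇒ i (iterL-cancel px s t s≤t e)))) (≅-reflexive refl))
    ... | inj₂ t≤s = ≅-sym (subst (t ≅_[mod o ]) (m∸n+n≡m t≤s)
                       (≅-+ {b = s ∸ t} (≅-sym (∣⇒≅0 (order⇒ i (iterL-cancel px t s t≤s (sym e))))) (≅-reflexive refl)))

    -- Cycles of class −1

    NegC : SP n → Letter n → Set
    NegC x a = ∃ λ t → iterL x a t ≡ negL a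

    negC? : SP n → Letter n → Bool
    negC? x a = any (λ t → letterEq (iterL x a t) (negL a)) (upTo (2 * n))

    negC?-sound : ∀ x a → negC? x a ≡ true → NegC x a
    negC?-sound x a e with any-witness (λ t → letterEq (iterL x a t) (negL a)) (upTo (2 * n)) e
    ... | t , _ , e′ = t , does⇒ (iterL x a t ≟L negL a) e′

    -- The search runs below 2n; a witness is first reduced modulo the order of a, which is at most
    -- 2n.
    negC?-complete : ∀ {x a} → Perm x → NegC x a → negC? x a ≡ true
    negC?-complete {x} {a} px (t , e) with orbitSize-IsOrder px a
    ... | i , o≤2n = any-true (λ t → letterEq (iterL x a t) (negL a)) (∈-upTo⁺ (<-≤-trans (m%n<n t o) o≤2n))
                       (dec-true (iterL x a (t % o) ≟L negL a) (trans (iterL-≅ i (%-≅ t)) e))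
      where
      o = orbitSize x a
      instance
        o≢0 : NonZero o
        o≢0 = >-nonZero (positive i)

    NegC-dec : ∀ {x} → Perm x → ∀ a → Dec (NegC x a)
    NegC-dec {x} px a with negC? x a in eq
    ... | true  = yes (negC?-sound x a eq)
    ... | false = no λ nc → false≢true (trans (sym eq) (negC?-complete px nc))

    negC?-false : ∀ {x a} → ¬ NegC x a → negC? x a ≡ false
    negC?-false {x} {a} ¬nc with negC? x a in eq
    ... | true  = ⊥-elim (¬nc (negC?-sound x a eq))
    ... | false = refl

    -- From x^h a = -a follows x^(2h) a = a, so an odd order would divide 2h and hence h, giving x^h
    -- a = a.
    NegC⇒even : ∀ {x a o} → IsOrder x a o → NegC x a → ∃ λ q → o ≡ 2 * q
    NegC⇒even {x} {a} {o} i (h , e) with parity o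
    ... | inj₁ even = even
    ... | inj₂ (q , refl) = ⊥-elim (negL≢ a (trans (sym e) (⇒order i o∣h)))
      where
      o∣2h : o ∣ h + h
      o∣2h = order⇒ i (trans (iterL-+ x a h h) (trans (cong (λ b → iterL x b h) e) (trans (iterL-neg x a h) (trans (cong negL e) (negL-involutive a)))))
      o∣h : o ∣ h
      o∣h = ∣m+n∣m⇒∣n (subst (o ∣_) (shuffle q h) (∣n⇒∣m*n (suc q) o∣2h)) (∣m⇒∣m*n h ∣-refl)
        where
        shuffle : ∀ q h → suc q * (h + h) ≡ (1 + 2 * q) * h + h
        shuffle = solve-∀

    -- On a cycle of class +1 the absolute value of a recurs only together with its sign, and it
    -- recurs within n steps.
    ¬NegC⇒≤ : ∀ {x a o} → Perm x → IsOrder x a o → ¬ NegC x a → o ≤ n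
    ¬NegC⇒≤ {x} {a} {o} px i ¬nc with idx-return-time px a
    ... | t , 0<t , t≤n , e with idx-≡ {iterL x a t} {a} e
    ... | inj₁ e′ = ≤-trans (∣⇒≤ {{>-nonZero 0<t}} (order⇒ i e′)) t≤n
    ... | inj₂ e′ = ⊥-elim (¬nc (t , e′))

    -- Inverses and membership in B_n

    invB-apply : (w : SP n) → isSignedPerm w ≡ true → ∀ a → apply w (apply (invB w) a) ≡ a
    invB-apply w sp (s , j) rewrite lookup∘tabulate (λ j → let i = firstL j (λ i → does (proj₂ (lookup w i) Finₚ.≟ j)) (allFin n) in (proj₁ (lookup w i) , i)) j =
      cong₂ _,_ (trans (xor-assoc s _ _) (trans (cong (s xor_) (xor-same (proj₁ (lookup w i)))) (xor-false s))) hit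
      where
      i = firstL j (λ i → does (proj₂ (lookup w i) Finₚ.≟ j)) (allFin n)
      xor-false : ∀ s → s xor false ≡ s
      xor-false false = refl
      xor-false true = refl
      hit : proj₂ (lookup w i) ≡ j
      hit with any-witness (λ i → does (proj₂ (lookup w i) Finₚ.≟ j)) (allFin n) (all-lookup (λ j → any (λ i → does (proj₂ (lookup w i) Finₚ.≟ j)) (allFin n)) sp (∈-allFin j))
      ... | k , k∈ , e = does⇒ (proj₂ (lookup w i) Finₚ.≟ j) (firstL-satisfies j (λ i → does (proj₂ (lookup w i) Finₚ.≟ j)) k∈ e)

    Perm-rightInverse : {w v : SP n} → (∀ a → apply w (apply v a) ≡ a) → Perm v
    Perm-rightInverse {w} r = perm λ {a} {b} e → trans (sym (r a)) (trans (cong (apply w) e) (r b))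

    -- A right inverse v of w is injective, hence surjective because every letter lies on a cycle of
    -- v.
    rightInverse⇒leftInverse : {w v : SP n} → (∀ a → apply w (apply v a) ≡ a) → ∀ a → apply v (apply w a) ≡ a
    rightInverse⇒leftInverse {w} {v} r a =
      let b , e = return-positive (Perm-rightInverse {w} {v} r) a
      in trans (cong (λ c → apply v (apply w c)) (sym e)) (trans (cong (apply v) (r b)) e)

    isSignedPerm⇒Perm : (w : SP n) → isSignedPerm w ≡ true → Perm w
    isSignedPerm⇒Perm w sp = Perm-rightInverse {invB w} {w} (rightInverse⇒leftInverse {w} {invB w} (invB-apply w sp))

    Perm⇒isSignedPerm : (w : SP n) → Perm w → isSignedPerm w ≡ true
    Perm⇒isSignedPerm w pw = all-true (λ j → any (λ i → does (proj₂ (lookup w i) Finₚ.≟ j)) (allFin n)) (allFin n) λ {j} _ →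
      let b , e = return-positive pw (false , j)
      in any-true (λ i → does (proj₂ (lookup w i) Finₚ.≟ j)) (∈-allFin (idx b)) (dec-true (proj₂ (lookup w (idx b)) Finₚ.≟ j) (cong idx e))

    module _ {w : SP n} (pw : Perm w) where

      inverseʳ : ∀ a → apply w (apply (invB w) a) ≡ a
      inverseʳ = invB-apply w (Perm⇒isSignedPerm w pw)

      inverseˡ : ∀ a → apply (invB w) (apply w a) ≡ a
      inverseˡ = rightInverse⇒leftInverse {w} {invB w} inverseʳ

      Perm-inv : Perm (invB w)
      Perm-inv = Perm-rightInverse {w} {invB w} inverseʳ

    Perm-∘ : {w v : SP n} → Perm w → Perm v → Perm (w ∘B v)
    Perm-∘ {w} {v} pw pv = perm λ {a} {b} e → apply-injective pv {a} {b} (apply-injective pw (trans (sym (apply-∘ w v a)) (trans e (apply-∘ w v b))))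

    Perm-id : Perm idB
    Perm-id = perm λ {a} {b} e → trans (sym (apply-id a)) (trans e (apply-id b))

    Commute-id : (y : SP n) → Commute y idB
    Commute-id y = commuting λ a → trans (cong (apply y) (apply-id a)) (sym (apply-id (apply y a)))

    Perm-conj : {h x : SP n} → Perm h → Perm x → Perm (conjB h x)
    Perm-conj ph px = Perm-∘ (Perm-∘ ph px) (Perm-inv ph)

    apply-conj : (h x : SP n) → ∀ a → apply (conjB h x) a ≡ apply h (apply x (apply (invB h) a))
    apply-conj h x a = trans (apply-∘ (h ∘B x) (invB h) a) (apply-∘ h x (apply (invB h) a))

  concatMap-map : ∀ {A B C : Set} (f : A → B → C) xs ys → concatMap (λ x → map (f x) ys) xs ≡ cartesianProductWith f xs ys
  concatMap-map f [] ys = refl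
  concatMap-map f (x ∷ xs) ys = cong (_ ++_) (concatMap-map f xs ys)

  signs : List Bool
  signs = false ∷ true ∷ []

  letters-product : ∀ n → letters n ≡ cartesianProductWith (λ i s → (s , i)) (allFin n) signs
  letters-product n = concatMap-map (λ i s → (s , i)) (allFin n) signs

  letters-unique : ∀ n → Unique (letters n)
  letters-unique n rewrite letters-product n =
    cartesianProductWith⁺ _ (λ { refl → refl , refl }) (allFin⁺ n) (((λ ()) ∷ []) ∷ [] ∷ [])

  ∈-letters : ∀ {n} (a : Letter n) → a ∈ letters n
  ∈-letters {n} (s , i) rewrite letters-product n = ∈-cartesianProductWith⁺ (λ i s → (s , i)) (∈-allFin i) (∈-signs s)
    where
    ∈-signs : ∀ s → s ∈ signs
    ∈-signs false = here refl
    ∈-signs true = there (here refl)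

  allVecs-product : ∀ m n → allVecs (suc m) n ≡ cartesianProductWith Vec._∷_ (letters n) (allVecs m n)
  allVecs-product m n = concatMap-map Vec._∷_ (letters n) (allVecs m n)

  allVecs-unique : ∀ m n → Unique (allVecs m n)
  allVecs-unique zero n = [] ∷ []
  allVecs-unique (suc m) n = subst Unique (sym (allVecs-product m n))
    (cartesianProductWith⁺ Vec._∷_ ∷-injective (letters-unique n) (allVecs-unique m n))

  ∈-allVecs : ∀ {m n} (v : Vec (Letter n) m) → v ∈ allVecs m n
  ∈-allVecs [] = here refl
  ∈-allVecs {suc m} {n} (a ∷ v) = subst ((a ∷ v) ∈_) (sym (allVecs-product m n))
    (∈-cartesianProductWith⁺ Vec._∷_ (∈-letters a) (∈-allVecs v))

  Bn-unique : ∀ n → Unique (Bn n)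
  Bn-unique n = Unique-filter⁺ (λ w → T? (isSignedPerm w)) (allVecs-unique n n)

  ∈-Bn⁺ : ∀ {n} {w : SP n} → Perm w → w ∈ Bn n
  ∈-Bn⁺ {n} {w} pw = ∈-filter⁺ (λ w → T? (isSignedPerm w)) (∈-allVecs w) (true⇒T (Perm⇒isSignedPerm w pw))

  ∈-Bn⁻ : ∀ {n} {w : SP n} → w ∈ Bn n → Perm w
  ∈-Bn⁻ {n} {w} w∈ = isSignedPerm⇒Perm w (T⇒true (proj₂ (∈-filter⁻ (λ w → T? (isSignedPerm w)) {xs = allVecs n n} w∈)))

  module _ {n : ℕ} where

    module _ {x : SP n} (px : Perm x) where

      private
        o : Letter n → ℕ
        o = orbitSize x
        ord : ∀ a → IsOrder x a (o a)
        ord a = proj₁ (orbitSize-IsOrder px a)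

      -- Since o - 1 steps undo one step on a cycle of order o, this many steps undo t of them.
      complement : Letter n → ℕ → ℕ
      complement a t = t * (o a ∸ 1)

      iterL-complement : ∀ a t → iterL x (iterL x a t) (complement a t) ≡ a
      iterL-complement a t = trans (sym (iterL-+ x a (complement a t) t)) (⇒order (ord a) (divides t eq))
        where
        eq : complement a t + t ≡ t * o a
        eq with o a | positive (ord a)
        ... | suc o′ | _ = trans (+-comm (t * o′) t) (sym (*-suc t o′))

      iterL-neg⇒NegC : ∀ a s t → iterL x a s ≡ negL (iterL x a t) → NegC x a
      iterL-neg⇒NegC a s t e = complement a t + s , (begin
          iterL x a (complement a t + s)                ≡⟨ iterL-+ x a (complement a t) s ⟩
          iterL x (iterL x a s) (complement a t)         ≡⟨ cong (λ b → iterL x b (complement a t)) e ⟩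
          iterL x (negL (iterL x a t)) (complement a t)  ≡⟨ iterL-neg x (iterL x a t) (complement a t) ⟩
          negL (iterL x (iterL x a t) (complement a t))  ≡⟨ cong negL (iterL-complement a t) ⟩
          negL a                                         ∎)
        where open ≡-Reasoning

    NegC-iterL : ∀ {x : SP n} a t → NegC x a → NegC x (iterL x a t)
    NegC-iterL {x} a t (h , e) = h , (begin
        iterL x (iterL x a t) h   ≡⟨ iterL-+ x a h t ⟨
        iterL x a (h + t)        ≡⟨ cong (iterL x a) (+-comm h t) ⟩
        iterL x a (t + h)        ≡⟨ iterL-+ x a t h ⟩
        iterL x (iterL x a h) t   ≡⟨ cong (λ b → iterL x b t) e ⟩
        iterL x (negL a) t        ≡⟨ iterL-neg x a t ⟩
        negL (iterL x a t)        ∎)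
      where open ≡-Reasoning

    NegC-neg : ∀ {x : SP n} {a} → NegC x a → NegC x (negL a)
    NegC-neg {x} {a} (h , e) = h , trans (iterL-neg x a h) (cong negL e)

    -- Equality of cycles up to sign

    infixr 4 _,_

    record SameCycle (x : SP n) (a b : Letter n) : Set where
      constructor _,_
      field
        steps   : ℕ
        reaches : idx (iterL x a steps) ≡ idx b

    SameCycle-refl : ∀ {x : SP n} {a} → SameCycle x a a
    SameCycle-refl = 0 , refl

    SameCycle-iterL : ∀ {x : SP n} a p → SameCycle x a (iterL x a p)
    SameCycle-iterL a p = p , refl

    SameCycle-trans : ∀ {x : SP n} {a b c} → SameCycle x a b → SameCycle x b c → SameCycle x a c
    SameCycle-trans {x} {a} {b} (p , e) (q , e′) =
      q + p , trans (cong idx (iterL-+ x a q p)) (trans (idx-iterL x {iterL x a p} {b} q e) e′)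

    SameCycle-sym : ∀ {x : SP n} {a b} → Perm x → SameCycle x a b → SameCycle x b a
    SameCycle-sym {x} {a} {b} px (p , e) =
      complement px a p , trans (idx-iterL x {b} {iterL x a p} (complement px a p) (sym e)) (cong idx (iterL-complement px a p))

    SameCycle-resp : ∀ {x : SP n} {a b a′ b′} → idx a ≡ idx a′ → idx b ≡ idx b′ → SameCycle x a b → SameCycle x a′ b′
    SameCycle-resp {x} {a} {b} {a′} ea eb (p , e) = p , trans (idx-iterL x {a′} {a} p (sym ea)) (trans e eb)

    SameCycle-commute : ∀ {x g : SP n} → Commute x g → ∀ {a b} q → SameCycle x a b → SameCycle x (iterL g a q) (iterL g b q)
    SameCycle-commute {x} {g} c {a} {b} q (p , e) = p , trans (cong idx (iterL-comm c a p q)) (idx-iterL g {iterL x a p} {b} q e)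

    SameCycle-cancel : ∀ {x g : SP n} → Perm g → Commute x g → ∀ {a b} q → SameCycle x (iterL g a q) (iterL g b q) → SameCycle x a b
    SameCycle-cancel {x} {g} pg c {a} {b} q (p , e) = p , idx-iterL-injective pg {iterL x a p} {b} q (trans (sym (cong idx (iterL-comm c a p q))) e)

    sameCycle? : SP n → Letter n → Letter n → Bool
    sameCycle? x a b = any (λ p → does (idx (iterL x a p) Finₚ.≟ idx b)) (upTo (2 * n))

    sameCycle?-sound : ∀ x a b → sameCycle? x a b ≡ true → SameCycle x a b
    sameCycle?-sound x a b e with any-witness (λ p → does (idx (iterL x a p) Finₚ.≟ idx b)) (upTo (2 * n)) e
    ... | p , _ , e′ = p , does⇒ (idx (iterL x a p) Finₚ.≟ idx b) e′

    sameCycle?-complete : ∀ {x : SP n} → Perm x → ∀ a b → SameCycle x a b → sameCycle? x a b ≡ true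
    sameCycle?-complete {x} px a b (p , e) = any-true (λ p → does (idx (iterL x a p) Finₚ.≟ idx b)) (∈-upTo⁺ (<-≤-trans (m%n<n p o) o≤2n))
        (dec-true (idx (iterL x a (p % o)) Finₚ.≟ idx b) (trans (cong idx (iterL-≅ i (%-≅ p))) e))
      where
      o = orbitSize x a
      i = proj₁ (orbitSize-IsOrder px a)
      o≤2n = proj₂ (orbitSize-IsOrder px a)
      instance
        o≢0 : NonZero o
        o≢0 = >-nonZero (positive i)

    SameCycle-dec : ∀ {x : SP n} → Perm x → ∀ a b → Dec (SameCycle x a b)
    SameCycle-dec {x} px a b with sameCycle? x a b in eq
    ... | true  = yes (sameCycle?-sound x a b eq)
    ... | false = no λ s → false≢true (trans (sym eq) (sameCycle?-complete px a b s))

    NegC-SameCycle : ∀ {x : SP n} {a b} → SameCycle x a b → NegC x a → NegC x b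
    NegC-SameCycle {x} {a} {b} (p , e) nc with idx-≡ {n} {iterL x a p} {b} e
    ... | inj₁ refl = NegC-iterL a p nc
    ... | inj₂ e′ = subst (NegC x) (trans (cong negL e′) (negL-involutive b)) (NegC-neg {x} {iterL x a p} (NegC-iterL a p nc))

    IsOrder-iterL : ∀ {x : SP n} → Perm x → ∀ {a o} p → IsOrder x a o → IsOrder x (iterL x a p) o
    IsOrder-iterL {x} px {a} p i = isOrder (positive i)
      (λ {t} e → order⇒ i (iterL-injective px p (trans (swap t) e)))
      (λ {t} d → trans (sym (swap t)) (cong (λ b → iterL x b p) (⇒order i d)))
      where
      swap : ∀ t → iterL x (iterL x a t) p ≡ iterL x (iterL x a p) t
      swap t = trans (sym (iterL-+ x a p t)) (trans (cong (iterL x a) (+-comm p t)) (iterL-+ x a t p))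

    IsOrder-neg : ∀ {x : SP n} {a o} → IsOrder x a o → IsOrder x (negL a) o
    IsOrder-neg {x} {a} i = isOrder (positive i)
      (λ {t} e → order⇒ i (negL-injective (trans (sym (iterL-neg x a t)) e)))
      (λ {t} d → trans (iterL-neg x a t) (cong negL (⇒order i d)))

    IsOrder-SameCycle : ∀ {x : SP n} → Perm x → ∀ {a b o} → SameCycle x a b → IsOrder x a o → IsOrder x b o
    IsOrder-SameCycle {x} px {a} {b} {o} (p , e) i with idx-≡ {n} {iterL x a p} {b} e
    ... | inj₁ refl = IsOrder-iterL px p i
    ... | inj₂ e′ = subst (λ c → IsOrder x c o) (trans (cong negL e′) (negL-involutive b)) (IsOrder-neg (IsOrder-iterL px p i))

    -- Both branches of cycleFactor at once: the sign is ignored on cycles of class +1.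
    AtPosition : SP n → Letter n → Letter n → ℕ → Set
    AtPosition x b a e = iterL x b e ≡ a ⊎ (¬ NegC x b × iterL x b e ≡ negL a)

    position : SP n → Letter n → Letter n → ℕ
    position x b a =
      firstN (λ e → letterEq (iterL x b e) a ∨ (not (negC? x b) ∧ letterEq (iterL x b e) (negL a))) (upTo (orbitSize x b))

    -- On a cycle of class -1 the sign has to match, and a wrong one is repaired by the h further
    -- steps that send b to -b.
    AtPosition-exists : ∀ {x : SP n} → Perm x → ∀ b a → SameCycle x b a → ∃ (AtPosition x b a)
    AtPosition-exists {x} px b a (p , e) with idx-≡ {n} {iterL x b p} {a} e
    ... | inj₁ e′ = p , inj₁ e′
    ... | inj₂ e′ with NegC-dec px b
    ...   | no ¬nc = p , inj₂ (¬nc , e′)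
    ...   | yes (h , eh) = p + h , inj₁ (begin
              iterL x b (p + h)         ≡⟨ iterL-+ x b p h ⟩
              iterL x (iterL x b h) p    ≡⟨ cong (λ c → iterL x c p) eh ⟩
              iterL x (negL b) p         ≡⟨ iterL-neg x b p ⟩
              negL (iterL x b p)         ≡⟨ cong negL e′ ⟩
              negL (negL a)              ≡⟨ negL-involutive a ⟩
              a                          ∎)
      where open ≡-Reasoning

    -- An exact hit and a negated hit together would put a letter and its negative on the cycle of
    -- b, against class +1.
    AtPosition-unique : ∀ {x : SP n} → Perm x → ∀ b a {o e e′} → IsOrder x b o →
                        AtPosition x b a e → AtPosition x b a e′ → e ≅ e′ [mod o ]
    AtPosition-unique px b a i (inj₁ p) (inj₁ p′) = ≅-iterL px i (trans p (sym p′))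
    AtPosition-unique px b a i (inj₂ (_ , p)) (inj₂ (_ , p′)) = ≅-iterL px i (trans p (sym p′))
    AtPosition-unique px b a {e = e} {e′} i (inj₁ p) (inj₂ (¬nc , p′)) = ⊥-elim (¬nc (iterL-neg⇒NegC px b e′ e (trans p′ (cong negL (sym p)))))
    AtPosition-unique px b a {e = e} {e′} i (inj₂ (¬nc , p)) (inj₁ p′) = ⊥-elim (¬nc (iterL-neg⇒NegC px b e e′ (trans p (cong negL (sym p′)))))

    AtPosition-≅ : ∀ {x : SP n} {b a o e e′} → IsOrder x b o → e ≅ e′ [mod o ] → AtPosition x b a e → AtPosition x b a e′
    AtPosition-≅ i c (inj₁ p) = inj₁ (trans (sym (iterL-≅ i c)) p)
    AtPosition-≅ i c (inj₂ (¬nc , p)) = inj₂ (¬nc , trans (sym (iterL-≅ i c)) p)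

    AtPosition-trans : ∀ {x : SP n} a b c {e f} → AtPosition x a b e → AtPosition x b c f → AtPosition x a c (f + e)
    AtPosition-trans {x} a b c {e} {f} r s = go r s
      where
      step : iterL x a (f + e) ≡ iterL x (iterL x a e) f
      step = iterL-+ x a f e
      neg-step : iterL x a e ≡ negL b → iterL x a (f + e) ≡ negL (iterL x b f)
      neg-step p = trans step (trans (cong (λ d → iterL x d f) p) (iterL-neg x b f))
      go : AtPosition x a b e → AtPosition x b c f → AtPosition x a c (f + e)
      go (inj₁ p) (inj₁ q) = inj₁ (trans step (trans (cong (λ d → iterL x d f) p) q))
      go (inj₁ p) (inj₂ (¬nc , q)) = inj₂ ((λ nc → ¬nc (subst (NegC x) p (NegC-iterL a e nc))) ,
                                       trans step (trans (cong (λ d → iterL x d f) p) q))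
      go (inj₂ (¬nc , p)) (inj₁ q) = inj₂ (¬nc , trans (neg-step p) (cong negL q))
      go (inj₂ (¬nc , p)) (inj₂ (_ , q)) = inj₁ (trans (neg-step p) (trans (cong negL q) (negL-involutive c)))

    NegC-apply : ∀ {x g : SP n} → Commute x g → ∀ a → NegC x a → NegC x (apply g a)
    NegC-apply {x} {g} c a (h , e) = h , trans (iterL-apply c a h) (trans (cong (apply g) e) (apply-neg g a))

    NegC-apply⁻ : ∀ {x g : SP n} → Perm g → Commute x g → ∀ a → NegC x (apply g a) → NegC x a
    NegC-apply⁻ {x} {g} pg c a (h , e) = h , apply-injective pg (trans (sym (iterL-apply c a h)) (trans e (sym (apply-neg g a))))

    AtPosition-apply : ∀ {x g : SP n} → Perm g → Commute x g → ∀ b a {e} → AtPosition x b a e → AtPosition x (apply g b) (apply g a) e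
    AtPosition-apply {x} {g} pg c b a {e} (inj₁ p) = inj₁ (trans (iterL-apply c b e) (cong (apply g) p))
    AtPosition-apply {x} {g} pg c b a {e} (inj₂ (¬nc , p)) =
      inj₂ ((λ nc → ¬nc (NegC-apply⁻ pg c b nc)) , trans (iterL-apply c b e) (trans (cong (apply g) p) (apply-neg g a)))

    IsOrder-apply : ∀ {x g : SP n} → Perm g → Commute x g → ∀ {a o} → IsOrder x a o → IsOrder x (apply g a) o
    IsOrder-apply {x} {g} pg c {a} i = isOrder (positive i)
      (λ {t} e → order⇒ i (apply-injective pg (trans (sym (iterL-apply c a t)) e)))
      (λ {t} d → trans (iterL-apply c a t) (cong (apply g) (⇒order i d)))

    -- Reducing a known position modulo the order of b shows that the search below the order
    -- succeeds, so it never falls back on its default value.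
    position-spec : ∀ {x : SP n} → Perm x → ∀ b a {e} → AtPosition x b a e → AtPosition x b a (position x b a)
    position-spec {x} px b a {e} r =
      let k , _ , eq , e′ , _ = firstN-applyUpTo test id o (m%n<n e o) (sound→ (AtPosition-≅ {x} {b} {a} i (≅-sym (%-≅ e)) r))
      in subst (AtPosition x b a) (sym eq) (→sound e′)
      where
      o = orbitSize x b
      i = proj₁ (orbitSize-IsOrder px b)
      instance
        o≢0 : NonZero o
        o≢0 = >-nonZero (positive i)
      test : ℕ → Bool
      test e = letterEq (iterL x b e) a ∨ (not (negC? x b) ∧ letterEq (iterL x b e) (negL a))
      sound→ : ∀ {e} → AtPosition x b a e → test e ≡ true
      sound→ {e} (inj₁ p) rewrite dec-true (iterL x b e ≟L a) p = refl
      sound→ {e} (inj₂ (¬nc , p)) rewrite negC?-false {x = x} {a = b} ¬nc | dec-true (iterL x b e ≟L negL a) p = ∨-true (letterEq (iterL x b e) a)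
        where
        ∨-true : ∀ c → c ∨ true ≡ true
        ∨-true false = refl
        ∨-true true = refl
      →sound : ∀ {e} → test e ≡ true → AtPosition x b a e
      →sound {e} t with letterEq (iterL x b e) a in eq₁ | negC? x b in eq₂ | letterEq (iterL x b e) (negL a) in eq₃
      ... | true  | _     | _    = inj₁ (does⇒ (iterL x b e ≟L a) eq₁)
      ... | false | false | true = inj₂ ((λ nc → false≢true (trans (sym eq₂) (negC?-complete px nc))) , does⇒ (iterL x b e ≟L negL a) eq₃)

    -- The number of cycles of x, up to sign, that g permutes in the orbit of a. The search starts
    -- at 1, since 0 turns always lead back.
    multiplicity : SP n → SP n → Letter n → ℕ
    multiplicity x g a =
      firstN (λ m → sameCycle? x a (iterL g a m)) (applyUpTo suc (2 * n))

    record IsMultiplicity (x g : SP n) (a : Letter n) (m : ℕ) : Set where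
      constructor isMultiplicity
      field
        m-positive : 0 < m
        returns    : SameCycle x a (iterL g a m)
        divides-returns : ∀ q → SameCycle x a (iterL g a q) → m ∣ q
    open IsMultiplicity public

    module _ {x g : SP n} (px : Perm x) (pg : Perm g) (c : Commute x g) where

      SameCycle-multiple : ∀ {a m} → SameCycle x a (iterL g a m) → ∀ k → SameCycle x a (iterL g a (k * m))
      SameCycle-multiple r zero = SameCycle-refl
      SameCycle-multiple {a} {m} r (suc k) = subst (SameCycle x a) (trans (sym (iterL-+ g a (k * m) m)) (cong (iterL g a) (+-comm (k * m) m)))
        (SameCycle-trans (SameCycle-multiple r k) (SameCycle-commute c (k * m) r))

      -- Because g carries cycles of x to cycles of x, multiples of m can be removed from any q for
      -- which g^q a lies on the cycle of a; minimality of m then forces the remainder to be zero.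
      least⇒IsMultiplicity : ∀ {a m} → 0 < m → SameCycle x a (iterL g a m) →
        (∀ q → 0 < q → q < m → ¬ SameCycle x a (iterL g a q)) → IsMultiplicity x g a m
      least⇒IsMultiplicity {a} {m} 0<m r least = isMultiplicity 0<m r div
        where
        instance
          m≢0 : NonZero m
          m≢0 = >-nonZero 0<m
        div : ∀ q → SameCycle x a (iterL g a q) → m ∣ q
        div q s with q % m in eq | m%n<n q m
        ... | zero  | _ = m%n≡0⇒n∣m q m eq
        ... | suc k | k<m = ⊥-elim (least (suc k) (s≤s z≤n) k<m
                (SameCycle-cancel pg c (q / m * m)
                  (SameCycle-trans (SameCycle-sym px (SameCycle-multiple r (q / m)))
                    (subst (SameCycle x a) (trans (cong (iterL g a) (trans (m≡m%n+[m/n]*n q m) (trans (cong (_+ q / m * m) eq) (+-comm (suc k) _)))) (iterL-+ g a (q / m * m) (suc k))) s))))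

      multiplicity-IsMultiplicity : ∀ a → IsMultiplicity x g a (multiplicity x g a)
      multiplicity-IsMultiplicity a with return-time pg a
      ... | suc t , _ , t<2n , e with firstN-applyUpTo (λ m → sameCycle? x a (iterL g a m)) suc (2 * n) {t} t<2n
                                        (sameCycle?-complete px a (iterL g a (suc t)) (0 , cong idx (sym e)))
      ... | r , _ , eq , e′ , least rewrite eq = least⇒IsMultiplicity {a} {suc r} (s≤s z≤n) (sameCycle?-sound x a (iterL g a (suc r)) e′)
            (λ { (suc q) _ (s≤s q<r) s → false≢true (trans (sym (least q q<r)) (sameCycle?-complete px a (iterL g a (suc q)) s)) })

      IsMultiplicity⇒≡ : ∀ {a m} → IsMultiplicity x g a m → multiplicity x g a ≡ m
      IsMultiplicity⇒≡ {a} i = ∣-antisym (divides-returns j _ (returns i)) (divides-returns i _ (returns j))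
        where j = multiplicity-IsMultiplicity a

    -- All these quantities are found by searches that only compare letters, so they agree for two
    -- pairs joined by an injection commuting with negation. Such maps arise from conjugation, from
    -- motion along an orbit and, as the identity, from a twist seen on another orbit.
    module Transfer (h : Letter n → Letter n) (h-injective : ∀ {a b} → h a ≡ h b → a ≡ b)
                    (h-neg : ∀ a → h (negL a) ≡ negL (h a)) where

      idx-h : ∀ a b → idx a ≡ idx b → idx (h a) ≡ idx (h b)
      idx-h a b e with idx-≡ {n} {a} {b} e
      ... | inj₁ refl = refl
      ... | inj₂ refl = cong idx (h-neg b)

      idx-h⁻ : ∀ a b → idx (h a) ≡ idx (h b) → idx a ≡ idx b
      idx-h⁻ a b e with idx-≡ {n} {h a} {h b} e
      ... | inj₁ e′ = cong idx (h-injective e′)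
      ... | inj₂ e′ = cong idx (h-injective {a} {negL b} (trans e′ (sym (h-neg b))))

      letterEq-h : ∀ a b → letterEq a b ≡ letterEq (h a) (h b)
      letterEq-h a b = does-⇔ (mk⇔ (cong h) h-injective) (a ≟L b) (h a ≟L h b)

      module _ {x x′ : SP n} {a : Letter n} (hx : ∀ p → h (iterL x a p) ≡ iterL x′ (h a) p) where

        orbitSize-transfer : orbitSize x a ≡ orbitSize x′ (h a)
        orbitSize-transfer = firstL-cong (applyUpTo suc (2 * n)) λ t →
          trans (letterEq-h (iterL x a t) a) (cong (λ b → letterEq b (h a)) (hx t))

        negC?-transfer : negC? x a ≡ negC? x′ (h a)
        negC?-transfer = any-cong (upTo (2 * n)) λ t →
          trans (letterEq-h (iterL x a t) (negL a)) (cong₂ letterEq (hx t) (h-neg a))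

        position-transfer : ∀ b → position x a b ≡ position x′ (h a) (h b)
        position-transfer b rewrite sym orbitSize-transfer = firstL-cong (upTo (orbitSize x a)) λ e →
          cong₂ _∨_ (trans (letterEq-h (iterL x a e) b) (cong (λ c → letterEq c (h b)) (hx e)))
            (cong₂ _∧_ (cong not negC?-transfer)
              (trans (letterEq-h (iterL x a e) (negL b)) (cong₂ letterEq (hx e) (h-neg b))))

        multiplicity-transfer : ∀ {g g′} → (∀ q → h (iterL g a q) ≡ iterL g′ (h a) q) →
                                multiplicity x g a ≡ multiplicity x′ g′ (h a)
        multiplicity-transfer {g} {g′} hg = firstL-cong (applyUpTo suc (2 * n)) λ m → any-cong (upTo (2 * n)) λ p →
          trans (does-⇔ (mk⇔ (idx-h (iterL x a p) (iterL g a m)) (idx-h⁻ (iterL x a p) (iterL g a m)))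
                   (idx (iterL x a p) Finₚ.≟ idx (iterL g a m)) (idx (h (iterL x a p)) Finₚ.≟ idx (h (iterL g a m))))
                (cong₂ (λ b c → does (idx b Finₚ.≟ idx c)) (hx p) (hg m))

  -- The two defaults may differ, as they do for `rep` at different indices, because the search is
  -- known to succeed.
  firstL-agree : ∀ {A : Set} {d d′ : A} {p q : A → Bool} {xs x} → x ∈ xs → p x ≡ true → (∀ y → p y ≡ q y) →
                 firstL d p xs ≡ firstL d′ q xs
  firstL-agree {p = p} {q} {y ∷ ys} x∈ e h rewrite h y with q y in eq
  ... | true = refl
  firstL-agree {p = p} {q} {y ∷ ys} (here refl) e h | false = ⊥-elim (false≢true (trans (sym (trans (h y) eq)) e))
  firstL-agree {p = p} {q} {y ∷ ys} (there x∈) e h | false = firstL-agree x∈ e h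

  ⇔⇒≡ : ∀ {b c : Bool} → (b ≡ true → c ≡ true) → (c ≡ true → b ≡ true) → b ≡ c
  ⇔⇒≡ {true} to from = sym (to refl)
  ⇔⇒≡ {false} {false} to from = refl
  ⇔⇒≡ {false} {true} to from = from refl

  pos : ∀ {n} → Fin n → Letter n
  pos i = false , i

  module _ {n : ℕ} where

    -- Orbits of the group generated by x, g and −1

    record Orbit (x g : SP n) (a b : Letter n) : Set where
      constructor _,_
      field
        turns     : ℕ
        sameCycle : SameCycle x (iterL g a turns) b

    orbit? : SP n → SP n → Letter n → Letter n → Bool
    orbit? x g a b = any (λ q → sameCycle? x (iterL g a q) b) (upTo (2 * n))

    -- As `allFin` is increasing, this is the least index in the orbit of i; it depends on the orbit
    -- alone and serves as its representative.
    rep : SP n → SP n → Fin n → Fin n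
    rep x g i = firstL i (λ k → orbit? x g (pos i) (pos k)) (allFin n)

    orbitBases : SP n → SP n → List (Fin n)
    orbitBases x g = filter (λ i → rep x g i Finₚ.≟ i) (allFin n)

    orbitBases-unique : ∀ x g → Unique (orbitBases x g)
    orbitBases-unique x g = Unique-filter⁺ (λ i → rep x g i Finₚ.≟ i) (allFin⁺ n)

    ∈-orbitBases⁺ : ∀ {x g} {i : Fin n} → rep x g i ≡ i → i ∈ orbitBases x g
    ∈-orbitBases⁺ {x} {g} {i} e = ∈-filter⁺ (λ i → rep x g i Finₚ.≟ i) (∈-allFin i) e

    ∈-orbitBases⁻ : ∀ {x g} {i : Fin n} → i ∈ orbitBases x g → rep x g i ≡ i
    ∈-orbitBases⁻ {x} {g} p = proj₂ (∈-filter⁻ (λ i → rep x g i Finₚ.≟ i) {xs = allFin n} p)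

    Orbit-resp : ∀ {x g : SP n} {a b a′ b′} → idx a ≡ idx a′ → idx b ≡ idx b′ → Orbit x g a b → Orbit x g a′ b′
    Orbit-resp {x} {g} {a} {b} {a′} {b′} ea eb (q , s) = q , SameCycle-resp (idx-iterL g {a} {a′} q ea) eb s

    Orbit-refl : ∀ {x g : SP n} a → Orbit x g a a
    Orbit-refl {x} a = 0 , SameCycle-refl

    Orbit-g : ∀ {x g : SP n} a q → Orbit x g a (iterL g a q)
    Orbit-g {x} {g} a q = q , SameCycle-refl

    SameCycle⇒Orbit : ∀ {x g : SP n} {a b} → SameCycle x a b → Orbit x g a b
    SameCycle⇒Orbit s = 0 , s

    module _ {x g : SP n} (px : Perm x) (pg : Perm g) (c : Commute x g) where

      Orbit-trans : ∀ {a b d} → Orbit x g a b → Orbit x g b d → Orbit x g a d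
      Orbit-trans {a} {b} {d} (q , s) (q′ , s′) = q′ + q ,
        subst (λ a → SameCycle x a d) (sym (iterL-+ g a q′ q))
          (SameCycle-trans (SameCycle-commute c q′ s) s′)

      Orbit-sym : ∀ {a b} → Orbit x g a b → Orbit x g b a
      Orbit-sym {a} {b} (q , s) = u , SameCycle-sym px
          (subst (λ a → SameCycle x a (iterL g b u)) (iterL-complement pg a q) (SameCycle-commute c u s))
        where u = complement pg a q

      orbit?-sound : ∀ a b → orbit? x g a b ≡ true → Orbit x g a b
      orbit?-sound a b e with any-witness (λ q → sameCycle? x (iterL g a q) b) (upTo (2 * n)) e
      ... | q , _ , e′ = q , sameCycle?-sound x (iterL g a q) b e′

      orbit?-complete : ∀ a b → Orbit x g a b → orbit? x g a b ≡ true
      orbit?-complete a b (q , s) = any-true (λ q → sameCycle? x (iterL g a q) b) (∈-upTo⁺ (<-≤-trans (m%n<n q o) o≤2n))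
          (sameCycle?-complete px (iterL g a (q % o)) b (subst (λ a → SameCycle x a b) (sym (iterL-≅ i (%-≅ q))) s))
        where
        o = orbitSize g a
        i = proj₁ (orbitSize-IsOrder pg a)
        o≤2n = proj₂ (orbitSize-IsOrder pg a)
        instance
          o≢0 : NonZero o
          o≢0 = >-nonZero (positive i)

      rep-Orbit : ∀ i → Orbit x g (pos i) (pos (rep x g i))
      rep-Orbit i = orbit?-sound (pos i) (pos (rep x g i))
        (firstL-satisfies i (λ k → orbit? x g (pos i) (pos k)) (∈-allFin i) (orbit?-complete (pos i) (pos i) (Orbit-refl (pos i))))

      rep-cong : ∀ i k → Orbit x g (pos i) (pos k) → rep x g i ≡ rep x g k
      rep-cong i k s = firstL-agree (∈-allFin i) (orbit?-complete (pos i) (pos i) (Orbit-refl (pos i))) λ l → ⇔⇒≡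
        (λ e → orbit?-complete (pos k) (pos l) (Orbit-trans (Orbit-sym s) (orbit?-sound (pos i) (pos l) e)))
        (λ e → orbit?-complete (pos i) (pos l) (Orbit-trans s (orbit?-sound (pos k) (pos l) e)))

      rep-idem : ∀ i → rep x g (rep x g i) ≡ rep x g i
      rep-idem i = sym (rep-cong i (rep x g i) (rep-Orbit i))

    rep-≡ : ∀ {x g x′ g′ : SP n} → Perm x → Perm g → Commute x g → Perm x′ → Perm g′ → Commute x′ g′ →
            (∀ a b → Orbit x g a b → Orbit x′ g′ a b) → (∀ a b → Orbit x′ g′ a b → Orbit x g a b) → ∀ i → rep x g i ≡ rep x′ g′ i
    rep-≡ {x} {g} {x′} {g′} px pg c px′ pg′ c′ to from i = firstL-agree (∈-allFin i) (orbit?-complete px pg c (pos i) (pos i) (Orbit-refl (pos i))) λ l → ⇔⇒≡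
        (λ e → orbit?-complete px′ pg′ c′ (pos i) (pos l) (to (pos i) (pos l) (orbit?-sound px pg c (pos i) (pos l) e)))
        (λ e → orbit?-complete px pg c (pos i) (pos l) (from (pos i) (pos l) (orbit?-sound px′ pg′ c′ (pos i) (pos l) e)))

    -- Twisting y by g^s on the cycle of ± j under g

    twist : SP n → SP n → Letter n → ℕ → SP n
    twist y g j s = tabulate (λ i → if sameCycle? g j (pos i) then apply y (iterL g (pos i) s) else apply y (pos i))

    module Twist {g : SP n} (pg : Perm g) (j : Letter n) where

      private
        twistMap : SP n → ℕ → Letter n → Letter n
        twistMap y s a = if sameCycle? g j (pos (idx a)) then apply y (iterL g a s) else apply y a

        apply-twist : ∀ y s a → apply (twist y g j s) a ≡ twistMap y s a
        apply-twist y s = apply-tabulate (twistMap y s) neg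
          where
          neg : ∀ a → twistMap y s (negL a) ≡ negL (twistMap y s a)
          neg a with sameCycle? g j (pos (idx a))
          ... | true  = trans (cong (apply y) (iterL-neg g a s)) (apply-neg y (iterL g a s))
          ... | false = apply-neg y a

      twist-in : ∀ y s a → SameCycle g j a → apply (twist y g j s) a ≡ apply y (iterL g a s)
      twist-in y s a h = trans (apply-twist y s a) (cong (λ b → if b then apply y (iterL g a s) else apply y a)
        (sameCycle?-complete pg j (pos (idx a)) (SameCycle-resp refl refl h)))

      twist-out : ∀ y s a → ¬ SameCycle g j a → apply (twist y g j s) a ≡ apply y a
      twist-out y s a h = trans (apply-twist y s a) (cong (λ b → if b then apply y (iterL g a s) else apply y a) (out (sameCycle? g j (pos (idx a))) refl))
        where
        out : ∀ b → sameCycle? g j (pos (idx a)) ≡ b → b ≡ false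
        out false _ = refl
        out true e = ⊥-elim (h (SameCycle-resp refl refl (sameCycle?-sound g j (pos (idx a)) e)))

      private
        on-cycle : ∀ a q → SameCycle g j a → SameCycle g j (iterL g a q)
        on-cycle a q s = SameCycle-trans s (SameCycle-iterL a q)

        off-cycle : ∀ a q → ¬ SameCycle g j a → ¬ SameCycle g j (iterL g a q)
        off-cycle a q h s = h (SameCycle-trans s (SameCycle-sym pg (SameCycle-iterL a q)))

      twist-step : ∀ y s a → ∃ λ q → apply (twist y g j s) a ≡ apply y (iterL g a q)
      twist-step y s a with SameCycle-dec pg j a
      ... | yes h = s , twist-in y s a h
      ... | no ¬h = 0 , twist-out y s a ¬h

      twist-twist : ∀ y s t → twist (twist y g j s) g j t ≡ twist y g j (s + t)
      twist-twist y s t = apply-ext λ a → go a (SameCycle-dec pg j a)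
        where
        go : ∀ a → Dec (SameCycle g j a) → apply (twist (twist y g j s) g j t) a ≡ apply (twist y g j (s + t)) a
        go a (yes h) = trans (twist-in (twist y g j s) t a h) (trans (twist-in y s (iterL g a t) (on-cycle a t h))
          (trans (cong (apply y) (sym (iterL-+ g a s t))) (sym (twist-in y (s + t) a h))))
        go a (no ¬h) = trans (twist-out (twist y g j s) t a ¬h) (trans (twist-out y s a ¬h) (sym (twist-out y (s + t) a ¬h)))

      twist-0 : ∀ y → twist y g j 0 ≡ y
      twist-0 y = apply-ext λ a → go a (SameCycle-dec pg j a)
        where
        go : ∀ a → Dec (SameCycle g j a) → apply (twist y g j 0) a ≡ apply y a
        go a (yes h) = twist-in y 0 a h
        go a (no ¬h) = twist-out y 0 a ¬h

      twist-≅ : ∀ {D s t} → IsOrder g j D → ∀ y → s ≅ t [mod D ] → twist y g j s ≡ twist y g j t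
      twist-≅ {D} {s} {t} i y e = apply-ext λ a → go a (SameCycle-dec pg j a)
        where
        go : ∀ a → Dec (SameCycle g j a) → apply (twist y g j s) a ≡ apply (twist y g j t) a
        go a (yes h) = trans (twist-in y s a h) (trans (cong (apply y) (iterL-≅ (IsOrder-SameCycle pg h i) e)) (sym (twist-in y t a h)))
        go a (no ¬h) = trans (twist-out y s a ¬h) (sym (twist-out y t a ¬h))

      module _ {y : SP n} (py : Perm y) (c : Commute y g) (s : ℕ) where

        twist-Perm : Perm (twist y g j s)
        twist-Perm = perm λ {a} {b} e → go a b (SameCycle-dec pg j a) (SameCycle-dec pg j b) e
          where
          go : ∀ a b → Dec (SameCycle g j a) → Dec (SameCycle g j b) → apply (twist y g j s) a ≡ apply (twist y g j s) b → a ≡ b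
          go a b (yes h) (yes h′) e = iterL-injective pg s (apply-injective py (trans (sym (twist-in y s a h)) (trans e (twist-in y s b h′))))
          go a b (no ¬h) (no ¬h′) e = apply-injective py (trans (sym (twist-out y s a ¬h)) (trans e (twist-out y s b ¬h′)))
          go a b (yes h) (no ¬h′) e = ⊥-elim (¬h′ (subst (SameCycle g j)
            (apply-injective py {iterL g a s} {b} (trans (sym (twist-in y s a h)) (trans e (twist-out y s b ¬h′)))) (on-cycle a s h)))
          go a b (no ¬h) (yes h′) e = ⊥-elim (¬h (subst (SameCycle g j)
            (apply-injective py {iterL g b s} {a} (trans (sym (twist-in y s b h′)) (trans (sym e) (twist-out y s a ¬h)))) (on-cycle b s h′)))

        twist-Commute : Commute (twist y g j s) g
        twist-Commute = commuting λ a → go a (SameCycle-dec pg j a)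
          where
          go : ∀ a → Dec (SameCycle g j a) → apply (twist y g j s) (apply g a) ≡ apply g (apply (twist y g j s) a)
          go a (yes h) = trans (twist-in y s (apply g a) (on-cycle a 1 h)) (trans (cong (apply y) (trans (sym (iterL-sucʳ g a s)) refl))
            (trans (apply-comm c (iterL g a s)) (cong (apply g) (sym (twist-in y s a h)))))
          go a (no ¬h) = trans (twist-out y s (apply g a) (off-cycle a 1 ¬h)) (trans (apply-comm c a) (cong (apply g) (sym (twist-out y s a ¬h))))

      -- A step of y′ is a step of y after a power of g. These powers commute past y and collect in
      -- front, so the path stays in the orbit of a under y and g.
      Orbit-coarsen : ∀ {y y′ : SP n} → Commute y g → (∀ a → ∃ λ q → apply y′ a ≡ apply y (iterL g a q)) →
                      ∀ a b → Orbit y′ g a b → Orbit y g a b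
      Orbit-coarsen {y} {y′} c step a b (q , p , e) =
        let q′ , e′ = iterates (iterL g a q) p
        in q′ + q , p , trans (cong idx (trans (cong (λ d → iterL y d p) (iterL-+ g a q′ q)) (sym e′))) e
        where
        iterates : ∀ a p → ∃ λ q → iterL y′ a p ≡ iterL y (iterL g a q) p
        iterates a zero = 0 , refl
        iterates a (suc p) =
          let q , e = iterates a p
              q′ , e′ = step (iterL y′ a p)
          in q′ + q , trans e′ (cong (apply y) (trans (cong (λ d → iterL g d q′) e)
               (trans (sym (iterL-comm c (iterL g a q) p q′)) (cong (λ d → iterL y d p) (sym (iterL-+ g a q′ q))))))

      twist-Orbit : ∀ {y} → Perm y → Commute y g → ∀ s a b → Orbit (twist y g j s) g a b → Orbit y g a b
      twist-Orbit {y} py c s = Orbit-coarsen c (twist-step y s)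

      -- Here `complement pg j s` stands for -s modulo the order of g at j.
      untwist : ∀ {y} s → twist (twist y g j s) g j (complement pg j s) ≡ y
      untwist {y} s = trans (twist-twist y s (complement pg j s)) (trans (twist-≅ i y (∣⇒≅0 (order⇒ i back))) (twist-0 y))
        where
        i = proj₁ (orbitSize-IsOrder pg j)
        back : iterL g j (s + complement pg j s) ≡ j
        back = trans (cong (iterL g j) (+-comm s (complement pg j s))) (trans (iterL-+ g j (complement pg j s) s) (iterL-complement pg j s))

      -- The twist is undone by a further twist, so the inclusion of orbits also holds in the other
      -- direction.
      twist-Orbit⁻ : ∀ {y} → Perm y → Commute y g → ∀ s a b → Orbit y g a b → Orbit (twist y g j s) g a b
      twist-Orbit⁻ {y} py c s a b h = twist-Orbit (twist-Perm py c s) (twist-Commute py c s) (complement pg j s) a b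
        (subst (λ y → Orbit y g a b) (sym (untwist s)) h)

      twist-rep : ∀ {y} → Perm y → Commute y g → ∀ s i → rep (twist y g j s) g i ≡ rep y g i
      twist-rep py c s = rep-≡ (twist-Perm py c s) pg (twist-Commute py c s) py pg c (twist-Orbit py c s) (twist-Orbit⁻ py c s)

      twist-elsewhere : ∀ {y} → Perm y → Commute y g → ∀ s a → ¬ Orbit y g j a → ∀ t → iterL (twist y g j s) a t ≡ iterL y a t
      twist-elsewhere py c s a h zero = refl
      twist-elsewhere {y} py c s a h (suc t) = trans (cong (apply (twist y g j s)) (twist-elsewhere py c s a h t))
        (twist-out y s (iterL y a t) λ { (q , e) → h (q , SameCycle-sym py (t , sym e)) })

      -- Before its return at step r, the path of j under y meets the cycle of g through j only at
      -- its start, so just the first of these steps is twisted.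
      twist-before-return : ∀ {y r} → Commute y g → IsMultiplicity g y j r → ∀ s q → q < r → iterL (twist y g j s) j (suc q) ≡ iterL y (iterL g j s) (suc q)
      twist-before-return {y} c i s zero _ = twist-in y s j (SameCycle-refl)
      twist-before-return {y} {r} c i s (suc q) q<r = trans (cong (apply (twist y g j s)) (twist-before-return c i s q (≤-trans (n≤1+n _) q<r)))
        (twist-out y s (iterL y (iterL g j s) (suc q)) (subst (λ a → ¬ SameCycle g j a) (sym (iterL-comm c j (suc q) s))
          (off-cycle (iterL y j (suc q)) s λ h → <⇒≱ q<r (∣⇒≤ (divides-returns i (suc q) h)))))

open Combinatorics

-- Sums, products and roots of unity in the field

module FieldLemmas {c ℓ} (K : CharZeroField c ℓ) where
  open CharZeroField K
  open RingProperties ring using (x[y-z]≈xy-xz; +-cancelʳ; x∙y⁻¹≈ε⇒x≈y)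
  open import Relation.Binary.Reasoning.Setoid setoid

  module S = FiniteSum +-commutativeMonoid
  module P = FiniteSum *-commutativeMonoid

  infixr 8 _^_
  _^_ : Carrier → ℕ → Carrier
  _^_ = powK K

  ^-cong : ∀ {a b} m → a ≈ b → a ^ m ≈ b ^ m
  ^-cong zero e = refl
  ^-cong (suc m) e = *-cong e (^-cong m e)

  ^-+ : ∀ a m p → a ^ (m +ℕ p) ≈ a ^ m * a ^ p
  ^-+ a zero p = sym (*-identityˡ _)
  ^-+ a (suc m) p = trans (*-congˡ (^-+ a m p)) (sym (*-assoc _ _ _))

  ^-* : ∀ a m p → a ^ (m *ℕ p) ≈ (a ^ p) ^ m
  ^-* a zero p = refl
  ^-* a (suc m) p = trans (^-+ a p (m *ℕ p)) (*-congˡ (^-* a m p))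

  1^ : ∀ m → 1# ^ m ≈ 1#
  1^ zero = refl
  1^ (suc m) = trans (*-identityˡ _) (1^ m)

  ^-multiple : ∀ {a o} m → a ^ o ≈ 1# → a ^ (m *ℕ o) ≈ 1#
  ^-multiple {a} {o} m e = trans (^-* a m o) (trans (^-cong m e) (1^ m))

  ^-≅ : ∀ {a o m p} → a ^ o ≈ 1# → m ≅ p [mod o ] → a ^ m ≈ a ^ p
  ^-≅ {a} {o} {m} {p} e (x , y , q) = begin
    a ^ m                      ≈⟨ *-identityʳ _ ⟨
    a ^ m * 1#                 ≈⟨ *-congˡ (^-multiple x e) ⟨
    a ^ m * a ^ (x *ℕ o)       ≈⟨ ^-+ a m (x *ℕ o) ⟨
    a ^ (m +ℕ x *ℕ o)          ≡⟨ cong (a ^_) q ⟩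
    a ^ (p +ℕ y *ℕ o)          ≈⟨ ^-+ a p (y *ℕ o) ⟩
    a ^ p * a ^ (y *ℕ o)       ≈⟨ *-congˡ (^-multiple y e) ⟩
    a ^ p * 1#                 ≈⟨ *-identityʳ _ ⟩
    a ^ p                      ∎

  Unit : Carrier → Set _
  Unit a = ∃ λ b → b * a ≈ 1#

  *-cancelʳ-Unit : ∀ {a x y} → Unit a → x * a ≈ y * a → x ≈ y
  *-cancelʳ-Unit {a} {x} {y} (b , ba≈1) e = begin
    x            ≈⟨ *-identityʳ x ⟨
    x * 1#       ≈⟨ *-congˡ (trans (*-comm a b) ba≈1) ⟨
    x * (a * b)  ≈⟨ *-assoc x a b ⟨
    x * a * b    ≈⟨ *-congʳ e ⟩
    y * a * b    ≈⟨ *-assoc y a b ⟩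
    y * (a * b)  ≈⟨ *-congˡ (trans (*-comm a b) ba≈1) ⟩
    y * 1#       ≈⟨ *-identityʳ y ⟩
    y            ∎

  ≉0⇒Unit : ∀ {a} → ¬ a ≈ 0# → Unit a
  ≉0⇒Unit {a} ne = inv a , trans (*-comm _ _) (inv-law a ne)

  fromℕ-Unit : ∀ m → 0 < m → Unit (fromℕK K m)
  fromℕ-Unit (suc m) _ = ≉0⇒Unit (charZero m)

  root-Unit : ∀ {a o} m → 0 < o → a ^ o ≈ 1# → Unit (a ^ m)
  root-Unit {a} {suc o} m _ e = a ^ (o *ℕ m) , (begin
    a ^ (o *ℕ m) * a ^ m ≈⟨ *-comm _ _ ⟩
    a ^ m * a ^ (o *ℕ m) ≈⟨ ^-+ a m (o *ℕ m) ⟨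
    a ^ (suc o *ℕ m)     ≡⟨ cong (a ^_) (ℕₚ.*-comm (suc o) m) ⟩
    a ^ (m *ℕ suc o)     ≈⟨ ^-multiple m e ⟩
    1#                   ∎)

  ∏-Unit : ∀ {a} {A : Set a} (xs : List A) {f} → (∀ x → Unit (f x)) → Unit (P.∑ xs f)
  ∏-Unit [] u = 1# , *-identityʳ 1#
  ∏-Unit (x ∷ xs) u with u x | ∏-Unit xs u
  ... | b , e | b′ , e′ = b′ * b , trans (*-assoc _ _ _) (trans (*-congˡ (trans (sym (*-assoc _ _ _)) (trans (*-congʳ e) (*-identityˡ _)))) e′)

  -- The factors f x and h x differ by the ratio of θ at x and at σ x; as σ permutes xs, these
  -- ratios multiply to 1.
  ∏-telescope : ∀ {a} {A : Set a} (_≟_ : DecidableEquality A) {xs : List A} → Unique xs → (σ τ : A → A) →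
                (∀ {x} → x ∈ xs → σ x ∈ xs × τ (σ x) ≡ x) → (∀ {x} → x ∈ xs → τ x ∈ xs × σ (τ x) ≡ x) →
                (θ f h : A → Carrier) → (∀ x → Unit (θ x)) → (∀ x → f x * θ (σ x) ≈ h x * θ x) →
                P.∑ xs f ≈ P.∑ xs h
  ∏-telescope _≟_ {xs} u σ τ to from θ f h unit e = *-cancelʳ-Unit (∏-Unit xs unit) (begin
    P.∑ xs f * P.∑ xs θ                     ≈⟨ *-congˡ (P.∑-bij _≟_ u u σ τ to from (λ _ → refl)) ⟨
    P.∑ xs f * P.∑ xs (λ x → θ (σ x))       ≈⟨ P.∑-∙ xs f _ ⟨
    P.∑ xs (λ x → f x * θ (σ x))            ≈⟨ P.∑-cong xs (λ {x} _ → e x) ⟩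
    P.∑ xs (λ x → h x * θ x)                ≈⟨ P.∑-∙ xs h θ ⟩
    P.∑ xs h * P.∑ xs θ                     ∎)

  ∑-*ˡ : ∀ {a} {A : Set a} (xs : List A) b {f} → b * S.∑ xs f ≈ S.∑ xs (λ x → b * f x)
  ∑-*ˡ [] b = zeroʳ b
  ∑-*ˡ (x ∷ xs) b = trans (distribˡ b _ _) (+-congˡ (∑-*ˡ xs b))

  ∑-1 : ∀ D → S.∑ (upTo D) (λ _ → 1#) ≈ fromℕK K D
  ∑-1 D = go D id
    where
    go : ∀ D (f : ℕ → ℕ) → S.∑ (applyUpTo f D) (λ _ → 1#) ≈ fromℕK K D
    go zero f = refl
    go (suc D) f = +-congˡ (go D (f ∘ suc))

  ∑-const : ∀ D x → S.∑ (upTo D) (λ _ → x) ≈ fromℕK K D * x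
  ∑-const D x = begin
    S.∑ (upTo D) (λ _ → x)        ≈⟨ S.∑-cong (upTo D) (λ _ → sym (*-identityʳ x)) ⟩
    S.∑ (upTo D) (λ _ → x * 1#)   ≈⟨ ∑-*ˡ (upTo D) x ⟨
    x * S.∑ (upTo D) (λ _ → 1#)   ≈⟨ *-congˡ (∑-1 D) ⟩
    x * fromℕK K D                ≈⟨ *-comm _ _ ⟩
    fromℕK K D * x                ∎

  ∑-shift : ∀ {D} s₀ {f : ℕ → Carrier} → 0 < D → (∀ {s t} → s ≅ t [mod D ] → f s ≈ f t) →
            S.∑ (upTo D) (λ s → f (s +ℕ s₀)) ≈ S.∑ (upTo D) f
  ∑-shift {D@(suc D′)} s₀ {f} 0<D per =
    -- The inverse shift uses `D′ *ℕ s₀`, which is -s₀ modulo D.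
    S.∑-bij ℕₚ._≟_ (upTo⁺ D) (upTo⁺ D) (λ s → (s +ℕ s₀) % D) (λ s → (s +ℕ D′ *ℕ s₀) % D)
      (λ {s} p → ∈-upTo⁺ (m%n<n (s +ℕ s₀) D) , ≅-unique (m%n<n ((s +ℕ s₀) % D +ℕ D′ *ℕ s₀) D) (∈-upTo⁻ p)
        (≅-trans (%-≅ ((s +ℕ s₀) % D +ℕ D′ *ℕ s₀)) (≅-trans (≅-+ {a′ = D′ *ℕ s₀} (%-≅ (s +ℕ s₀)) (≅-reflexive ≡.refl)) (back s))))
      (λ {s} p → ∈-upTo⁺ (m%n<n (s +ℕ D′ *ℕ s₀) D) , ≅-unique (m%n<n ((s +ℕ D′ *ℕ s₀) % D +ℕ s₀) D) (∈-upTo⁻ p)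
        (≅-trans (%-≅ ((s +ℕ D′ *ℕ s₀) % D +ℕ s₀)) (≅-trans (≅-+ {a′ = s₀} (%-≅ (s +ℕ D′ *ℕ s₀)) (≅-reflexive ≡.refl))
          (subst (_≅ s [mod D ]) (shuffle s s₀ (D′ *ℕ s₀)) (back s)))))
      (λ {s} _ → per (≅-sym (%-≅ (s +ℕ s₀))))
    where
    back : ∀ s → s +ℕ s₀ +ℕ D′ *ℕ s₀ ≅ s [mod D ]
    back s = 0 , s₀ , ≡.trans (ℕₚ.+-identityʳ _) (≡.trans (ℕₚ.+-assoc s s₀ _) (cong (s +ℕ_) (ℕₚ.*-comm D s₀)))
    shuffle : ∀ s a b → s +ℕ a +ℕ b ≡ s +ℕ b +ℕ a
    shuffle s a b = ≡.trans (ℕₚ.+-assoc s a b) (≡.trans (cong (s +ℕ_) (ℕₚ.+-comm a b)) (≡.sym (ℕₚ.+-assoc s b a)))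

  -- Multiplication by ξ shifts the exponents cyclically, so ξ - 1 annihilates the sum; for o > 1
  -- primitivity makes ξ - 1 invertible.
  geometric-sum : ∀ {o ξ} → 0 < o → Primitive K o ξ →
                  S.∑ (upTo o) (ξ ^_) ≈ (if does (o ℕₚ.≟ 1) then 1# else 0#)
  geometric-sum {suc zero} _ _ = +-identityʳ 1#
  geometric-sum {o@(suc (suc o′))} {ξ} 0<o (ξ^o≈1 , prim) =
    *-cancelʳ-Unit {ξ - 1#} (≉0⇒Unit ξ-1≉0) (begin
      Σ * (ξ - 1#)            ≈⟨ x[y-z]≈xy-xz _ _ _ ⟩
      Σ * ξ - Σ * 1#          ≈⟨ +-cong (trans (*-comm _ _) ξΣ≈Σ) (-‿cong (*-identityʳ _)) ⟩
      Σ - Σ                   ≈⟨ -‿inverseʳ _ ⟩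
      0#                      ≈⟨ zeroˡ _ ⟨
      0# * (ξ - 1#)           ∎)
    where
    Σ = S.∑ (upTo o) (ξ ^_)
    ξ-1≉0 : ¬ ξ - 1# ≈ 0#
    ξ-1≉0 e = prim 1 (s≤s z≤n) (s≤s (s≤s z≤n)) (trans (*-identityʳ ξ) (x∙y⁻¹≈ε⇒x≈y _ _ e))
    ξΣ≈Σ : ξ * Σ ≈ Σ
    ξΣ≈Σ = begin
      ξ * Σ                                    ≈⟨ ∑-*ˡ (upTo o) ξ ⟩
      S.∑ (upTo o) (λ s → ξ ^ suc s)           ≈⟨ S.∑-cong (upTo o) (λ {s} _ → reflexive (cong (ξ ^_) (≡.sym (ℕₚ.+-comm s 1)))) ⟩
      S.∑ (upTo o) (λ s → ξ ^ (s +ℕ 1))        ≈⟨ ∑-shift 1 0<o (^-≅ ξ^o≈1) ⟩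
      Σ                                        ∎

  Primitive-^ : ∀ {c o ξ} → 0 < c → Primitive K (c *ℕ o) ξ → Primitive K o (ξ ^ c)
  Primitive-^ {c} {o} {ξ} 0<c (p , q) =
    trans (sym (^-* ξ o c)) (trans (reflexive (cong (ξ ^_) (ℕₚ.*-comm o c))) p) ,
    λ j 1≤j j<o e → q (c *ℕ j) (ℕₚ.*-mono-≤ 0<c 1≤j) (ℕₚ.*-monoʳ-< c {{>-nonZero 0<c}} j<o)
      (trans (reflexive (cong (ξ ^_) (ℕₚ.*-comm c j))) (trans (^-* ξ j c) e))

  -- Elements of given order in ℤ/D and Ramanujan sums

  totatives divisors : ℕ → List ℕ
  totatives o = filter (λ v → gcd v o ℕₚ.≟ 1) (upTo o)
  divisors D = filter (λ o → o ∣? D) (upTo (suc D))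

  ofOrder : ℕ → ℕ → List ℕ
  ofOrder D o = filter (λ s → order s D ℕₚ.≟ o) (upTo D)

  totatives-unique : ∀ o → Unique (totatives o)
  totatives-unique o = Unique-filter⁺ (λ v → gcd v o ℕₚ.≟ 1) (upTo⁺ o)

  divisors-unique : ∀ D → Unique (divisors D)
  divisors-unique D = Unique-filter⁺ (_∣? D) (upTo⁺ (suc D))

  ofOrder-unique : ∀ D o → Unique (ofOrder D o)
  ofOrder-unique D o = Unique-filter⁺ (λ s → order s D ℕₚ.≟ o) (upTo⁺ D)

  ∑-order : ∀ {D} → 0 < D → ∀ f → S.∑ (upTo D) f ≈ S.∑ (divisors D) (λ o → S.∑ (ofOrder D o) f)
  ∑-order {D} 0<D f = S.∑-fibre ℕₚ._≟_ (λ s → order s D) (upTo D) f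
    (divisors-unique D)
    (λ {s} _ → let o∣D = subst (order s D ∣_) (≡.sym (order*gcd s D)) (m∣m*n (gcd s D))
               in ∈-filter⁺ (λ o → o ∣? D) (∈-upTo⁺ (s≤s (∣⇒≤ {{>-nonZero 0<D}} o∣D))) o∣D)

  -- An s of order o has gcd(s, D) = c, so s = c v with v < o, and dividing the gcd by c shows that
  -- v is prime to o.
  ∑-ofOrder : ∀ {D c o} → 0 < D → D ≡ c *ℕ o → ∀ f →
              S.∑ (ofOrder D o) f ≈ S.∑ (totatives o) (λ v → f (c *ℕ v))
  ∑-ofOrder {D} {c} {o} 0<D ≡.refl f =
    S.∑-bij ℕₚ._≟_ (ofOrder-unique D o) (totatives-unique o) φ (c *ℕ_) to from
      (λ p → reflexive (cong f (≡.sym (proj₂ (to p)))))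
    where
    instance
      c≢0 : NonZero c
      c≢0 = >-nonZero (factor-positiveˡ c 0<D)
      o≢0 : NonZero o
      o≢0 = >-nonZero (factor-positiveʳ c 0<D)
    φ : ℕ → ℕ
    φ s = quotient (gcd[m,n]∣m s D)
    φ* : ∀ s → s ≡ φ s *ℕ gcd s D
    φ* s = m∣n⇒n≡quotient*m (gcd[m,n]∣m s D)
    to : ∀ {s} → s ∈ ofOrder D o → φ s ∈ totatives o × c *ℕ φ s ≡ s
    to {s} p = ∈-filter⁺ _ (∈-upTo⁺ φ<o) cop , cφ≡s
      where
      s<D = ∈-upTo⁻ (proj₁ (∈-filter⁻ _ p))
      gcd≡c : gcd s D ≡ c
      gcd≡c = ℕₚ.*-cancelˡ-≡ _ _ o (≡.trans (cong (_*ℕ gcd s D) (≡.sym (proj₂ (∈-filter⁻ (λ s → order s D ℕₚ.≟ o) {xs = upTo D} p))))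
        (≡.trans (≡.sym (order*gcd s D)) (ℕₚ.*-comm c o)))
      cφ≡s : c *ℕ φ s ≡ s
      cφ≡s = ≡.trans (ℕₚ.*-comm c (φ s)) (≡.trans (cong (φ s *ℕ_) (≡.sym gcd≡c)) (≡.sym (φ* s)))
      φ<o : φ s < o
      φ<o = ℕₚ.*-cancelˡ-< c _ _ (subst (_< c *ℕ o) (≡.sym cφ≡s) s<D)
      cop : gcd (φ s) o ≡ 1
      cop = ℕₚ.*-cancelˡ-≡ _ _ c (≡.trans (c*gcd[m,n]≡gcd[cm,cn] c (φ s) o)
        (≡.trans (cong (λ t → gcd t D) cφ≡s) (≡.trans gcd≡c (≡.sym (ℕₚ.*-identityʳ c)))))
    from : ∀ {v} → v ∈ totatives o → c *ℕ v ∈ ofOrder D o × φ (c *ℕ v) ≡ v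
    from {v} p =
      let v∈ , cop = ∈-filter⁻ (λ v → gcd v o ℕₚ.≟ 1) {xs = upTo o} p
          g , ord = order-multiple {D} {c} {o} {v} 0<D ≡.refl cop
      in ∈-filter⁺ _ (∈-upTo⁺ (ℕₚ.*-monoʳ-< c (∈-upTo⁻ v∈))) ord ,
         ℕₚ.*-cancelˡ-≡ _ _ c (≡.trans (ℕₚ.*-comm c _) (≡.trans (cong (φ (c *ℕ v) *ℕ_) (≡.sym g)) (≡.sym (φ* (c *ℕ v)))))

  -- The Ramanujan sum over the primitive o-th roots of unity, which is μ(o).
  ramanujan : ℕ → Carrier → Carrier
  ramanujan o ξ = S.∑ (totatives o) (ξ ^_)

  ramanujan-^ : ∀ {D c o} ξ → 0 < D → D ≡ c *ℕ o → S.∑ (ofOrder D o) (ξ ^_) ≈ ramanujan o (ξ ^ c)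
  ramanujan-^ {D} {c} {o} ξ 0<D e = trans (∑-ofOrder {c = c} 0<D e (ξ ^_))
    (S.∑-cong (totatives o) {f = λ v → ξ ^ (c *ℕ v)} λ {v} _ → trans (reflexive (cong (ξ ^_) (ℕₚ.*-comm c v))) (^-* ξ v c))

  -- Two primitive roots of the same order are not compared as powers of each other: finding the
  -- exponent would need decidable equality in K.
  ramanujan-independent : ∀ o {ξ ξ′} → 0 < o → Primitive K o ξ → Primitive K o ξ′ → ramanujan o ξ ≈ ramanujan o ξ′
  ramanujan-independent = <-rec _ step
    where
    step : ∀ o → (∀ {q} → q < o → ∀ {ξ ξ′} → 0 < q → Primitive K q ξ → Primitive K q ξ′ → ramanujan q ξ ≈ ramanujan q ξ′) →
           ∀ {ξ ξ′} → 0 < o → Primitive K o ξ → Primitive K o ξ′ → ramanujan o ξ ≈ ramanujan o ξ′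
    -- The geometric sum has the same value for both roots. Its parts of order q < o agree by
    -- induction, since ξ^c is a primitive q-th root when o = c q; what remains is the part of order
    -- o.
    step o rec {ξ} {ξ′} 0<o pξ pξ′ = +-cancelʳ (rest ξ) _ _ (begin
        ramanujan o ξ + rest ξ    ≈⟨ total ξ ⟨
        S.∑ (upTo o) (ξ ^_)       ≈⟨ geometric-sum 0<o pξ ⟩
        _                         ≈⟨ geometric-sum 0<o pξ′ ⟨
        S.∑ (upTo o) (ξ′ ^_)      ≈⟨ total ξ′ ⟩
        ramanujan o ξ′ + rest ξ′  ≈⟨ +-congˡ (S.∑-cong proper same) ⟨
        ramanujan o ξ′ + rest ξ   ∎)
      where
      proper = filter (λ q → ¬? (q ℕₚ.≟ o)) (divisors o)
      rest : Carrier → Carrier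
      rest ξ = S.∑ proper (λ q → S.∑ (ofOrder o q) (ξ ^_))
      total : ∀ ξ → S.∑ (upTo o) (ξ ^_) ≈ ramanujan o ξ + rest ξ
      total ξ = begin
        S.∑ (upTo o) (ξ ^_)                                     ≈⟨ ∑-order 0<o _ ⟩
        S.∑ (divisors o) (λ q → S.∑ (ofOrder o q) (ξ ^_))       ≈⟨ S.∑-remove ℕₚ._≟_ _ (divisors-unique o)
                                                                     (∈-filter⁺ (λ q → q ∣? o) (∈-upTo⁺ (ℕₚ.n<1+n o)) ∣-refl) ⟩
        S.∑ (ofOrder o o) (ξ ^_) + rest ξ                       ≈⟨ +-congʳ (trans (ramanujan-^ {c = 1} ξ 0<o (≡.sym (ℕₚ.*-identityˡ o)))
                                                                     (S.∑-cong (totatives o) (λ {v} _ → ^-cong v (*-identityʳ ξ)))) ⟩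
        ramanujan o ξ + rest ξ                                  ∎
      same : ∀ {q} → q ∈ proper → S.∑ (ofOrder o q) (ξ ^_) ≈ S.∑ (ofOrder o q) (ξ′ ^_)
      same {q} p with ∈-filter⁻ (λ q → ¬? (q ℕₚ.≟ o)) {xs = divisors o} p
      ... | q∈ , q≢o with ∈-filter⁻ (λ q → q ∣? o) {xs = upTo (suc o)} q∈
      ... | q∈′ , divides c ≡.refl = begin
        S.∑ (ofOrder o q) (ξ ^_)    ≈⟨ ramanujan-^ {c = c} ξ 0<o ≡.refl ⟩
        ramanujan q (ξ ^ c)         ≈⟨ rec (ℕₚ.≤∧≢⇒< (ℕₚ.≤-pred (∈-upTo⁻ q∈′)) q≢o) (factor-positiveʳ c 0<o)
                                         (Primitive-^ {c} 0<c pξ) (Primitive-^ {c} 0<c pξ′) ⟩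
        ramanujan q (ξ′ ^ c)        ≈⟨ ramanujan-^ {c = c} ξ′ 0<o ≡.refl ⟨
        S.∑ (ofOrder o q) (ξ′ ^_)   ∎
        where 0<c = factor-positiveˡ c 0<o

  -- F s depends on s through its order o in ℤ/D and on the inverse of s/gcd(s,D) modulo o, so the
  -- s of order o contribute the Ramanujan sum μ(o).
  module RootSum {D : ℕ} (0<D : 0 < D) (m : ℕ) (Ξ F : ℕ → Carrier)
           (Ξ-primitive : ∀ s → Primitive K (order s D) (Ξ (order s D)))
           (F-root : ∀ s → ∃ λ u → u *ℕ s ≅ gcd s D [mod D ] × F s ≈ Ξ (order s D) ^ u)
           where

    E = gcd m D

    0<E : 0 < E
    0<E = gcd-positive m 0<D

    -- Every divisor o of D is the order of some residue, namely of D/o.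
    Ξ-primitive′ : ∀ {o} → o ∣ D → Primitive K o (Ξ o)
    Ξ-primitive′ {o} (divides c e) = subst (λ o → Primitive K o (Ξ o))
      (proj₂ (order-multiple {D} {c} {o} {1} 0<D e (∣1⇒≡1 (gcd[m,n]∣m 1 o)))) (Ξ-primitive (c *ℕ 1))

    inv-mod : ℕ → ℕ → ℕ
    inv-mod o v with 0 ℕₚ.<? o | gcd v o ℕₚ.≟ 1
    ... | yes 0<o | yes cop = proj₁ (inverse v o 0<o cop)
    ... | _       | _       = 0

    inv-mod-spec : ∀ {v o} → v ∈ totatives o → inv-mod o v < o × inv-mod o v *ℕ v ≅ 1 [mod o ]
    inv-mod-spec {v} {o} p with 0 ℕₚ.<? o | gcd v o ℕₚ.≟ 1
    ... | yes 0<o | yes cop = proj₂ (inverse v o 0<o cop)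
    ... | no ¬0<o | _       = ⊥-elim (¬0<o (ℕₚ.≤-<-trans z≤n (∈-upTo⁻ (proj₁ (∈-filter⁻ (λ v → gcd v o ℕₚ.≟ 1) {xs = upTo o} p)))))
    ... | yes _   | no ¬cop = ⊥-elim (¬cop (proj₂ (∈-filter⁻ (λ v → gcd v o ℕₚ.≟ 1) {xs = upTo o} p)))

    -- Inversion is an involution of the units modulo o.
    ∑-inv-mod : ∀ o ξ → S.∑ (totatives o) (λ v → ξ ^ inv-mod o v) ≈ ramanujan o ξ
    ∑-inv-mod o ξ = S.∑-bij ℕₚ._≟_ uniq uniq (inv-mod o) (inv-mod o) bij bij (λ _ → refl)
      where
      uniq = totatives-unique o
      bij : ∀ {v} → v ∈ totatives o → inv-mod o v ∈ totatives o × inv-mod o (inv-mod o v) ≡ v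
      bij {v} p =
        let w<o , wv≅1 = inv-mod-spec p
            vw≅1 = subst (_≅ 1 [mod o ]) (ℕₚ.*-comm (inv-mod o v) v) wv≅1
            w∈ = ∈-filter⁺ (λ v → gcd v o ℕₚ.≟ 1) (∈-upTo⁺ w<o) (unit⇒coprime v _ o vw≅1)
            w′<o , w′w≅1 = inv-mod-spec w∈
        in w∈ , ≅-unique w′<o (∈-upTo⁻ (proj₁ (∈-filter⁻ (λ v → gcd v o ℕₚ.≟ 1) {xs = upTo o} p))) (inverse-unique w′w≅1 vw≅1)

    -- For s = c v the congruence u s ≡ c modulo D = c o divides by c to u v ≡ 1 modulo o, so F s is
    -- the power of `Ξ o` by the inverse of v, and inversion permutes the units.
    ∑-F-ofOrder : ∀ {o} → o ∣ D → S.∑ (ofOrder D o) F ≈ ramanujan o (Ξ o)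
    ∑-F-ofOrder {o} o∣D@(divides c e) = begin
      S.∑ (ofOrder D o) F                          ≈⟨ ∑-ofOrder {D} {c} 0<D e F ⟩
      S.∑ (totatives o) (λ v → F (c *ℕ v))         ≈⟨ S.∑-cong (totatives o) value ⟩
      S.∑ (totatives o) (λ v → Ξ o ^ inv-mod o v)  ≈⟨ ∑-inv-mod o (Ξ o) ⟩
      ramanujan o (Ξ o)                            ∎
      where
      value : ∀ {v} → v ∈ totatives o → F (c *ℕ v) ≈ Ξ o ^ inv-mod o v
      value {v} p =
        let cop = proj₂ (∈-filter⁻ (λ v → gcd v o ℕₚ.≟ 1) {xs = upTo o} p)
            g , ord = order-multiple {D} {c} {o} {v} 0<D e cop
            root = F-root (c *ℕ v)
            u = proj₁ root
            us≅c = proj₁ (proj₂ root)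
            Fs≈ = proj₂ (proj₂ root)
            cuv≅c : c *ℕ (u *ℕ v) ≅ c *ℕ 1 [mod c *ℕ o ]
            cuv≅c = ≡.subst₂ (_≅_[mod c *ℕ o ]) (≡.trans (≡.sym (ℕₚ.*-assoc u c v)) (≡.trans (cong (_*ℕ v) (ℕₚ.*-comm u c)) (ℕₚ.*-assoc c u v)))
                      (≡.trans g (≡.sym (ℕₚ.*-identityʳ c))) (≡.subst (λ D → u *ℕ (c *ℕ v) ≅ gcd (c *ℕ v) D′ [mod D ]) e us≅c)
            uv≅1 = ≅-unscale c {{>-nonZero (factor-positiveˡ c (subst (0 <_) e 0<D))}} cuv≅c
        in trans Fs≈ (trans (reflexive (cong (λ o → powK K (Ξ o) u) ord))
             (^-≅ {m = u} {p = inv-mod o v} (proj₁ (Ξ-primitive′ o∣D)) (inverse-unique {u} {inv-mod o v} {v} uv≅1 (proj₂ (inv-mod-spec p)))))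
        where D′ = D

    -- P selects the residues whose order divides m, so the left side is the sum of the Ramanujan
    -- sums of the divisors of E = gcd(m, D). The same sums make up the geometric sum of a primitive
    -- E-th root, which is 1 for E = 1 and 0 otherwise; accordingly m s ≡ 1 has one solution modulo
    -- D or none.
    root-sum : ∀ {p q} {P : ℕ → Set p} {Q : ℕ → Set q} (P? : Decidable P) (Q? : Decidable Q) →
               (∀ s → P s → D ∣ m *ℕ s) → (∀ s → D ∣ m *ℕ s → P s) →
               (∀ s → Q s → m *ℕ s ≅ 1 [mod D ]) → (∀ s → m *ℕ s ≅ 1 [mod D ] → Q s) →
               S.∑ (upTo D) (λ s → if does (P? s) then F s else 0#) ≈
               S.∑ (upTo D) (λ s → if does (Q? s) then 1# else 0#)
    root-sum P? Q? P⇒ ⇒P Q⇒ ⇒Q = begin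
      S.∑ (upTo D) (λ s → if does (P? s) then F s else 0#)
        ≈⟨ ∑-order 0<D _ ⟩
      S.∑ (divisors D) (λ o → S.∑ (ofOrder D o) (λ s → if does (P? s) then F s else 0#))
        ≈⟨ S.∑-cong (divisors D) inner ⟩
      S.∑ (divisors D) (λ o → if does (o ∣? m) then ramanujan o (Ξ o) else 0#)
        ≈⟨ S.∑-filter (_∣? m) (divisors D) _ ⟨
      S.∑ (filter (_∣? m) (divisors D)) (λ o → ramanujan o (Ξ o))
        ≈⟨ S.∑-bij ℕₚ._≟_ {f = λ o → ramanujan o (Ξ o)} {h = λ o → ramanujan o (Ξ o)}
             (Unique-filter⁺ (_∣? m) (divisors-unique D)) (divisors-unique E) id id to from (λ _ → refl) ⟩
      S.∑ (divisors E) (λ o → ramanujan o (Ξ o))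
        ≈⟨ S.∑-cong (divisors E) outer ⟨
      S.∑ (divisors E) (λ o → S.∑ (ofOrder E o) (Ξ E ^_))
        ≈⟨ ∑-order 0<E _ ⟨
      S.∑ (upTo E) (Ξ E ^_)
        ≈⟨ geometric-sum 0<E (Ξ-primitive′ (gcd[m,n]∣n m D)) ⟩
      (if does (E ℕₚ.≟ 1) then 1# else 0#)
        ≈⟨ count (E ℕₚ.≟ 1) ⟩
      S.∑ (upTo D) (λ s → if does (Q? s) then 1# else 0#) ∎
      where
      inner : ∀ {o} → o ∈ divisors D →
              S.∑ (ofOrder D o) (λ s → if does (P? s) then F s else 0#) ≈ (if does (o ∣? m) then ramanujan o (Ξ o) else 0#)
      inner {o} o∈ with o ∣? m
      ... | yes o∣m = trans (S.∑-cong (ofOrder D o) (λ {s} s∈ → S.if-yes (P? s) (⇒P s (proj₂ (∣*⇔order∣ 0<D s m)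
              (subst (_∣ m) (≡.sym (proj₂ (∈-filter⁻ (λ s → order s D ℕₚ.≟ o) {xs = upTo D} s∈))) o∣m)))))
              (∑-F-ofOrder (proj₂ (∈-filter⁻ (_∣? D) {xs = upTo (suc D)} o∈)))
      ... | no o∤m = S.∑-ε (ofOrder D o) (λ {s} s∈ → S.if-no (P? s) (λ Ps → o∤m
              (subst (_∣ m) (proj₂ (∈-filter⁻ (λ s → order s D ℕₚ.≟ o) {xs = upTo D} s∈)) (proj₁ (∣*⇔order∣ 0<D s m) (P⇒ s Ps)))))
      to : ∀ {o} → o ∈ filter (_∣? m) (divisors D) → o ∈ divisors E × o ≡ o
      to {o} o∈ =
        let o∈′ , o∣m = ∈-filter⁻ (_∣? m) {xs = divisors D} o∈
            o∣E = gcd-greatest o∣m (proj₂ (∈-filter⁻ (_∣? D) {xs = upTo (suc D)} o∈′))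
        in ∈-filter⁺ (_∣? E) (∈-upTo⁺ (s≤s (∣⇒≤ {{>-nonZero 0<E}} o∣E))) o∣E , ≡.refl
      from : ∀ {o} → o ∈ divisors E → o ∈ filter (_∣? m) (divisors D) × o ≡ o
      from {o} o∈ =
        let o∣E = proj₂ (∈-filter⁻ (_∣? E) {xs = upTo (suc E)} o∈)
            o∣D = ∣-trans o∣E (gcd[m,n]∣n m D)
        in ∈-filter⁺ (_∣? m) (∈-filter⁺ (_∣? D) (∈-upTo⁺ (s≤s (∣⇒≤ {{>-nonZero 0<D}} o∣D))) o∣D) (∣-trans o∣E (gcd[m,n]∣m m D)) , ≡.refl
      outer : ∀ {o} → o ∈ divisors E → S.∑ (ofOrder E o) (Ξ E ^_) ≈ ramanujan o (Ξ o)
      outer {o} o∈ with proj₂ (∈-filter⁻ (_∣? E) {xs = upTo (suc E)} o∈)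
      ... | o∣E@(divides c e) = trans (ramanujan-^ {c = c} (Ξ E) 0<E e)
              (ramanujan-independent o (factor-positiveʳ c (subst (0 <_) e 0<E))
                (Primitive-^ {c} (factor-positiveˡ c (subst (0 <_) e 0<E)) (subst (λ E′ → Primitive K E′ (Ξ E)) e (Ξ-primitive′ (gcd[m,n]∣n m D))))
                (Ξ-primitive′ (∣-trans o∣E (gcd[m,n]∣n m D))))
      count : (d : Dec (E ≡ 1)) → (if does d then 1# else 0#) ≈ S.∑ (upTo D) (λ s → if does (Q? s) then 1# else 0#)
      count (yes E≡1) =
        let w , w<D , wm≅1 = inverse m D 0<D E≡1
            mw≅1 = subst (_≅ 1 [mod D ]) (ℕₚ.*-comm w m) wm≅1
        in sym (trans (S.∑-single (upTo⁺ D) (∈-upTo⁺ w<D) (λ {s} s∈ s≢w → S.if-no (Q? s) (λ Qs →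
                  s≢w (≅-unique (∈-upTo⁻ s∈) w<D (inverse-unique (subst (_≅ 1 [mod D ]) (ℕₚ.*-comm m s) (Q⇒ s Qs)) wm≅1)))))
                (S.if-yes (Q? w) (⇒Q w mw≅1)))
      count (no E≢1) = sym (S.∑-ε (upTo D) (λ {s} _ → S.if-no (Q? s) (λ Qs →
                       E≢1 (unit⇒coprime s m D (subst (_≅ 1 [mod D ]) (ℕₚ.*-comm m s) (Q⇒ s Qs))))))

-- Parity and signs

odd∣2* : ∀ {o} → Odd o → ∀ m → o ∣ 2 *ℕ m → o ∣ m
odd∣2* {o} (q , ≡.refl) m d = ∣m+n∣m⇒∣n (subst (o ∣_) (shuffle q m) (∣n⇒∣m*n (suc q) d)) (∣m⇒∣m*n m ∣-refl)
  where
  shuffle : ∀ q m → suc q *ℕ (2 *ℕ m) ≡ (1 +ℕ 2 *ℕ q) *ℕ m +ℕ m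
  shuffle = solve-∀

¬Even∧Odd : ∀ {o} → Even o → ¬ Odd o
¬Even∧Odd {o} (p , e) (q , e′) = 2∤1 (∣m+n∣m⇒∣n (subst (2 ∣_) (≡.trans (≡.trans (≡.sym e) e′) (ℕₚ.+-comm 1 (2 *ℕ q))) (m∣m*n p)) (m∣m*n q))
  where
  2∤1 : ¬ 2 ∣ 1
  2∤1 d with ∣1⇒≡1 d
  ... | ()

⌊2*n/2⌋ : ∀ q → ⌊ 2 *ℕ q /2⌋ ≡ q
⌊2*n/2⌋ q = ≡.trans (cong (λ t → ⌊ q +ℕ t /2⌋) (ℕₚ.+-identityʳ q)) (≡.sym (ℕₚ.n≡⌊n+n/2⌋ q))

-- The k-th power of the sign τ, where `true` stands for -1.
times : Bool → ℕ → Bool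
times τ zero = false
times τ (suc k) = times τ k xor τ

times-false : ∀ k → times false k ≡ false
times-false zero = ≡.refl
times-false (suc k) rewrite times-false k = ≡.refl

times-even : ∀ τ q → times τ (2 *ℕ q) ≡ false
times-even τ zero = ≡.refl
times-even τ (suc q) = subst (λ k → times τ k ≡ false) (≡.sym (ℕₚ.*-suc 2 q))
  (≡.trans (cong (λ b → (b xor τ) xor τ) (times-even τ q)) (cancel τ))
  where
  cancel : ∀ τ → τ xor τ ≡ false
  cancel false = ≡.refl
  cancel true = ≡.refl

times-odd : ∀ {k} → Odd k → times true k ≡ true
times-odd (q , ≡.refl) rewrite times-even true q = ≡.refl

times-true⁻ : ∀ {k} → times true k ≡ false → Even k
times-true⁻ {k} e with parity k
... | inj₁ ev = ev
... | inj₂ od with ≡.trans (≡.sym e) (times-odd od)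
...   | ()

module _ {n : ℕ} where

  flip : Bool → Letter n → Letter n
  flip false a = a
  flip true a = negL a

  flip-flip : ∀ b c a → flip b (flip c a) ≡ flip (b xor c) a
  flip-flip false c a = ≡.refl
  flip-flip true false a = ≡.refl
  flip-flip true true a = negL-involutive a

  iterL-flip : ∀ (x : SP n) b a t → iterL x (flip b a) t ≡ flip b (iterL x a t)
  iterL-flip x false a t = ≡.refl
  iterL-flip x true a t = iterL-neg x a t

  idx-flip : ∀ b a → idx (flip b a) ≡ idx a
  idx-flip false a = ≡.refl
  idx-flip true a = ≡.refl

  -- If x^h a = -a, then 2q divides 2h, so h = w q. An even w would make x^h fix a, and for odd w
  -- the powers x^h and x^q agree on a.
  half-order : ∀ {x : SP n} {a q} → IsOrder x a (2 *ℕ q) → NegC x a → iterL x a q ≡ negL a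
  half-order {x} {a} {q} i (h , e) = go (order⇒ i 2h)
    where
    2h : iterL x a (2 *ℕ h) ≡ a
    2h = ≡.trans (cong (λ t → iterL x a (h +ℕ t)) (ℕₚ.+-identityʳ h)) (≡.trans (iterL-+ x a h h)
           (≡.trans (cong (λ b → iterL x b h) e) (≡.trans (iterL-neg x a h) (≡.trans (cong negL e) (negL-involutive a)))))
    go : 2 *ℕ q ∣ 2 *ℕ h → iterL x a q ≡ negL a
    go d with *-cancelˡ-∣ {q} {h} 2 d
    ... | divides w ≡.refl with parity w
    ... | inj₁ (v , ≡.refl) = ⊥-elim (negL≢ a (≡.trans (≡.sym e) (⇒order i (divides v (shuffle v q)))))
      where
      shuffle : ∀ v q → 2 *ℕ v *ℕ q ≡ v *ℕ (2 *ℕ q)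
      shuffle = solve-∀
    ... | inj₂ (v , ≡.refl) = ≡.trans (iterL-≅ i (v , 0 , shuffle v q)) e
      where
      shuffle : ∀ v q → q +ℕ v *ℕ (2 *ℕ q) ≡ (1 +ℕ 2 *ℕ v) *ℕ q +ℕ 0
      shuffle = solve-∀

  idx-iterL-≅ : ∀ {x : SP n} {a q s t} → iterL x a q ≡ negL a → s ≅ t [mod q ] → idx (iterL x a s) ≡ idx (iterL x a t)
  idx-iterL-≅ {x} {a} {q} {s} {t} e (y , z , eq) =
    ≡.trans (≡.sym (drop s y)) (≡.trans (cong (λ u → idx (iterL x a u)) eq) (drop t z))
    where
    multiples : ∀ y → idx (iterL x a (y *ℕ q)) ≡ idx a
    multiples zero = ≡.refl
    multiples (suc y) = ≡.trans (cong idx (iterL-+ x a q (y *ℕ q)))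
      (≡.trans (idx-iterL x {iterL x a (y *ℕ q)} {a} q (multiples y)) (cong idx e))
    drop : ∀ s y → idx (iterL x a (s +ℕ y *ℕ q)) ≡ idx (iterL x a s)
    drop s y = ≡.trans (cong idx (iterL-+ x a s (y *ℕ q))) (idx-iterL x {iterL x a (y *ℕ q)} {a} s (multiples y))

-- Roots of unity attached to cycles and orbits

module Characters {c ℓ} (K : CharZeroField c ℓ) (n : ℕ) (ζ η : ℕ → CharZeroField.Carrier K)
  (ζ-primitive : ∀ i → 1 ≤ i → i ≤ n → Primitive K i (ζ i))
  (η-primitive : ∀ i → 1 ≤ i → i ≤ n → Primitive K (2 *ℕ i) (η i)) where

  open CharZeroField K
  open FieldLemmas K
  open import Relation.Binary.Reasoning.Setoid setoid

  -- The root of unity attached to the cycle of a.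
  κ : SP n → Letter n → Carrier
  κ x a = if negC? x a then η ⌊ orbitSize x a /2⌋ else ζ (orbitSize x a)

  -- The value of the cycle character on the displacement from b to a. Any letter b may serve as
  -- base point, not only the one of least index.
  χ : SP n → Letter n → Letter n → Carrier
  χ x b a = κ x b ^ position x b a

  κ-NegC : ∀ {x a o} → Perm x → IsOrder x a o → NegC x a → κ x a ≡ η ⌊ o /2⌋
  κ-NegC {x} {a} px i nc rewrite negC?-complete px nc | IsOrder-orbitSize px i = ≡.refl

  κ-¬NegC : ∀ {x a o} → Perm x → IsOrder x a o → ¬ NegC x a → κ x a ≡ ζ o
  κ-¬NegC {x} {a} px i ¬nc rewrite negC?-false {x = x} {a = a} ¬nc | IsOrder-orbitSize px i = ≡.refl

  -- A cycle of class -1 and length i has 2i letters, and `η i` has order 2i; so in both classes the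
  -- order of the root is the number of letters. The bound i ≤ n comes from `¬NegC⇒≤` in class +1
  -- and from the 2n letters in class -1.
  κ-primitive : ∀ {x a o} → Perm x → IsOrder x a o → Primitive K o (κ x a)
  κ-primitive {x} {a} {o} px i with NegC-dec px a
  ... | no ¬nc = subst (Primitive K o) (≡.sym (κ-¬NegC px i ¬nc)) (ζ-primitive o (positive i) (¬NegC⇒≤ px i ¬nc))
  ... | yes nc with NegC⇒even i nc
  ... | q , ≡.refl = subst (Primitive K (2 *ℕ q)) (≡.sym (≡.trans (κ-NegC px i nc) (cong η (⌊2*n/2⌋ q))))
                       (η-primitive q (factor-positiveʳ 2 (positive i))
                         (ℕₚ.*-cancelˡ-≤ 2 (subst (_≤ 2 *ℕ n) (IsOrder-orbitSize px i) (proj₂ (orbitSize-IsOrder px a)))))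

  κ-root : ∀ {x} → Perm x → ∀ a → κ x a ^ orbitSize x a ≈ 1#
  κ-root px a = proj₁ (κ-primitive px (proj₁ (orbitSize-IsOrder px a)))

  κ-SameCycle : ∀ {x} → Perm x → ∀ {a b} → SameCycle x a b → κ x a ≡ κ x b
  κ-SameCycle {x} px {a} {b} s = step (NegC-dec px a)
    where
    i = proj₁ (orbitSize-IsOrder px a)
    j = IsOrder-SameCycle px s i
    step : Dec (NegC x a) → κ x a ≡ κ x b
    step (yes nc) = ≡.trans (κ-NegC px i nc) (≡.sym (κ-NegC px j (NegC-SameCycle s nc)))
    step (no ¬nc) = ≡.trans (κ-¬NegC px i ¬nc)
      (≡.sym (κ-¬NegC px j (λ nc → ¬nc (NegC-SameCycle (SameCycle-sym px s) nc))))

  -- Any position may replace the one found by the search, because two positions are congruent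
  -- modulo the order of the root.
  χ-spec : ∀ {x} → Perm x → ∀ b a {e} → AtPosition x b a e → χ x b a ≈ κ x b ^ e
  χ-spec px b a r = ^-≅ (κ-root px b)
    (AtPosition-unique px b a (proj₁ (orbitSize-IsOrder px b)) (position-spec px b a r) r)

  χ-Unit : ∀ {x} → Perm x → ∀ b a → Unit (χ x b a)
  χ-Unit {x} px b a = root-Unit (position x b a) (positive (proj₁ (orbitSize-IsOrder px b))) (κ-root px b)

  -- Positions along a cycle add. This cocycle rule is what makes products over cycles telescope.
  χ-trans : ∀ {x} → Perm x → ∀ {a b d} → SameCycle x a b → SameCycle x b d → χ x a b * χ x b d ≈ χ x a d
  χ-trans {x} px {a} {b} {d} s t =
    let e , r = AtPosition-exists px a b s
        f , q = AtPosition-exists px b d t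
    in begin
      χ x a b * χ x b d          ≈⟨ *-cong (χ-spec px a b r) (χ-spec px b d q) ⟩
      κ x a ^ e * κ x b ^ f      ≡⟨ cong (λ k → κ x a ^ e * powK K k f) (κ-SameCycle px s) ⟨
      κ x a ^ e * κ x a ^ f      ≈⟨ *-comm _ _ ⟩
      κ x a ^ f * κ x a ^ e      ≈⟨ ^-+ (κ x a) f e ⟨
      κ x a ^ (f +ℕ e)           ≈⟨ χ-spec px a d (AtPosition-trans a b d r q) ⟨
      χ x a d                    ∎

  κ-apply : ∀ {x g} → Perm x → Perm g → Commute x g → ∀ a → κ x (apply g a) ≡ κ x a
  κ-apply {x} {g} px pg c a = step (NegC-dec px a)
    where
    i = proj₁ (orbitSize-IsOrder px a)
    step : Dec (NegC x a) → κ x (apply g a) ≡ κ x a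
    step (yes nc) = ≡.trans (κ-NegC px (IsOrder-apply pg c i) (NegC-apply c a nc)) (≡.sym (κ-NegC px i nc))
    step (no ¬nc) = ≡.trans (κ-¬NegC px (IsOrder-apply pg c i) (λ nc → ¬nc (NegC-apply⁻ pg c a nc))) (≡.sym (κ-¬NegC px i ¬nc))

  χ-apply : ∀ {x g} → Perm x → Perm g → Commute x g → ∀ {a b} → SameCycle x a b → χ x (apply g a) (apply g b) ≈ χ x a b
  χ-apply {x} {g} px pg c {a} {b} s =
    let e , r = AtPosition-exists px a b s
    in trans (χ-spec px (apply g a) (apply g b) (AtPosition-apply pg c a b r))
         (trans (reflexive (cong (λ k → powK K k e) (κ-apply px pg c a))) (sym (χ-spec px a b r)))

  -- The contribution to ω^x(g) of the ⟨x,g⟩-orbit of a.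
  F : SP n → SP n → Letter n → Carrier
  F x g a = χ x a (iterL g a (multiplicity x g a))

  Ω : SP n → SP n → Carrier
  Ω x g = P.∑ (orbitBases x g) (λ i → F x g (pos i))

  F-spec : ∀ {x g} → Perm x → Perm g → Commute x g → ∀ a {m e} → IsMultiplicity x g a m →
           AtPosition x a (iterL g a m) e → F x g a ≈ κ x a ^ e
  F-spec {x} {g} px pg c a {m} i r rewrite IsMultiplicity⇒≡ px pg c i = χ-spec px a (iterL g a m) r

  F-transfer : (h : Letter n → Letter n) → (∀ {a b} → h a ≡ h b → a ≡ b) → (∀ a → h (negL a) ≡ negL (h a)) →
               ∀ {x g x′ g′} a → (∀ p → h (iterL x a p) ≡ iterL x′ (h a) p) → (∀ p → h (iterL g a p) ≡ iterL g′ (h a) p) →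
               F x g a ≡ F x′ g′ (h a)
  F-transfer h inj neg {x} {g} {x′} {g′} a hx hg = go
    where
    open Transfer h inj neg
    κ-eq : κ x a ≡ κ x′ (h a)
    κ-eq rewrite negC?-transfer hx | orbitSize-transfer hx = ≡.refl
    go : F x g a ≡ F x′ g′ (h a)
    go = cong₂ (powK K) κ-eq (≡.trans (position-transfer hx (iterL g a (multiplicity x g a)))
           (cong (position x′ (h a)) (≡.trans (hg _) (cong (iterL g′ (h a)) (multiplicity-transfer hx hg)))))

  -- ξ^((o+1)/2) is the square root of ξ among the o-th roots of unity, o odd.
  Primitive-sqrt : ∀ {o ξ} → Odd o → Primitive K o ξ → Primitive K o (ξ ^ ⌊ suc o /2⌋)
  Primitive-sqrt {o} {ξ} (q , ≡.refl) (p , l) =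
    trans (sym (^-* ξ o k)) (trans (reflexive (cong (ξ ^_) (ℕₚ.*-comm o k))) (^-multiple {ξ} {o} k p)) ,
    λ j 1≤j j<o e → l j 1≤j j<o (begin
      ξ ^ j                        ≈⟨ ^-≅ p (q′ j) ⟨
      ξ ^ (2 *ℕ (j *ℕ k))          ≈⟨ ^-* ξ 2 (j *ℕ k) ⟩
      (ξ ^ (j *ℕ k)) ^ 2           ≈⟨ ^-cong 2 (trans (^-* ξ j k) e) ⟩
      1# ^ 2                       ≈⟨ 1^ 2 ⟩
      1#                           ∎)
    where
    k = ⌊ suc o /2⌋
    k≡ : k ≡ suc q
    k≡ = ≡.trans (cong ⌊_/2⌋ (≡.sym (ℕₚ.*-suc 2 q))) (⌊2*n/2⌋ (suc q))
    q′ : ∀ j → 2 *ℕ (j *ℕ k) ≅ j [mod o ]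
    q′ j = 0 , j , ≡.trans (ℕₚ.+-identityʳ _) (≡.trans (cong (λ k → 2 *ℕ (j *ℕ k)) k≡) (shuffle j q))
      where
      shuffle : ∀ j q → 2 *ℕ (j *ℕ suc q) ≡ j +ℕ j *ℕ (1 +ℕ 2 *ℕ q)
      shuffle = solve-∀

  -- Modulo the odd number o the exponent (o + 1)/2 is the inverse of 2.
  ^-sqrt : ∀ {o ξ} → Odd o → ξ ^ o ≈ 1# → ∀ u → (ξ ^ ⌊ suc o /2⌋) ^ (2 *ℕ u) ≈ ξ ^ u
  ^-sqrt {o} {ξ} (q , ≡.refl) p u = trans (sym (^-* ξ (2 *ℕ u) k)) (^-≅ p e)
    where
    k = ⌊ suc o /2⌋
    e : 2 *ℕ u *ℕ k ≅ u [mod o ]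
    e = 0 , u , ≡.trans (ℕₚ.+-identityʳ _) (≡.trans (cong (2 *ℕ u *ℕ_) (≡.trans (cong ⌊_/2⌋ (≡.sym (ℕₚ.*-suc 2 q))) (⌊2*n/2⌋ (suc q)))) (shuffle u q))
      where
      shuffle : ∀ u q → 2 *ℕ u *ℕ suc q ≡ u +ℕ u *ℕ (1 +ℕ 2 *ℕ q)
      shuffle = solve-∀

-- The contribution of the orbit through the twisted cycle of g

module LocalRoots {c ℓ} (K : CharZeroField c ℓ) (n : ℕ) (ζ η : ℕ → CharZeroField.Carrier K)
  (ζ-primitive : ∀ i → 1 ≤ i → i ≤ n → Primitive K i (ζ i))
  (η-primitive : ∀ i → 1 ≤ i → i ≤ n → Primitive K (2 *ℕ i) (η i))
  {g : SP n} (pg : Perm g) (j : Letter n) {D : ℕ} (iD : IsOrder g j D)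
  {r : ℕ} (0<r : 0 < r) {τ : Bool} (τ-sign : τ ≡ false ⊎ ¬ NegC g j) where

  open CharZeroField K
  open FieldLemmas K
  open Characters K n ζ η ζ-primitive η-primitive

  private
    0<D : 0 < D
    0<D = positive iD

    -- The root of unity whose powers F y g j are, when the twist s has order o in ℤ/D.  In the cases
    -- with ⌊ suc o /2⌋ only powers of its square occur.
    Ξ-of : Dec (NegC g j) → Bool → ∀ o → Even o ⊎ Odd o → Carrier
    Ξ-of (yes _) _     o (inj₁ _) = η ⌊ o *ℕ r /2⌋ ^ r
    Ξ-of (yes _) _     o (inj₂ _) = (ζ (o *ℕ r) ^ r) ^ ⌊ suc o /2⌋
    Ξ-of (no _)  true  o (inj₂ _) = (η (o *ℕ r) ^ (2 *ℕ r)) ^ ⌊ suc o /2⌋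
    Ξ-of (no _)  true  o (inj₁ _) = ζ (o *ℕ r) ^ r
    Ξ-of (no _)  false o _        = ζ (o *ℕ r) ^ r

  Ξ : ℕ → Carrier
  Ξ o = Ξ-of (NegC-dec pg j) τ o (parity o)

  -- After normalisation y^r acts on j as ± g^s with sign `τ`. The sign -1 is kept only when the
  -- cycle of g has class +1; in class -1 it can be absorbed into s.
  module _ {y : SP n} (py : Perm y) (com : Commute y g) (s : ℕ)
           (y^r : iterL y j r ≡ flip τ (iterL g j s))
           (r-divides : ∀ p t → idx (iterL y j p) ≡ idx (iterL g j t) → r ∣ p) where

    private
      o d u : ℕ
      o = order s D
      d = gcd s D
      u = proj₁ (bézout s D 0<D)
      us≅d : u *ℕ s ≅ d [mod D ]
      us≅d = proj₂ (bézout s D 0<D)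
      0<o : 0 < o
      0<o = order-positive s 0<D
      0<or : 0 < o *ℕ r
      0<or = ℕₚ.*-mono-≤ 0<o 0<r
      D≡od : D ≡ o *ℕ d
      D≡od = order*gcd s D

    -- As y commutes with g, each further return multiplies by the same ± g^s.
    iterL-*r : ∀ k → iterL y j (k *ℕ r) ≡ flip (times τ k) (iterL g j (k *ℕ s))
    iterL-*r zero = ≡.refl
    iterL-*r (suc k) = begin
        iterL y j (r +ℕ k *ℕ r)                                        ≡⟨ iterL-+ y j r (k *ℕ r) ⟩
        iterL y (iterL y j (k *ℕ r)) r                                 ≡⟨ cong (λ a → iterL y a r) (iterL-*r k) ⟩
        iterL y (flip (times τ k) (iterL g j (k *ℕ s))) r              ≡⟨ iterL-flip y (times τ k) _ r ⟩
        flip (times τ k) (iterL y (iterL g j (k *ℕ s)) r)              ≡⟨ cong (flip (times τ k)) (iterL-comm com j r (k *ℕ s)) ⟩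
        flip (times τ k) (iterL g (iterL y j r) (k *ℕ s))              ≡⟨ cong (λ a → flip (times τ k) (iterL g a (k *ℕ s))) y^r ⟩
        flip (times τ k) (iterL g (flip τ (iterL g j s)) (k *ℕ s))     ≡⟨ cong (flip (times τ k)) (iterL-flip g τ (iterL g j s) (k *ℕ s)) ⟩
        flip (times τ k) (flip τ (iterL g (iterL g j s) (k *ℕ s)))     ≡⟨ flip-flip (times τ k) τ _ ⟩
        flip (times τ (suc k)) (iterL g (iterL g j s) (k *ℕ s))        ≡⟨ cong (flip (times τ (suc k))) (iterL-+ g j (k *ℕ s) s) ⟨
        flip (times τ (suc k)) (iterL g j (k *ℕ s +ℕ s))               ≡⟨ cong (λ t → flip (times τ (suc k)) (iterL g j t)) (ℕₚ.+-comm (k *ℕ s) s) ⟩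
        flip (times τ (suc k)) (iterL g j (s +ℕ k *ℕ s))               ∎
      where open ≡.≡-Reasoning

    iterL-*r-even : ∀ k → times τ k ≡ false → iterL y j (k *ℕ r) ≡ iterL g j (k *ℕ s)
    iterL-*r-even k e = ≡.trans (iterL-*r k) (cong (λ b → flip b (iterL g j (k *ℕ s))) e)

    iterL-*r-odd : ∀ k → times τ k ≡ true → iterL y j (k *ℕ r) ≡ negL (iterL g j (k *ℕ s))
    iterL-*r-odd k e = ≡.trans (iterL-*r k) (cong (λ b → flip b (iterL g j (k *ℕ s))) e)

    idx-iterL-*r : ∀ k → idx (iterL y j (k *ℕ r)) ≡ idx (iterL g j (k *ℕ s))
    idx-iterL-*r k = ≡.trans (cong idx (iterL-*r k)) (idx-flip (times τ k) (iterL g j (k *ℕ s)))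

    ¬times-NegC : ∀ k → times τ k ≡ true → ¬ NegC g j
    ¬times-NegC k e nc = go τ-sign
      where
      go : τ ≡ false ⊎ ¬ NegC g j → _
      go (inj₁ ≡.refl) with ≡.trans (≡.sym e) (times-false k)
      ... | ()
      go (inj₂ ¬nc) = ¬nc nc

    -- The path returns to the cycle of g only at multiples of r. A remaining sign -1 would place -j
    -- on the cycle of j under g, which `τ-sign` excludes.
    iterL≡g-iterL⁻ : ∀ p t → iterL y j p ≡ iterL g j t → ∃ λ k → p ≡ k *ℕ r × times τ k ≡ false × k *ℕ s ≅ t [mod D ]
    iterL≡g-iterL⁻ p t e with r-divides p t (cong idx e)
    ... | divides k ≡.refl with times τ k in eq
    ...   | false = k , ≡.refl , eq , ≅-iterL pg iD (≡.trans (≡.sym (iterL-*r-even k eq)) e)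
    ...   | true  = ⊥-elim (¬times-NegC k eq (iterL-neg⇒NegC pg j t (k *ℕ s) (≡.trans (≡.sym e) (iterL-*r-odd k eq))))

    iterL≡g-iterL⁺ : ∀ k t → times τ k ≡ false → k *ℕ s ≅ t [mod D ] → iterL y j (k *ℕ r) ≡ iterL g j t
    iterL≡g-iterL⁺ k t e c = ≡.trans (iterL-*r-even k e) (iterL-≅ iD c)

    private
      returns⁻ : ∀ p → iterL y j p ≡ j → ∃ λ k → p ≡ k *ℕ r × times τ k ≡ false × o ∣ k
      returns⁻ p e = let k , e₁ , e₂ , e₃ = iterL≡g-iterL⁻ p 0 e
                     in k , e₁ , e₂ , proj₁ (∣*⇔order∣ 0<D s k) (≅0⇒∣ e₃)

      returns⁺ : ∀ k → times τ k ≡ false → o ∣ k → iterL y j (k *ℕ r) ≡ j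
      returns⁺ k e o∣k = iterL≡g-iterL⁺ k 0 e (∣⇒≅0 (proj₂ (∣*⇔order∣ 0<D s k) o∣k))

      order-or : (∀ k → o ∣ k → times τ k ≡ false) → IsOrder y j (o *ℕ r)
      order-or h = isOrder 0<or
        (λ {t} e → case-back (returns⁻ t e))
        (λ { (divides q ≡.refl) → subst (λ t → iterL y j t ≡ j) (ℕₚ.*-assoc q o r) (returns⁺ (q *ℕ o) (h (q *ℕ o) (n∣m*n q)) (n∣m*n q)) })
        where
        case-back : ∀ {t} → (∃ λ k → t ≡ k *ℕ r × times τ k ≡ false × o ∣ k) → o *ℕ r ∣ t
        case-back (k , ≡.refl , _ , o∣k) = *-monoˡ-∣ r o∣k

      -- Up to sign, the cycle of y through j meets the cycle of g exactly in the letters g^(k s) j,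
      -- which reduces the multiplicity to arithmetic with exponents.
      multiplicity-of : ∀ {m} → 0 < m → ∀ v → idx (iterL g j (v *ℕ s)) ≡ idx (iterL g j m) →
                        (∀ k q → idx (iterL g j (k *ℕ s)) ≡ idx (iterL g j q) → m ∣ q) → IsMultiplicity y g j m
      multiplicity-of 0<m v e h = isMultiplicity 0<m (v *ℕ r , ≡.trans (idx-iterL-*r v) e) λ { q (p , e′) → div q p e′ (r-divides p q e′) }
        where
        div : ∀ q p → idx (iterL y j p) ≡ idx (iterL g j q) → r ∣ p → _
        div q _ e′ (divides k ≡.refl) = h k q (≡.trans (≡.sym (idx-iterL-*r k)) e′)

      d∣ks : ∀ k → d ∣ k *ℕ s
      d∣ks k = ∣n⇒∣m*n k (gcd[m,n]∣m s D)

      g-idx⇒≅ : ¬ NegC g j → ∀ s t → idx (iterL g j s) ≡ idx (iterL g j t) → s ≅ t [mod D ]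
      g-idx⇒≅ ¬nc s t e with idx-≡ {n} {iterL g j s} {iterL g j t} e
      ... | inj₁ e′ = ≅-iterL pg iD e′
      ... | inj₂ e′ = ⊥-elim (¬nc (iterL-neg⇒NegC pg j s t e′))

      multiplicity-d : ¬ NegC g j → IsMultiplicity y g j d
      multiplicity-d ¬nc = multiplicity-of (gcd-positive s 0<D) u (cong idx (iterL-≅ iD us≅d))
        λ k q e → ≅-∣ (gcd[m,n]∣n s D) (g-idx⇒≅ ¬nc (k *ℕ s) q e) (d∣ks k)

      Result : Carrier → Set _
      Result ξ = Primitive K o ξ × ∃ λ v → v *ℕ s ≅ d [mod D ] × F y g j ≈ ξ ^ v

      -- Since o s vanishes modulo D, o may be added to the coefficient u, and for odd o this
      -- changes its parity.
      even-bézout : Odd o → ∃ λ v → 2 *ℕ v *ℕ s ≅ d [mod D ]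
      even-bézout od with parity u
      ... | inj₁ (v , e) = v , subst (λ u → u *ℕ s ≅ d [mod D ]) e us≅d
      ... | inj₂ (v , e) with od
      ...   | q , e′ = suc (v +ℕ q) , subst (λ w → w *ℕ s ≅ d [mod D ]) sum
                (≅-trans (subst₂′ (≅-+ us≅d os≅0)) (≅-reflexive (ℕₚ.+-identityʳ d)))
        where
        os≅0 : o *ℕ s ≅ 0 [mod D ]
        os≅0 = ∣⇒≅0 (proj₂ (∣*⇔order∣ 0<D s o) ∣-refl)
        subst₂′ : u *ℕ s +ℕ o *ℕ s ≅ d +ℕ 0 [mod D ] → (u +ℕ o) *ℕ s ≅ d +ℕ 0 [mod D ]
        subst₂′ = subst (_≅ d +ℕ 0 [mod D ]) (≡.sym (ℕₚ.*-distribʳ-+ s u o))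
        sum : u +ℕ o ≡ 2 *ℕ suc (v +ℕ q)
        sum = ≡.trans (cong₂ _+ℕ_ e e′) (shuffle v q)
          where
          shuffle : ∀ v q → (1 +ℕ 2 *ℕ v) +ℕ (1 +ℕ 2 *ℕ q) ≡ 2 *ℕ suc (v +ℕ q)
          shuffle = solve-∀

      -- The cycle of y has o r letters, so the r-th power of its root has order o; the position u r
      -- of g^d j makes F the u-th power of that.
      result-plain : ∀ {ξ} → IsOrder y j (o *ℕ r) → κ y j ≡ ξ → ∀ {m} → IsMultiplicity y g j m → m ≡ d →
                     AtPosition y j (iterL g j d) (u *ℕ r) → Result (ξ ^ r)
      result-plain i ≡.refl im ≡.refl at =
        Primitive-^ 0<r (subst (λ t → Primitive K t (κ y j)) (ℕₚ.*-comm o r) (κ-primitive py i)) ,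
        u , us≅d , trans (F-spec py pg com j im at) (^-* (κ y j) u r)

      -- Here v is only half of a Bézout coefficient. Passing to the square root of ξ doubles the
      -- exponent and restores the required congruence.
      result-sqrt : ∀ {ξ} → Odd o → Primitive K o ξ → ∀ v → 2 *ℕ v *ℕ s ≅ d [mod D ] → F y g j ≈ ξ ^ v →
                    Result (ξ ^ ⌊ suc o /2⌋)
      result-sqrt od prim v e f = Primitive-sqrt od prim , 2 *ℕ v , e , trans f (sym (^-sqrt od (proj₁ prim) v))

      -- An equation y^p j = -j would give class -1 to the cycle of g or a sign -1 at a multiple of
      -- o. So y has class +1 at j as well: its cycle has o r letters, and the sign of y^(u r) j is
      -- ignored.
      result-positive : ¬ NegC g j → (∀ k → o ∣ k → times τ k ≡ false) → Result (ζ (o *ℕ r) ^ r)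
      result-positive ¬nc h = result-plain i (κ-¬NegC py i ¬nc-y) (multiplicity-d ¬nc) ≡.refl (at (times τ u) ≡.refl)
        where
        i = order-or h
        ¬nc-y : ¬ NegC y j
        ¬nc-y (p , e) with r-divides p 0 (cong idx e)
        ... | divides k ≡.refl with times τ k in eq
        ...   | false = ¬nc (k *ℕ s , ≡.trans (≡.sym (iterL-*r-even k eq)) e)
        ...   | true with ≡.trans (≡.sym eq) (h k (proj₁ (∣*⇔order∣ 0<D s k) (order⇒ iD
                        (negL-injective (≡.trans (≡.sym (iterL-*r-odd k eq)) e)))))
        ...     | ()
        at : ∀ b → times τ u ≡ b → AtPosition y j (iterL g j d) (u *ℕ r)
        at false e = inj₁ (iterL≡g-iterL⁺ u d e us≅d)
        at true e = inj₂ (¬nc-y , ≡.trans (iterL-*r-odd u e) (cong negL (iterL-≅ iD us≅d)))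

      -- Since o is odd, y^(o r) j = -j, and the cycle of y has class -1 with 2 o r letters. Signs
      -- now count, so g^d j must be reached by an even number 2v of returns; F is then the v-th
      -- power of η^(2r), whose order is o.
      result-twisted : τ ≡ true → ¬ NegC g j → Odd o → Result ((η (o *ℕ r) ^ (2 *ℕ r)) ^ ⌊ suc o /2⌋)
      result-twisted ≡.refl ¬nc od = result-sqrt od
          (Primitive-^ {2 *ℕ r} {o} (ℕₚ.*-mono-≤ (s≤s (z≤n {1})) 0<r) (≡.subst₂ (Primitive K) (shuffle o r) κ≡ (κ-primitive py i)))
          (proj₁ ev) (proj₂ ev)
          (trans (F-spec py pg com j (multiplicity-d ¬nc) (inj₁ (iterL≡g-iterL⁺ (2 *ℕ v) d (times-even τ v) (proj₂ ev))))
            (trans (reflexive (cong₂ (powK K) κ≡ (shuffle′ v r))) (^-* (η (o *ℕ r)) v (2 *ℕ r))))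
        where
        ev = even-bézout od
        v = proj₁ ev
        nc : NegC y j
        nc = o *ℕ r , ≡.trans (iterL-*r-odd o (times-odd od)) (cong negL (⇒order iD (proj₂ (∣*⇔order∣ 0<D s o) ∣-refl)))
        i : IsOrder y j (2 *ℕ (o *ℕ r))
        i = isOrder (ℕₚ.*-mono-≤ (s≤s (z≤n {1})) 0<or)
          (λ {t} e → back (returns⁻ t e))
          (λ { (divides q ≡.refl) → subst (λ t → iterL y j t ≡ j) (shuffle″ q o r) (returns⁺ (2 *ℕ (q *ℕ o)) (times-even true (q *ℕ o)) (∣n⇒∣m*n 2 (n∣m*n q))) })
          where
          shuffle″ : ∀ q o r → 2 *ℕ (q *ℕ o) *ℕ r ≡ q *ℕ (2 *ℕ (o *ℕ r))
          shuffle″ = solve-∀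
          back : ∀ {t} → (∃ λ k → t ≡ k *ℕ r × times true k ≡ false × o ∣ k) → 2 *ℕ (o *ℕ r) ∣ t
          back (k , ≡.refl , e , o∣k) with times-true⁻ {k} e
          ... | q , ≡.refl = subst (_∣ 2 *ℕ q *ℕ r) (ℕₚ.*-assoc 2 o r) (*-monoˡ-∣ r (*-monoʳ-∣ 2 (odd∣2* od q o∣k)))
        κ≡ : κ y j ≡ η (o *ℕ r)
        κ≡ = ≡.trans (κ-NegC py i nc) (cong η (⌊2*n/2⌋ (o *ℕ r)))
        shuffle : ∀ o r → 2 *ℕ (o *ℕ r) ≡ 2 *ℕ r *ℕ o
        shuffle = solve-∀
        shuffle′ : ∀ v r → 2 *ℕ v *ℕ r ≡ v *ℕ (2 *ℕ r)
        shuffle′ = solve-∀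

      module _ (nc : NegC g j) {q : ℕ} (D≡2q : D ≡ 2 *ℕ q) where

        τ≡false : τ ≡ false
        τ≡false = go τ-sign
          where
          go : τ ≡ false ⊎ ¬ NegC g j → τ ≡ false
          go (inj₁ e) = e
          go (inj₂ ¬nc) = ⊥-elim (¬nc nc)

        untwisted : ∀ k → times τ k ≡ false
        untwisted k = ≡.trans (cong (λ τ → times τ k) τ≡false) (times-false k)

        g^q : iterL g j q ≡ negL j
        g^q = half-order (subst (IsOrder g j) D≡2q iD) nc

        order-y : IsOrder y j (o *ℕ r)
        order-y = order-or (λ k _ → untwisted k)

        idx⇒≅ : ∀ s t → idx (iterL g j s) ≡ idx (iterL g j t) → s ≅ t [mod q ]
        idx⇒≅ s t e with idx-≡ {n} {iterL g j s} {iterL g j t} e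
        ... | inj₁ e′ = ≅-weaken (divides 2 D≡2q) (≅-iterL pg iD e′)
        ... | inj₂ e′ = ≅-trans (≅-weaken (divides 2 D≡2q) (≅-iterL pg iD (≡.trans e′ (≡.sym shifted)))) (0 , 1 , ≡.trans (ℕₚ.+-identityʳ _) (cong (t +ℕ_) (≡.sym (ℕₚ.+-identityʳ q))))
          where
          shifted : iterL g j (t +ℕ q) ≡ negL (iterL g j t)
          shifted = ≡.trans (iterL-+ g j t q) (≡.trans (cong (λ a → iterL g a t) g^q) (iterL-neg g j t))

        -- Equality up to sign of powers of g at j determines exponents modulo q = o′ d. This is
        -- still a multiple of d, so the multiplicity remains d.
        result-even : Even o → Result (η ⌊ o *ℕ r /2⌋ ^ r)
        result-even (o′ , o≡) = result-plain order-y (κ-NegC py order-y nc-y)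
            (multiplicity-of (gcd-positive s 0<D) u (cong idx (iterL-≅ iD us≅d))
              λ k t e → ≅-∣ (divides o′ q≡) (idx⇒≅ (k *ℕ s) t e) (d∣ks k)) ≡.refl
            (inj₁ (iterL≡g-iterL⁺ u d (untwisted u) us≅d))
          where
          q≡ : q ≡ o′ *ℕ d
          q≡ = ℕₚ.*-cancelˡ-≡ q (o′ *ℕ d) 2 (≡.trans (≡.sym D≡2q) (≡.trans D≡od (≡.trans (cong (_*ℕ d) o≡) (ℕₚ.*-assoc 2 o′ d))))
          -- y^(o′r) j = g^(o′s) j, and o′s is an odd multiple of q because o does not divide o′.
          nc-y : NegC y j
          nc-y = o′ *ℕ r , ≡.trans (iterL-*r-even o′ (untwisted o′)) (odd-case (parity v))
            where
            v = quotient (gcd[m,n]∣m s D)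
            o′s≡ : o′ *ℕ s ≡ v *ℕ q
            o′s≡ = ≡.trans (cong (o′ *ℕ_) (m∣n⇒n≡quotient*m (gcd[m,n]∣m s D))) (≡.trans (shuffle o′ v d) (cong (v *ℕ_) (≡.sym q≡)))
              where
              shuffle : ∀ o v d → o *ℕ (v *ℕ d) ≡ v *ℕ (o *ℕ d)
              shuffle = solve-∀
            odd-case : Even v ⊎ Odd v → iterL g j (o′ *ℕ s) ≡ negL j
            odd-case (inj₂ (w , v≡)) = ≡.trans (iterL-≅ iD (0 , w , ≡.trans (ℕₚ.+-identityʳ _) (≡.trans o′s≡
                (≡.trans (cong (_*ℕ q) v≡) (≡.trans (shuffle w q) (cong (λ D → q +ℕ w *ℕ D) (≡.sym D≡2q))))))) g^q
              where
              shuffle : ∀ w q → (1 +ℕ 2 *ℕ w) *ℕ q ≡ q +ℕ w *ℕ (2 *ℕ q)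
              shuffle = solve-∀
            odd-case (inj₁ (w , v≡)) = ⊥-elim (ℕₚ.<⇒≱ (o′<o) (∣⇒≤ {{>-nonZero 0<o′}} (proj₁ (∣*⇔order∣ 0<D s o′) D∣)))
              where
              shuffle : ∀ w q → 2 *ℕ w *ℕ q ≡ w *ℕ (2 *ℕ q)
              shuffle = solve-∀
              D∣ : D ∣ o′ *ℕ s
              D∣ = divides w (≡.trans o′s≡ (≡.trans (cong (_*ℕ q) v≡) (≡.trans (shuffle w q) (cong (w *ℕ_) (≡.sym D≡2q)))))
              0<o′ : 0 < o′
              0<o′ = factor-positiveʳ 2 (subst (0 <_) o≡ 0<o)
              o′<o : o′ < o
              o′<o = subst (o′ <_) (≡.sym o≡) (ℕₚ.m<m+n o′ (ℕₚ.<-≤-trans 0<o′ (ℕₚ.m≤m+n o′ 0)))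

        -- For odd o the even number D = o d forces d = 2m and q = o m. The congruence 2 v s ≡ d
        -- modulo 2q halves to v s ≡ m modulo q, and up to sign g has period q at j, so the
        -- multiplicity is d/2. The cycle of y has class +1, hence the sign at g^m j is ignored.
        result-odd : Odd o → Result ((ζ (o *ℕ r) ^ r) ^ ⌊ suc o /2⌋)
        result-odd od = go (even-d od (parity d))
          where
          ev = even-bézout od
          v = proj₁ ev
          ¬nc-y : ¬ NegC y j
          ¬nc-y (p , e) with r-divides p 0 (cong idx e)
          ... | divides k ≡.refl = negL≢ j (≡.trans (≡.sym e) (returns⁺ k (untwisted k) (odd∣2* od k o∣2k)))
            where
            o∣2k : o ∣ 2 *ℕ k
            o∣2k = proj₁ (∣*⇔order∣ 0<D s (2 *ℕ k)) (subst (_∣ 2 *ℕ k *ℕ s) (≡.sym D≡2q)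
              (subst (2 *ℕ q ∣_) (≡.sym (ℕₚ.*-assoc 2 k s)) (*-monoʳ-∣ 2 (≅0⇒∣ (idx⇒≅ (k *ℕ s) 0
                (≡.trans (≡.sym (idx-iterL-*r k)) (cong idx e)))))))
          even-d : Odd o → Even d ⊎ Odd d → Even d
          even-d od (inj₁ m) = m
          even-d (a , e) (inj₂ (b , e′)) = ⊥-elim (¬Even∧Odd (q , D≡2q) (2 *ℕ a *ℕ b +ℕ a +ℕ b , ≡.trans D≡od (≡.trans (cong₂ _*ℕ_ e e′) (shuffle a b))))
            where
            shuffle : ∀ a b → (1 +ℕ 2 *ℕ a) *ℕ (1 +ℕ 2 *ℕ b) ≡ 1 +ℕ 2 *ℕ (2 *ℕ a *ℕ b +ℕ a +ℕ b)
            shuffle = solve-∀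
          go : Even d → Result ((ζ (o *ℕ r) ^ r) ^ ⌊ suc o /2⌋)
          go (m , d≡) = result-sqrt od
              (Primitive-^ 0<r (≡.subst₂ (Primitive K) (ℕₚ.*-comm o r) κ≡ (κ-primitive py order-y)))
              v (proj₂ ev)
              (trans (F-spec py pg com j im at) (trans (reflexive (cong (λ k → powK K k (v *ℕ r)) κ≡)) (^-* (ζ (o *ℕ r)) v r)))
            where
            κ≡ : κ y j ≡ ζ (o *ℕ r)
            κ≡ = κ-¬NegC py order-y ¬nc-y
            q≡ : q ≡ o *ℕ m
            q≡ = ℕₚ.*-cancelˡ-≡ q (o *ℕ m) 2 (≡.trans (≡.sym D≡2q) (≡.trans D≡od (≡.trans (cong (o *ℕ_) d≡) (shuffle o m))))
              where
              shuffle : ∀ o m → o *ℕ (2 *ℕ m) ≡ 2 *ℕ (o *ℕ m)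
              shuffle = solve-∀
            0<m : 0 < m
            0<m = factor-positiveʳ 2 (subst (0 <_) d≡ (gcd-positive s 0<D))
            vs≅m : v *ℕ s ≅ m [mod q ]
            vs≅m = ≅-unscale 2 (≡.subst₂ (λ a D → a ≅ 2 *ℕ m [mod D ]) (ℕₚ.*-assoc 2 v s) D≡2q (subst (λ d → 2 *ℕ v *ℕ s ≅ d [mod D ]) d≡ (proj₂ ev)))
            im : IsMultiplicity y g j m
            im = multiplicity-of 0<m v (idx-iterL-≅ g^q vs≅m)
              λ k t e → ≅-∣ (divides o q≡) (idx⇒≅ (k *ℕ s) t e) (∣-trans (divides 2 d≡) (d∣ks k))
            at : AtPosition y j (iterL g j m) (v *ℕ r)
            at = at-of (idx-≡ {n} {iterL y j (v *ℕ r)} {iterL g j m} (≡.trans (idx-iterL-*r v) (idx-iterL-≅ g^q vs≅m)))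
              where
              at-of : iterL y j (v *ℕ r) ≡ iterL g j m ⊎ iterL y j (v *ℕ r) ≡ negL (iterL g j m) → AtPosition y j (iterL g j m) (v *ℕ r)
              at-of (inj₁ e) = inj₁ e
              at-of (inj₂ e) = inj₂ (¬nc-y , e)

    local-root : Primitive K (order s D) (Ξ (order s D)) × ∃ λ v → v *ℕ s ≅ gcd s D [mod D ] × F y g j ≈ Ξ (order s D) ^ v
    local-root = go (NegC-dec pg j) τ ≡.refl (parity o)
      where
      go : (ν : Dec (NegC g j)) (τ′ : Bool) → τ ≡ τ′ → (p : Even o ⊎ Odd o) → Result (Ξ-of ν τ′ o p)
      go (yes nc) _     _ (inj₁ ev) = result-even nc {proj₁ (NegC⇒even iD nc)} (proj₂ (NegC⇒even iD nc)) ev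
      go (yes nc) _     _ (inj₂ od) = result-odd nc {proj₁ (NegC⇒even iD nc)} (proj₂ (NegC⇒even iD nc)) od
      go (no ¬nc) true  e (inj₂ od) = result-twisted e ¬nc od
      -- For even o the sign is trivial at every multiple of o.
      go (no ¬nc) true  e (inj₁ (h , o≡)) = result-positive ¬nc λ { k (divides w k≡) →
        subst (λ k → times τ k ≡ false) (≡.sym (≡.trans k≡ (≡.trans (cong (w *ℕ_) o≡) (shuffle w h)))) (times-even τ (w *ℕ h)) }
        where
        shuffle : ∀ w h → w *ℕ (2 *ℕ h) ≡ 2 *ℕ (w *ℕ h)
        shuffle = solve-∀
      go (no ¬nc) false e p = result-positive ¬nc λ k _ → ≡.trans (cong (λ τ → times τ k) e) (times-false k)

-- Exchanging character factors for root conditions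

module Hybrid {c ℓ} (K : CharZeroField c ℓ) (n : ℕ) (ζ η : ℕ → CharZeroField.Carrier K)
  (ζ-primitive : ∀ i → 1 ≤ i → i ≤ n → Primitive K i (ζ i))
  (η-primitive : ∀ i → 1 ≤ i → i ≤ n → Primitive K (2 *ℕ i) (η i))
  (k : ℕ) {g : SP n} (pg : Perm g) where

  open CharZeroField K
  open FieldLemmas K
  open Characters K n ζ η ζ-primitive η-primitive

  rootFactor charFactor : SP n → Fin n → Carrier
  rootFactor y i = if does (iterL y (pos i) k ≟L apply g (pos i)) then 1# else 0#
  charFactor y i = if does (iterL y (pos i) k ≟L pos i) then F y g (pos i) else 0#

  centralizer : List (SP n)
  centralizer = filter (λ y → commute? y g) (Bn n)

  centralizer-unique : Unique centralizer
  centralizer-unique = Unique-filter⁺ (λ y → commute? y g) (Bn-unique n)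

  ∈-centralizer⁺ : ∀ {y} → Perm y → Commute y g → y ∈ centralizer
  ∈-centralizer⁺ py c = ∈-filter⁺ (λ y → commute? y g) (∈-Bn⁺ py) (Commute⇒∘B c)

  ∈-centralizer⁻ : ∀ {y} → y ∈ centralizer → Perm y × Commute y g
  ∈-centralizer⁻ {y} p = let q , e = ∈-filter⁻ (λ y → commute? y g) {xs = Bn n} p in ∈-Bn⁻ q , ∘B⇒Commute e

  module Local (j : Fin n) where
    open Twist pg (pos j)

    D : ℕ
    D = orbitSize g (pos j)

    iD : IsOrder g (pos j) D
    iD = proj₁ (orbitSize-IsOrder pg (pos j))

    0<D : 0 < D
    0<D = positive iD

    module _ {y : SP n} (py : Perm y) (com : Commute y g) where

      private
        b : Letter n
        b = pos j

        Signed : ℕ → Set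
        Signed r = ∃₂ λ τ s₀ → (τ ≡ false ⊎ ¬ NegC g b) × iterL y b r ≡ flip τ (iterL g b s₀)

        -- If -b is reached from b by a power of g, a negative sign is absorbed into the exponent;
        -- otherwise it is recorded in `τ`.
        signed : ∀ r → SameCycle g b (iterL y b r) → Signed r
        signed r (t , e) = go (idx-≡ {n} {iterL y b r} {iterL g b t} (≡.sym e)) (NegC-dec pg b)
          where
          go : iterL y b r ≡ iterL g b t ⊎ iterL y b r ≡ negL (iterL g b t) → Dec (NegC g b) → Signed r
          go (inj₁ e) _ = false , t , inj₁ ≡.refl , e
          go (inj₂ e) (no ¬nc) = true , t , inj₂ ¬nc , e
          go (inj₂ e) (yes (h , e′)) = false , t +ℕ h , inj₁ ≡.refl , ≡.trans e
            (≡.sym (≡.trans (iterL-+ g b t h) (≡.trans (cong (λ a → iterL g a t) e′) (iterL-neg g b t))))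

        module Signs {r : ℕ} (i : IsMultiplicity g y b r) {τ s₀} (τ-sign : τ ≡ false ⊎ ¬ NegC g b)
                     (y^r : iterL y b r ≡ flip τ (iterL g b s₀)) where

          -- The exponent -s₀ modulo D. Starting the twists there normalises the action of y^r on b
          -- to ± g^s.
          s₁ : ℕ
          s₁ = complement pg b s₀

          Y : ℕ → SP n
          Y s = twist y g b (s +ℕ s₁)

          pY : ∀ s → Perm (Y s)
          pY s = twist-Perm py com (s +ℕ s₁)

          cY : ∀ s → Commute (Y s) g
          cY s = twist-Commute py com (s +ℕ s₁)

          Y^ : ∀ s q → 0 < q → q ≤ r → iterL (Y s) b q ≡ iterL g (iterL y b q) (s +ℕ s₁)
          Y^ s (suc q) _ q<r = ≡.trans (twist-before-return com i (s +ℕ s₁) q q<r) (iterL-comm com b (suc q) (s +ℕ s₁))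

          Y^r : ∀ s → iterL (Y s) b r ≡ flip τ (iterL g b s)
          Y^r s = begin
              iterL (Y s) b r                                  ≡⟨ Y^ s r (m-positive i) ℕₚ.≤-refl ⟩
              iterL g (iterL y b r) (s +ℕ s₁)                  ≡⟨ cong (λ a → iterL g a (s +ℕ s₁)) y^r ⟩
              iterL g (flip τ (iterL g b s₀)) (s +ℕ s₁)        ≡⟨ iterL-flip g τ (iterL g b s₀) (s +ℕ s₁) ⟩
              flip τ (iterL g (iterL g b s₀) (s +ℕ s₁))        ≡⟨ cong (flip τ) (iterL-+ g (iterL g b s₀) s s₁) ⟩
              flip τ (iterL g (iterL g (iterL g b s₀) s₁) s)   ≡⟨ cong (λ a → flip τ (iterL g a s)) (iterL-complement pg b s₀) ⟩
              flip τ (iterL g b s)                             ∎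
            where open ≡.≡-Reasoning

          -- Up to step r the twist moves each letter of the path only within its cycle of g, so the
          -- first return stays at r.
          iY : ∀ s → IsMultiplicity g (Y s) b r
          iY s = least⇒IsMultiplicity pg (pY s) (Commute-sym (cY s)) (m-positive i)
            (s , ≡.sym (≡.trans (cong idx (Y^r s)) (idx-flip τ (iterL g b s))))
            λ q 0<q q<r h → ℕₚ.<⇒≱ q<r (∣⇒≤ {{>-nonZero 0<q}} (divides-returns i q
              (SameCycle-trans
                (subst (SameCycle g b) (Y^ s q 0<q (ℕₚ.<⇒≤ q<r)) h)
                (SameCycle-sym pg (SameCycle-iterL (iterL y b q) (s +ℕ s₁))))))

          r-divides : ∀ s p t → idx (iterL (Y s) b p) ≡ idx (iterL g b t) → r ∣ p
          r-divides s p t e = divides-returns (iY s) p (t , ≡.sym e)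

          module L = LocalRoots K n ζ η ζ-primitive η-primitive pg b iD (m-positive i) {τ} τ-sign

          Sums : Set _
          Sums = S.∑ (upTo D) (λ s → charFactor (Y s) j) ≈ S.∑ (upTo D) (λ s → rootFactor (Y s) j)

          -- The values t = 0 and t = 1 are the tests for y^k = 1 and y^k = g at b.
          vanish : (∀ s t → ¬ iterL (Y s) b k ≡ iterL g b t) → Sums
          vanish h = trans (S.∑-ε (upTo D) (λ {s} _ → S.if-no (iterL (Y s) b k ≟L b) (h s 0)))
                    (sym (S.∑-ε (upTo D) (λ {s} _ → S.if-no (iterL (Y s) b k ≟L apply g b) (h s 1))))

          k-multiple : ∀ m → k ≡ m *ℕ r → ∀ s t → iterL (Y s) b k ≡ iterL g b t → times τ m ≡ false × m *ℕ s ≅ t [mod D ]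
          k-multiple m k≡ s t e =
            let m′ , e₁ , e₂ , e₃ = L.iterL≡g-iterL⁻ (pY s) (cY s) s (Y^r s) (r-divides s) k t e
                m′≡m = ℕₚ.*-cancelʳ-≡ m′ m r {{>-nonZero (m-positive i)}} (≡.trans (≡.sym e₁) k≡)
            in subst (λ m → times τ m ≡ false × m *ℕ s ≅ t [mod D ]) m′≡m (e₂ , e₃)

          sums-multiple : ∀ m → k ≡ m *ℕ r → times τ m ≡ false → Sums
          sums-multiple m k≡ even = R.root-sum (λ s → iterL (Y s) b k ≟L b) (λ s → iterL (Y s) b k ≟L apply g b)
              (λ s e → ≅0⇒∣ (proj₂ (k-multiple m k≡ s 0 e)))
              (λ s d → k⁺ s 0 (∣⇒≅0 d))
              (λ s e → proj₂ (k-multiple m k≡ s 1 e))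
              (λ s c → k⁺ s 1 c)
            where
            local : ∀ s → _
            local s = L.local-root (pY s) (cY s) s (Y^r s) (r-divides s)
            module R = RootSum 0<D m L.Ξ (λ s → F (Y s) g b) (λ s → proj₁ (local s)) (λ s → proj₂ (local s))
            k⁺ : ∀ s t → m *ℕ s ≅ t [mod D ] → iterL (Y s) b k ≡ iterL g b t
            k⁺ s t c = ≡.trans (cong (iterL (Y s) b) k≡) (L.iterL≡g-iterL⁺ (pY s) (cY s) s (Y^r s) (r-divides s) m t even c)

          -- A k-th power brings b back to its cycle under g only if k = m r, and then as a signed
          -- g^(m s) b. With sign -1 neither test is ever passed; with sign +1 the Ramanujan sums
          -- decide.
          sums : Sums
          sums with r ∣? k
          ... | no r∤k = vanish λ s t e → r∤k (r-divides s k t (cong idx e))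
          ... | yes (divides m k≡) with times τ m in eq
          ...   | false = sums-multiple m k≡ eq
          ...   | true = vanish λ s t e → false≢true (≡.trans (≡.sym (proj₁ (k-multiple m k≡ s t e))) eq)

          shifted-sums : S.∑ (upTo D) (λ s → charFactor (twist y g b s) j) ≈ S.∑ (upTo D) (λ s → rootFactor (twist y g b s) j)
          shifted-sums = trans (sym (∑-shift s₁ 0<D (λ e → reflexive (cong (λ y → charFactor y j) (twist-≅ iD y e)))))
            (trans sums (∑-shift s₁ 0<D (λ e → reflexive (cong (λ y → rootFactor y j) (twist-≅ iD y e)))))

      local-sum : S.∑ (upTo D) (λ s → charFactor (twist y g (pos j) s) j) ≈ S.∑ (upTo D) (λ s → rootFactor (twist y g (pos j) s) j)
      local-sum =
        -- The roles of y and g are exchanged: r counts the steps of y back to the cycle of g.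
        let i = multiplicity-IsMultiplicity pg py (Commute-sym com) b
            τ , s₀ , τ-sign , y^r = signed (multiplicity g y b) (returns i)
        in Signs.shifted-sums i {τ} {s₀} τ-sign y^r

  -- Replacing charFactor by rootFactor one orbit base at a time

  mixedFactor : ℕ → SP n → Fin n → Carrier
  mixedFactor l y i = if does (toℕ i ℕₚ.<? l) then rootFactor y i else charFactor y i

  mixedProduct : ℕ → SP n → Carrier
  mixedProduct l y = P.∑ (orbitBases y g) (mixedFactor l y)

  module Step (j : Fin n) where
    open Local j
    open Twist pg (pos j)

    private
      l : ℕ
      l = toℕ j

      others : SP n → List (Fin n)
      others y = filter (λ i → ¬? (i Finₚ.≟ j)) (orbitBases y g)

      rest : SP n → Carrier
      rest y = P.∑ (others y) (mixedFactor l y)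

      mixedFactor-suc : ∀ y {i} → i ≢ j → mixedFactor l y i ≈ mixedFactor (suc l) y i
      mixedFactor-suc y {i} i≢j = go (toℕ i ℕₚ.<? l)
        where
        go : Dec (toℕ i < l) → mixedFactor l y i ≈ mixedFactor (suc l) y i
        go (yes p) = trans (S.if-yes (toℕ i ℕₚ.<? l) p) (sym (S.if-yes (toℕ i ℕₚ.<? suc l) (ℕₚ.m<n⇒m<1+n p)))
        go (no ¬p) = trans (S.if-no (toℕ i ℕₚ.<? l) ¬p) (sym (S.if-no (toℕ i ℕₚ.<? suc l)
          λ p → i≢j (Finₚ.toℕ-injective (ℕₚ.≤-antisym (ℕₚ.≤-pred p) (ℕₚ.≮⇒≥ ¬p)))))

      others≢ : ∀ {y i} → i ∈ others y → i ∈ orbitBases y g × i ≢ j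
      others≢ {y} p = ∈-filter⁻ (λ i → ¬? (i Finₚ.≟ j)) {xs = orbitBases y g} p

      product-before : ∀ {y} → rep y g j ≡ j → mixedProduct l y ≈ charFactor y j * rest y
      product-before {y} e = trans (P.∑-remove Finₚ._≟_ (mixedFactor l y) (orbitBases-unique y g) (∈-orbitBases⁺ {x = y} {g} e))
        (*-congʳ (S.if-no (l ℕₚ.<? l) (ℕₚ.<-irrefl ≡.refl)))

      product-after : ∀ {y} → rep y g j ≡ j → mixedProduct (suc l) y ≈ rootFactor y j * rest y
      product-after {y} e = trans (P.∑-remove Finₚ._≟_ (mixedFactor (suc l) y) (orbitBases-unique y g) (∈-orbitBases⁺ {x = y} {g} e))
        (*-cong (S.if-yes (l ℕₚ.<? suc l) ℕₚ.≤-refl) (P.∑-cong (others y) (λ p → sym (mixedFactor-suc y (proj₂ (others≢ {y} p))))))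

      module _ {y : SP n} (py : Perm y) (com : Commute y g) (base : rep y g j ≡ j) (s : ℕ) where

        private
          y′ : SP n
          y′ = twist y g (pos j) s

        orbitBases-twist : orbitBases y′ g ≡ orbitBases y g
        orbitBases-twist = filter-≐ (λ i → rep y′ g i Finₚ.≟ i) (λ i → rep y g i Finₚ.≟ i)
          ((λ {i} e → ≡.trans (≡.sym (twist-rep py com s i)) e) , (λ {i} e → ≡.trans (twist-rep py com s i) e)) (allFin n)

        -- An orbit with another base is disjoint from that of j, so the twist cannot be seen on it.
        factor-twist : ∀ {i} → i ∈ others y → mixedFactor l y′ i ≈ mixedFactor l y i
        factor-twist {i} p = reflexive (cong₂ (λ a b → if does (toℕ i ℕₚ.<? l) then a else b)
            (cong (λ a → if does (a ≟L apply g (pos i)) then 1# else 0#) (same k))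
            (cong₂ (λ a f → if does (a ≟L pos i) then f else 0#) (same k)
              (F-transfer (λ a → a) (λ e → e) (λ _ → ≡.refl) (pos i) same (λ _ → ≡.refl))))
          where
          outside : ¬ Orbit y g (pos j) (pos i)
          outside o = proj₂ (others≢ {y} p) (≡.sym (≡.trans (≡.sym base) (≡.trans (rep-cong py pg com j i o)
            (∈-orbitBases⁻ {x = y} {g} (proj₁ (others≢ {y} p))))))
          same : ∀ t → iterL y′ (pos i) t ≡ iterL y (pos i) t
          same = twist-elsewhere py com s (pos i) outside

        rest-twist : rest y′ ≈ rest y
        rest-twist = trans (reflexive (cong (λ is → P.∑ (filter (λ i → ¬? (i Finₚ.≟ j)) is) (mixedFactor l y′)) orbitBases-twist))
          (P.∑-cong (others y) factor-twist)

      based? : (y : SP n) → Dec (rep y g j ≡ j)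
      based? y = rep y g j Finₚ.≟ j

      based : List (SP n)
      based = filter based? centralizer

      ∈-based⁻ : ∀ y → y ∈ based → Perm y × Commute y g × rep y g j ≡ j
      ∈-based⁻ y p =
        let q , e = ∈-filter⁻ based? {xs = centralizer} p
            py , com = ∈-centralizer⁻ q
        in py , com , e

      ∈-based-twist : ∀ s {y} → y ∈ based → twist y g (pos j) s ∈ based
      ∈-based-twist s {y} p = let py , com , e = ∈-based⁻ y p in
        ∈-filter⁺ based? {xs = centralizer} (∈-centralizer⁺ (twist-Perm py com s) (twist-Commute py com s)) (≡.trans (twist-rep py com s j) e)

      untwistʳ : ∀ {y} s → twist (twist y g (pos j) (complement pg (pos j) s)) g (pos j) s ≡ y
      untwistʳ {y} s = ≡.trans (twist-twist y u s) (≡.trans (cong (twist y g (pos j)) (ℕₚ.+-comm u s))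
        (≡.trans (≡.sym (twist-twist y s u)) (untwist s)))
        where u = complement pg (pos j) s

      -- Each twist by g^s permutes the y for which j is an orbit base, so every s repeats the same
      -- sum.
      average : ∀ X → fromℕK K D * S.∑ based X ≈ S.∑ based (λ y → S.∑ (upTo D) (λ s → X (twist y g (pos j) s)))
      average X = begin
        fromℕK K D * S.∑ based X                                             ≈⟨ ∑-const D (S.∑ based X) ⟨
        S.∑ (upTo D) (λ s → S.∑ based X)                                     ≈⟨ S.∑-cong (upTo D) (λ {s} _ → sym (twisted s)) ⟩
        S.∑ (upTo D) (λ s → S.∑ based (λ y → X (twist y g (pos j) s)))       ≈⟨ S.∑-swap (upTo D) based _ ⟩
        S.∑ based (λ y → S.∑ (upTo D) (λ s → X (twist y g (pos j) s)))       ∎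
        where
        open import Relation.Binary.Reasoning.Setoid setoid
        u = Unique-filter⁺ based? centralizer-unique
        twisted : ∀ s → S.∑ based (λ y → X (twist y g (pos j) s)) ≈ S.∑ based X
        twisted s = S.∑-bij _≟W_ u u (λ y → twist y g (pos j) s) (λ y → twist y g (pos j) (complement pg (pos j) s))
          (λ p → ∈-based-twist s p , untwist s) (λ p → ∈-based-twist (complement pg (pos j) s) p , untwistʳ s) (λ _ → refl)

      averaged : ∀ (f X : SP n → Carrier) → (∀ {y} → y ∈ based → ∀ s → twist y g (pos j) s ∈ based) →
                 (∀ {y} → y ∈ based → X y ≈ f y * rest y) →
                 fromℕK K D * S.∑ based X ≈ S.∑ based (λ y → rest y * S.∑ (upTo D) (λ s → f (twist y g (pos j) s)))
      averaged f X closed e = trans (average X) (S.∑-cong based λ {y} p →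
        let py , com , base = ∈-based⁻ y p in
        trans (S.∑-cong (upTo D) (λ {s} _ → trans (e (closed p s)) (trans (*-congˡ (rest-twist py com base s)) (*-comm _ _))))
              (sym (∑-*ˡ (upTo D) (rest y))))

      based-step : S.∑ based (mixedProduct l) ≈ S.∑ based (mixedProduct (suc l))
      based-step = *-cancelʳ-Unit (fromℕ-Unit D 0<D) (trans (*-comm _ _) (trans equal (*-comm _ _)))
        where
        closed : ∀ {y} → y ∈ based → ∀ s → twist y g (pos j) s ∈ based
        closed p s = ∈-based-twist s p
        equal : fromℕK K D * S.∑ based (mixedProduct l) ≈ fromℕK K D * S.∑ based (mixedProduct (suc l))
        equal = trans (averaged (λ y → charFactor y j) (mixedProduct l) closed (λ {y} p → product-before {y} (proj₂ (proj₂ (∈-based⁻ y p)))))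
          (trans (S.∑-cong based (λ {y} p → let py , com , _ = ∈-based⁻ y p in *-congˡ (local-sum py com)))
            (sym (averaged (λ y → rootFactor y j) (mixedProduct (suc l)) closed (λ {y} p → product-after {y} (proj₂ (proj₂ (∈-based⁻ y p)))))))

    -- The two products differ only in the factor at j. It is absent when j is not the base of its
    -- orbit, and the other y are treated by averaging in `based-step`.
    step : S.∑ centralizer (mixedProduct l) ≈ S.∑ centralizer (mixedProduct (suc l))
    step = trans (S.∑-partition based? centralizer _)
      (trans (+-cong based-step (S.∑-cong (filter (λ y → ¬? (based? y)) centralizer) λ {y} p →
               P.∑-cong (orbitBases y g) λ {i} i∈ → mixedFactor-suc y λ i≡j →
                 proj₂ (∈-filter⁻ (λ y → ¬? (based? y)) {xs = centralizer} p)
                   (subst (λ i → rep y g i ≡ i) i≡j (∈-orbitBases⁻ {x = y} {g} i∈))))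
             (sym (S.∑-partition based? centralizer _)))

  mixed-0 : ∀ l → l ≤ n → S.∑ centralizer (mixedProduct 0) ≈ S.∑ centralizer (mixedProduct l)
  mixed-0 zero _ = refl
  mixed-0 (suc l) l<n = trans (mixed-0 l (ℕₚ.<⇒≤ l<n))
    (subst (λ l → S.∑ centralizer (mixedProduct l) ≈ S.∑ centralizer (mixedProduct (suc l))) (Finₚ.toℕ-fromℕ< l<n) (Step.step (fromℕ< l<n)))

  charProduct≈rootProduct : S.∑ centralizer (λ y → P.∑ (orbitBases y g) (charFactor y)) ≈ S.∑ centralizer (λ y → P.∑ (orbitBases y g) (rootFactor y))
  charProduct≈rootProduct = trans (mixed-0 n ℕₚ.≤-refl) (S.∑-cong centralizer λ {y} _ → P.∑-cong (orbitBases y g) λ {i} _ →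
    S.if-yes (toℕ i ℕₚ.<? n) (Finₚ.toℕ<n i))

  -- The letters on which y^k and h agree are stable under y, g and -1, because these commute with
  -- both maps.
  iterL-Orbit : ∀ {y h} → Perm y → Perm h → Commute y g → Commute y h → Commute g h →
                ∀ a b → Orbit y g a b → iterL y a k ≡ apply h a → iterL y b k ≡ apply h b
  iterL-Orbit {y} {h} py ph yg yh gh a b (q , p , e) e′ = go (idx-≡ {n} {d} {b} e)
    where
    open ≡.≡-Reasoning
    d : Letter n
    d = iterL y (iterL g a q) p
    on-d : iterL y d k ≡ apply h d
    on-d = begin
      iterL y (iterL y (iterL g a q) p) k   ≡⟨ iterL-+ y (iterL g a q) k p ⟨
      iterL y (iterL g a q) (k +ℕ p)        ≡⟨ cong (iterL y (iterL g a q)) (ℕₚ.+-comm k p) ⟩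
      iterL y (iterL g a q) (p +ℕ k)        ≡⟨ iterL-+ y (iterL g a q) p k ⟩
      iterL y (iterL y (iterL g a q) k) p   ≡⟨ cong (λ a → iterL y a p) (iterL-comm yg a k q) ⟩
      iterL y (iterL g (iterL y a k) q) p   ≡⟨ cong (λ a → iterL y (iterL g a q) p) e′ ⟩
      iterL y (iterL g (apply h a) q) p     ≡⟨ cong (λ a → iterL y a p) (iterL-apply gh a q) ⟩
      iterL y (apply h (iterL g a q)) p     ≡⟨ iterL-apply yh (iterL g a q) p ⟩
      apply h d                             ∎
    go : d ≡ b ⊎ d ≡ negL b → iterL y b k ≡ apply h b
    go (inj₁ ≡.refl) = on-d
    go (inj₂ d≡) = negL-injective (≡.trans (≡.sym (iterL-neg y b k)) (≡.trans (≡.subst (λ d → iterL y d k ≡ apply h d) d≡ on-d) (apply-neg h b)))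

  powB-bases : ∀ {y h} → Perm y → Perm h → Commute y g → Commute y h → Commute g h →
               (∀ {i} → i ∈ orbitBases y g → iterL y (pos i) k ≡ apply h (pos i)) → powB y k ≡ h
  powB-bases {y} {h} py ph yg yh gh e = apply-ext λ a → ≡.trans (apply-powB y k a)
    (iterL-Orbit py ph yg yh gh (pos (rep y g (idx a))) a
      (Orbit-resp ≡.refl ≡.refl (Orbit-sym py pg yg (rep-Orbit py pg yg (idx a))))
      (e (∈-orbitBases⁺ {x = y} {g} (rep-idem py pg yg (idx a)))))

  ∏-guard : ∀ {p} {A : Set} {Q : A → Set p} (Q? : ∀ x → Dec (Q x)) (xs : List A) (f : A → Carrier) →
            (∀ {x} → x ∈ xs → Q x) ⊎ P.∑ xs (λ x → if does (Q? x) then f x else 0#) ≈ 0#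
  ∏-guard Q? [] f = inj₁ λ ()
  ∏-guard Q? (x ∷ xs) f with Q? x | ∏-guard Q? xs f
  ... | no _  | _       = inj₂ (zeroˡ _)
  ... | yes _ | inj₂ e  = inj₂ (trans (*-congˡ e) (zeroʳ _))
  ... | yes q | inj₁ qs = inj₁ λ { (here ≡.refl) → q ; (there p) → qs p }

  -- A test passed at every orbit base spreads to all letters by commutation, and one failed test
  -- annihilates the product. The uses are h = g for roots and h = 1 for the condition on classes.
  ∏-guard-powB : ∀ {y h} → Perm y → Perm h → Commute y g → Commute y h → Commute g h → (f : Fin n → Carrier) →
                 P.∑ (orbitBases y g) (λ i → if does (iterL y (pos i) k ≟L apply h (pos i)) then f i else 0#) ≈
                 (if does (powB y k ≟W h) then P.∑ (orbitBases y g) f else 0#)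
  ∏-guard-powB {y} {h} py ph yg yh gh f with powB y k ≟W h
  ... | yes e = P.∑-cong (orbitBases y g) λ {i} _ → S.if-yes (iterL y (pos i) k ≟L apply h (pos i))
                  (≡.trans (≡.sym (apply-powB y k (pos i))) (cong (λ w → apply w (pos i)) e))
  ... | no ¬e with ∏-guard (λ i → iterL y (pos i) k ≟L apply h (pos i)) (orbitBases y g) f
  ...   | inj₂ z = z
  ...   | inj₁ all = ⊥-elim (¬e (powB-bases py ph yg yh gh all))

  P-∑-1 : ∀ {A : Set} (xs : List A) → P.∑ xs (λ _ → 1#) ≈ 1#
  P-∑-1 xs = P.∑-ε xs (λ _ → refl)

  fromℕ-countL : ∀ {A : Set} {Q : A → Set} (Q? : ∀ x → Dec (Q x)) xs →
                 fromℕK K (countL (λ x → does (Q? x)) xs) ≈ S.∑ xs (λ x → if does (Q? x) then 1# else 0#)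
  fromℕ-countL Q? [] = refl
  fromℕ-countL Q? (x ∷ xs) with does (Q? x)
  ... | true  = +-congˡ (fromℕ-countL Q? xs)
  ... | false = trans (fromℕ-countL Q? xs) (sym (+-identityˡ _))

  powB-Commute : (y : SP n) → Commute y (powB y k)
  powB-Commute y = commuting λ a → ≡.trans (cong (apply y) (apply-powB y k a))
    (≡.trans (iterL-sucʳ y a k) (≡.sym (apply-powB y k (apply y a))))

  -- A k-th root of g commutes with g, so the count may be restricted to the centralizer before the
  -- factors are exchanged.
  roots-sum : fromℕK K (countL (λ y → does (powB y k ≟W g)) (Bn n)) ≈
              S.∑ centralizer (λ y → if does (powB y k ≟W idB) then Ω y g else 0#)
  roots-sum = begin
    fromℕK K (countL (λ y → does (powB y k ≟W g)) (Bn n))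
      ≈⟨ fromℕ-countL (λ y → powB y k ≟W g) (Bn n) ⟩
    S.∑ (Bn n) (λ y → if does (powB y k ≟W g) then 1# else 0#)
      ≈⟨ S.∑-cong (Bn n) (λ {y} _ → restrict y (commute? y g)) ⟩
    S.∑ (Bn n) (λ y → if does (commute? y g) then (if does (powB y k ≟W g) then 1# else 0#) else 0#)
      ≈⟨ S.∑-filter (λ y → commute? y g) (Bn n) _ ⟨
    S.∑ centralizer (λ y → if does (powB y k ≟W g) then 1# else 0#)
      ≈⟨ S.∑-cong centralizer (λ {y} p → let py , yg = ∈-centralizer⁻ p in
           trans (∏-guard-powB py pg yg yg (commuting λ _ → ≡.refl) (λ _ → 1#)) (if-congᵗ (powB y k ≟W g) (P-∑-1 (orbitBases y g)))) ⟨
    S.∑ centralizer (λ y → P.∑ (orbitBases y g) (rootFactor y))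
      ≈⟨ charProduct≈rootProduct ⟨
    S.∑ centralizer (λ y → P.∑ (orbitBases y g) (charFactor y))
      ≈⟨ S.∑-cong centralizer (λ {y} p → let py , yg = ∈-centralizer⁻ p in
           trans (P.∑-cong (orbitBases y g) (λ {i} _ → reflexive (cong (λ a → if does (iterL y (pos i) k ≟L a) then F y g (pos i) else 0#) (≡.sym (apply-id (pos i))))))
             (∏-guard-powB py Perm-id yg (Commute-id y) (Commute-id g) (λ i → F y g (pos i)))) ⟩
    S.∑ centralizer (λ y → if does (powB y k ≟W idB) then Ω y g else 0#) ∎
    where
    open import Relation.Binary.Reasoning.Setoid setoid
    if-congᵗ : ∀ {Q : Set} (d : Dec Q) {a b z} → a ≈ b → (if does d then a else z) ≈ (if does d then b else z)
    if-congᵗ (yes _) e = e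
    if-congᵗ (no _) e = refl
    restrict : (y : SP n) (d : Dec (y ∘B g ≡ g ∘B y)) → (if does (powB y k ≟W g) then 1# else 0#) ≈ (if does d then (if does (powB y k ≟W g) then 1# else 0#) else 0#)
    restrict y (yes _) = refl
    restrict y (no ¬c) = S.if-no (powB y k ≟W g) λ e → ¬c (subst (λ (w : SP n) → y ∘B w ≡ w ∘B y) e (Commute⇒∘B {x = y} {z = powB y k} (powB-Commute y)))

-- Least indices as base points of cycles

module _ {n : ℕ} where

  minFin-≤ˡ : (a b : Fin n) → toℕ (minFin a b) ≤ toℕ a
  minFin-≤ˡ a b with toℕ a ≤ᵇ toℕ b in eq
  ... | true  = ℕₚ.≤-refl
  ... | false with ℕₚ.≤-total (toℕ a) (toℕ b)
  ...   | inj₂ b≤a = b≤a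
  ...   | inj₁ a≤b = ⊥-elim (false≢true (≡.trans (≡.sym eq) (T⇒true (ℕₚ.≤⇒≤ᵇ a≤b))))

  minFin-≤ʳ : (a b : Fin n) → toℕ (minFin a b) ≤ toℕ b
  minFin-≤ʳ a b with toℕ a ≤ᵇ toℕ b in eq
  ... | true  = ℕₚ.≤ᵇ⇒≤ (toℕ a) (toℕ b) (true⇒T eq)
  ... | false = ℕₚ.≤-refl

  minFin-sel : (a b : Fin n) → minFin a b ≡ a ⊎ minFin a b ≡ b
  minFin-sel a b with toℕ a ≤ᵇ toℕ b
  ... | true  = inj₁ ≡.refl
  ... | false = inj₂ ≡.refl

  baseIdx-SameCycle : (x : SP n) → ∀ i → SameCycle x (pos i) (pos (baseIdx x i))
  baseIdx-SameCycle x i = go (upTo (2 *ℕ n))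
    where
    go : ∀ ts → SameCycle x (pos i) (pos (foldr (λ t acc → minFin (idx (iterL x (pos i) t)) acc) i ts))
    go [] = 0 , ≡.refl
    go (t ∷ ts) with minFin-sel (idx (iterL x (pos i) t)) (foldr (λ t acc → minFin (idx (iterL x (pos i) t)) acc) i ts)
    ... | inj₁ e = t , ≡.sym e
    ... | inj₂ e = let p , e′ = go ts in p , ≡.trans e′ (≡.sym e)

  baseIdx-≤ : ∀ {x : SP n} → Perm x → ∀ i k → SameCycle x (pos i) (pos k) → toℕ (baseIdx x i) ≤ toℕ k
  baseIdx-≤ {x} px i k (p , e) = subst (λ k → toℕ (baseIdx x i) ≤ toℕ k)
      (≡.trans (cong idx (iterL-≅ ord (%-≅ p))) e) (go (upTo (2 *ℕ n)) (∈-upTo⁺ (ℕₚ.<-≤-trans (m%n<n p o) o≤2n)))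
    where
    o = orbitSize x (pos i)
    ord = proj₁ (orbitSize-IsOrder px (pos i))
    o≤2n = proj₂ (orbitSize-IsOrder px (pos i))
    instance
      o≢0 : NonZero o
      o≢0 = >-nonZero (positive ord)
    go : ∀ ts {t} → t ∈ ts → toℕ (foldr (λ t acc → minFin (idx (iterL x (pos i) t)) acc) i ts) ≤ toℕ (idx (iterL x (pos i) t))
    go (t ∷ ts) (here ≡.refl) = minFin-≤ˡ (idx (iterL x (pos i) t)) _
    go (t ∷ ts) (there q) = ℕₚ.≤-trans (minFin-≤ʳ (idx (iterL x (pos i) t)) _) (go ts q)

  baseIdx-cong : ∀ {x : SP n} → Perm x → ∀ i k → SameCycle x (pos i) (pos k) → baseIdx x i ≡ baseIdx x k
  baseIdx-cong {x} px i k s = Finₚ.toℕ-injective (ℕₚ.≤-antisym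
    (baseIdx-≤ px i (baseIdx x k) (SameCycle-trans s (baseIdx-SameCycle x k)))
    (baseIdx-≤ px k (baseIdx x i) (SameCycle-trans (SameCycle-sym px s) (baseIdx-SameCycle x i))))

  -- Since h′ carries cycles of y to cycles of y, moving to the representative of a cycle before
  -- applying h′ still leads back to the cycle of i.
  transversal-inverse : ∀ {y h h′ : SP n} → Commute y h′ → (∀ a → apply h′ (apply h a) ≡ a) → (β : Fin n → Fin n) →
    (∀ i → SameCycle y (pos i) (pos (β i))) → (∀ i k → SameCycle y (pos i) (pos k) → β i ≡ β k) → ∀ i → β i ≡ i →
    β (β (idx (apply h (pos i)))) ≡ β (idx (apply h (pos i))) × β (idx (apply h′ (pos (β (idx (apply h (pos i))))))) ≡ i
  transversal-inverse {y} {h} {h′} c inv β β-SameCycle β-cong i βi≡i =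
      ≡.sym (β-cong (idx a) k (β-SameCycle (idx a))) , ≡.trans (≡.sym (β-cong i (idx (apply h′ (pos k))) back)) βi≡i
    where
    a : Letter n
    a = apply h (pos i)
    k : Fin n
    k = β (idx a)
    back : SameCycle y (pos i) (pos (idx (apply h′ (pos k))))
    back = SameCycle-resp (cong idx (inv (pos i))) ≡.refl
      (SameCycle-commute c {a} {pos k} 1 (SameCycle-resp ≡.refl ≡.refl (β-SameCycle (idx a))))

  cycleBases : SP n → List (Fin n)
  cycleBases x = filter (λ j → T? (isBase x j)) (allFin n)

  cycleBases-unique : ∀ x → Unique (cycleBases x)
  cycleBases-unique x = Unique-filter⁺ (λ j → T? (isBase x j)) (allFin⁺ n)

  ∈-cycleBases⁺ : ∀ {x} {i : Fin n} → baseIdx x i ≡ i → i ∈ cycleBases x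
  ∈-cycleBases⁺ {x} {i} e = ∈-filter⁺ (λ j → T? (isBase x j)) (∈-allFin i) (true⇒T (dec-true (baseIdx x i Finₚ.≟ i) e))

  ∈-cycleBases⁻ : ∀ {x} {i : Fin n} → i ∈ cycleBases x → baseIdx x i ≡ i
  ∈-cycleBases⁻ {x} {i} p = does⇒ (baseIdx x i Finₚ.≟ i) (T⇒true (proj₂ (∈-filter⁻ (λ j → T? (isBase x j)) {xs = allFin n} p)))

  Commute-inv : ∀ {x g : SP n} → Perm g → Commute x g → Commute x (invB g)
  Commute-inv {x} {g} pg c = commuting λ a → apply-injective pg (begin
      apply g (apply x (apply (invB g) a))       ≡⟨ apply-comm c (apply (invB g) a) ⟨
      apply x (apply g (apply (invB g) a))       ≡⟨ cong (apply x) (inverseʳ pg a) ⟩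
      apply x a                                  ≡⟨ inverseʳ pg (apply x a) ⟨
      apply g (apply (invB g) (apply x a))       ∎)
    where open ≡.≡-Reasoning

  negC?-≡ : ∀ {x : SP n} → Perm x → ∀ a b → (NegC x a → NegC x b) → (NegC x b → NegC x a) → negC? x a ≡ negC? x b
  negC?-≡ {x} px a b to from = ⇔⇒≡ (λ e → negC?-complete px (to (negC?-sound x a e))) (λ e → negC?-complete px (from (negC?-sound x b e)))

-- The character ω^y as a product over orbits

module Omega {c ℓ} (K : CharZeroField c ℓ) (n : ℕ) (ζ η : ℕ → CharZeroField.Carrier K)
  (ζ-primitive : ∀ i → 1 ≤ i → i ≤ n → Primitive K i (ζ i))
  (η-primitive : ∀ i → 1 ≤ i → i ≤ n → Primitive K (2 *ℕ i) (η i)) where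

  open CharZeroField K
  open FieldLemmas K
  open Characters K n ζ η ζ-primitive η-primitive
  open import Relation.Binary.Reasoning.Setoid setoid

  module _ {y g : SP n} (py : Perm y) (pg : Perm g) (com : Commute y g) where

    private
      σ : Fin n → Fin n
      σ i = baseIdx y (idx (apply g (pos i)))

      σ-SameCycle : ∀ i → SameCycle y (pos (σ i)) (apply g (pos i))
      σ-SameCycle i = SameCycle-sym py
        (SameCycle-resp ≡.refl ≡.refl
          (baseIdx-SameCycle y (idx (apply g (pos i)))))

    -- `cycleFactor` reads order and class off the cycle of i but measures from the base point of
    -- the image cycle; as g commutes with y, both cycles have the same order and class.
    cycleFactor≡χ : ∀ i → cycleFactor K ζ η y g i ≡ χ y (pos (σ i)) (apply g (pos i))
    cycleFactor≡χ i = ≡.sym (unfold (negC? y (pos i)) (negC? y (pos (σ i))) neg-eq (orbitSize y (pos (σ i))) size-eq)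
      where
      a b′ : Letter n
      a = apply g (pos i)
      b′ = pos (σ i)
      size-eq : orbitSize y b′ ≡ orbitSize y (pos i)
      size-eq = IsOrder-orbitSize py (IsOrder-SameCycle py (SameCycle-sym py (σ-SameCycle i))
        (IsOrder-apply pg com (proj₁ (orbitSize-IsOrder py (pos i)))))
      neg-eq : negC? y b′ ≡ negC? y (pos i)
      neg-eq = negC?-≡ py b′ (pos i)
        (λ nc → NegC-apply⁻ pg com (pos i) (NegC-SameCycle (σ-SameCycle i) nc))
        (λ nc → NegC-SameCycle (SameCycle-sym py (σ-SameCycle i)) (NegC-apply com (pos i) nc))
      unfold : ∀ ν ν′ → ν′ ≡ ν → ∀ o′ → o′ ≡ orbitSize y (pos i) →
               powK K (if ν′ then η ⌊ o′ /2⌋ else ζ o′)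
                 (firstN (λ e → letterEq (iterL y b′ e) a ∨ (not ν′ ∧ letterEq (iterL y b′ e) (negL a))) (upTo o′)) ≡
               (if ν then powK K (η ⌊ orbitSize y (pos i) /2⌋) (firstN (λ e → letterEq (iterL y b′ e) a) (upTo (orbitSize y (pos i))))
                else powK K (ζ (orbitSize y (pos i)))
                  (firstN (λ e → letterEq (iterL y b′ e) a ∨ letterEq (iterL y b′ e) (negL a)) (upTo (orbitSize y (pos i)))))
      unfold true _ ≡.refl _ ≡.refl = cong (powK K (η ⌊ orbitSize y (pos i) /2⌋))
        (firstL-cong (upTo (orbitSize y (pos i))) (λ e → ∨-identityʳ (letterEq (iterL y b′ e) a)))
      unfold false _ ≡.refl _ ≡.refl = ≡.refl

    private
      base : Letter n → Letter n
      base a = pos (rep y g (idx a))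

      mult : Letter n → ℕ
      mult a = multiplicity y g (base a)

      isMult : ∀ a → IsMultiplicity y g (base a) (mult a)
      isMult a = multiplicity-IsMultiplicity py pg com (base a)

      base-cong : ∀ {a b} → Orbit y g a b → base a ≡ base b
      base-cong {a} {b} o = cong pos (rep-cong py pg com (idx a) (idx b) (Orbit-resp ≡.refl ≡.refl o))

      SameCycle-iterates : ∀ b m q q′ → IsMultiplicity y g b m → q < m → q′ < m → SameCycle y (iterL g b q) (iterL g b q′) → q ≡ q′
      SameCycle-iterates b m q q′ i q<m q′<m s = go (ℕₚ.≤-total q q′)
        where
        ordered : ∀ q q′ → q ≤ q′ → q′ < m → SameCycle y (iterL g b q) (iterL g b q′) → q ≡ q′
        ordered q q′ q≤q′ q′<m s with q′ ∸ q in eq | divides-returns i (q′ ∸ q) (SameCycle-cancel pg com q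
              (subst (SameCycle y (iterL g b q)) (≡.trans (cong (iterL g b) (≡.sym (ℕₚ.m+[n∸m]≡n q≤q′))) (iterL-+ g b q (q′ ∸ q))) s))
        ... | zero  | _ = ℕₚ.≤-antisym q≤q′ (ℕₚ.m∸n≡0⇒m≤n eq)
        ... | suc d | m∣ = ⊥-elim (ℕₚ.<⇒≱ (ℕₚ.≤-<-trans (ℕₚ.m∸n≤m q′ q) q′<m) (subst (m ≤_) (≡.sym eq) (∣⇒≤ m∣)))
        go : q ≤ q′ ⊎ q′ ≤ q → q ≡ q′
        go (inj₁ q≤q′) = ordered q q′ q≤q′ q′<m s
        go (inj₂ q′≤q) = ≡.sym (ordered q′ q q′≤q q<m (SameCycle-sym py s))

      abstract
        -- The cycles of an orbit are numbered by the power of g leading to them from the base.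
        -- After `mult a` turns the first cycle recurs, so the number is reduced modulo it.
        index-exists : ∀ a → ∃ λ q → q < mult a × SameCycle y (iterL g (base a) q) a
        index-exists a = q % m , m%n<n q m , SameCycle-trans
            (subst (SameCycle y (iterL g b (q % m))) (≡.trans (≡.sym (iterL-+ g b (q % m) (q / m *ℕ m))) (cong (iterL g b) (≡.sym (m≡m%n+[m/n]*n q m))))
              (SameCycle-commute com (q % m) (SameCycle-multiple py pg com (returns (isMult a)) (q / m))))
            (Orbit.sameCycle o)
          where
          b : Letter n
          b = base a
          m : ℕ
          m = mult a
          instance
            m≢0 : NonZero m
            m≢0 = >-nonZero (m-positive (isMult a))
          o : Orbit y g b a
          o = Orbit-resp ≡.refl ≡.refl (Orbit-sym py pg com (rep-Orbit py pg com (idx a)))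
          q : ℕ
          q = Orbit.turns o

        index : Letter n → ℕ
        index a = proj₁ (index-exists a)

        index<mult : ∀ a → index a < mult a
        index<mult a = proj₁ (proj₂ (index-exists a))

        index-SameCycle : ∀ a → SameCycle y (iterL g (base a) (index a)) a
        index-SameCycle a = proj₂ (proj₂ (index-exists a))

        index-unique : ∀ a q → q < mult a → SameCycle y (iterL g (base a) q) a → index a ≡ q
        index-unique a q q<m s = SameCycle-iterates (base a) (mult a) (index a) q (isMult a) (index<mult a) q<m
          (SameCycle-trans (index-SameCycle a) (SameCycle-sym py s))

        closing : Letter n → Carrier
        closing a = if does (suc (index a) ℕₚ.≟ mult a) then F y g (base a) else 1#

        closing-yes : ∀ a → suc (index a) ≡ mult a → closing a ≈ F y g (base a)
        closing-yes a e = P.if-yes (suc (index a) ℕₚ.≟ mult a) e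

        closing-no : ∀ a → suc (index a) ≢ mult a → closing a ≈ 1#
        closing-no a ne = P.if-no (suc (index a) ℕₚ.≟ mult a) ne

        -- A coordinate on the orbit of a: y multiplies it by κ, and g fixes it except
        -- where it closes up, at the last of the mult a cycles of the orbit.
        θ : Letter n → Carrier
        θ a = χ y (iterL g (base a) (index a)) a

        θ-Unit : ∀ a → Unit (θ a)
        θ-Unit a = χ-Unit py (iterL g (base a) (index a)) a

        θ-SameCycle : ∀ {a b} → SameCycle y a b → θ a * χ y a b ≈ θ b
        θ-SameCycle {a} {b} s = trans (χ-trans py (index-SameCycle a) s)
            (reflexive (cong (λ d → χ y d b) (cong₂ (iterL g) base≡ (≡.sym index≡))))
          where
          base≡ : base a ≡ base b
          base≡ = base-cong (SameCycle⇒Orbit s)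
          index≡ : index b ≡ index a
          index≡ = index-unique b (index a) (subst (λ d → index a < multiplicity y g d) base≡ (index<mult a))
            (subst (λ d → SameCycle y (iterL g d (index a)) b) base≡
              (SameCycle-trans (index-SameCycle a) s))

        -- Applying g raises the index by one. On the last cycle the index wraps round to 0, and the
        -- displacement made by `mult a` turns, which is F, is left over.
        θ-apply : ∀ a → θ (apply g a) ≈ closing a * θ a
        θ-apply a = go (suc (index a) ℕₚ.≟ mult a)
          where
          b : Letter n
          b = base a
          b-SameCycle : SameCycle y (iterL g b (suc (index a))) (apply g a)
          b-SameCycle = SameCycle-commute com 1 (index-SameCycle a)
          base≡ : base (apply g a) ≡ b
          base≡ = ≡.sym (base-cong (Orbit-g a 1))
          θ≡ : ∀ q → q < mult a → SameCycle y (iterL g b q) (apply g a) → θ (apply g a) ≡ χ y (iterL g b q) (apply g a)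
          θ≡ q q<m s = cong (λ d → χ y d (apply g a)) (cong₂ (iterL g) base≡
            (index-unique (apply g a) q (subst (λ d → q < multiplicity y g d) (≡.sym base≡) q<m)
              (subst (λ d → SameCycle y (iterL g d q) (apply g a)) (≡.sym base≡) s)))
          χ≈θ : χ y (iterL g b (suc (index a))) (apply g a) ≈ θ a
          χ≈θ = χ-apply py pg com (index-SameCycle a)
          go : Dec (suc (index a) ≡ mult a) → θ (apply g a) ≈ closing a * θ a
          go (no ne) = trans (reflexive (θ≡ (suc (index a)) (ℕₚ.≤∧≢⇒< (index<mult a) ne) b-SameCycle))
            (trans χ≈θ (sym (trans (*-congʳ (closing-no a ne)) (*-identityˡ _))))
          go (yes e) = begin
              θ (apply g a)
                ≡⟨ θ≡ 0 (m-positive (isMult a)) (SameCycle-trans back b-SameCycle) ⟩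
              χ y b (apply g a)
                ≈⟨ χ-trans py back b-SameCycle ⟨
              χ y b (iterL g b (suc (index a))) * χ y (iterL g b (suc (index a))) (apply g a)
                ≈⟨ *-cong (reflexive (cong (λ m → χ y b (iterL g b m)) e)) χ≈θ ⟩
              F y g b * θ a
                ≈⟨ *-congʳ (closing-yes a e) ⟨
              closing a * θ a ∎
            where
            back : SameCycle y b (iterL g b (suc (index a)))
            back = subst (λ m → SameCycle y b (iterL g b m)) (≡.sym e) (returns (isMult a))

      B : List (Fin n)
      B = cycleBases y

      σ-∈ : ∀ {h h′ : SP n} → Commute y h′ → (∀ a → apply h′ (apply h a) ≡ a) → ∀ {i} → i ∈ B →
            baseIdx y (idx (apply h (pos i))) ∈ B × baseIdx y (idx (apply h′ (pos (baseIdx y (idx (apply h (pos i))))))) ≡ i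
      σ-∈ {h} {h′} c inv {i} i∈ =
        let e , e′ = transversal-inverse {y = y} {h} {h′} c inv (baseIdx y) (baseIdx-SameCycle y) (baseIdx-cong py) i (∈-cycleBases⁻ {x = y} i∈)
        in ∈-cycleBases⁺ {x = y} {i = baseIdx y (idx (apply h (pos i)))} e , e′

      -- By `θ-SameCycle` and `θ-apply`, the cycle factor at i is `closing` times the ratio of θ at
      -- i and at σ i. These ratios cancel because σ permutes the bases of cycles.
      product-closing : P.∑ B (cycleFactor K ζ η y g) ≈ P.∑ B (λ i → closing (pos i))
      product-closing = ∏-telescope Finₚ._≟_ (cycleBases-unique y) σ (λ i → baseIdx y (idx (apply (invB g) (pos i))))
          (σ-∈ {g} {invB g} (Commute-inv pg com) (inverseˡ pg)) (σ-∈ {invB g} {g} com (inverseʳ pg))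
          (λ i → θ (pos i)) (cycleFactor K ζ η y g) (λ i → closing (pos i)) (λ i → θ-Unit (pos i)) factor
        where
        step : ∀ i → θ (pos (σ i)) * cycleFactor K ζ η y g i ≈ θ (apply g (pos i))
        step i = subst (λ z → θ (pos (σ i)) * z ≈ θ (apply g (pos i))) (≡.sym (cycleFactor≡χ i))
          (θ-SameCycle (σ-SameCycle i))
        factor : ∀ i → cycleFactor K ζ η y g i * θ (pos (σ i)) ≈ closing (pos i) * θ (pos i)
        factor i = trans (*-comm (cycleFactor K ζ η y g i) (θ (pos (σ i)))) (trans (step i) (θ-apply (pos i)))

      closes? : ∀ i → Dec (suc (index (pos i)) ≡ mult (pos i))
      closes? i = suc (index (pos i)) ℕₚ.≟ mult (pos i)

      last : Fin n → Fin n
      last j = baseIdx y (idx (iterL g (pos j) (pred (multiplicity y g (pos j)))))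

      -- Indices start at 0, so each orbit has exactly one closing cycle, the one of index m - 1
      -- where m is its number of cycles.
      closing-orbits : P.∑ B (λ i → closing (pos i)) ≈ Ω y g
      closing-orbits = trans (P.∑-cong B (λ {i} _ → as-guard i (closes? i))) (trans (sym (P.∑-filter closes? B (λ i → F y g (base (pos i)))))
          (P.∑-bij Finₚ._≟_ (Unique-filter⁺ closes? (cycleBases-unique y)) (orbitBases-unique y g) (rep y g) last to from (λ _ → refl)))
        where
        as-guard : ∀ i → Dec (suc (index (pos i)) ≡ mult (pos i)) → closing (pos i) ≈ (if does (closes? i) then F y g (base (pos i)) else 1#)
        as-guard i (yes e) = trans (closing-yes (pos i) e) (sym (P.if-yes (closes? i) e))
        as-guard i (no ne) = trans (closing-no (pos i) ne) (sym (P.if-no (closes? i) ne))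
        to : ∀ {i} → i ∈ filter closes? B → rep y g i ∈ orbitBases y g × last (rep y g i) ≡ i
        to {i} p = ∈-orbitBases⁺ {x = y} {g} (rep-idem py pg com i) ,
            ≡.trans (cong (λ m → baseIdx y (idx (iterL g (base (pos i)) (pred m)))) (≡.sym (proj₂ q)))
              (≡.trans (baseIdx-cong py (idx (iterL g (base (pos i)) (index (pos i)))) i (SameCycle-resp ≡.refl ≡.refl (index-SameCycle (pos i))))
                (∈-cycleBases⁻ {x = y} (proj₁ q)))
          where q = ∈-filter⁻ closes? {xs = B} p
        from : ∀ {j} → j ∈ orbitBases y g → last j ∈ filter closes? B × rep y g (last j) ≡ j
        from {j} p = ∈-filter⁺ closes? (∈-cycleBases⁺ {x = y} (≡.sym (baseIdx-cong py (idx a) (last j) (baseIdx-SameCycle y (idx a))))) closes , rep≡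
          where
          m : ℕ
          m = multiplicity y g (pos j)
          a : Letter n
          a = iterL g (pos j) (pred m)
          0<m : 0 < m
          0<m = m-positive (multiplicity-IsMultiplicity py pg com (pos j))
          suc-pred : suc (pred m) ≡ m
          suc-pred = ℕₚ.suc-pred m {{>-nonZero 0<m}}
          a-last : SameCycle y a (pos (last j))
          a-last = SameCycle-resp ≡.refl ≡.refl (baseIdx-SameCycle y (idx a))
          rep≡ : rep y g (last j) ≡ j
          rep≡ = ≡.trans (≡.sym (rep-cong py pg com j (last j) (pred m , a-last))) (∈-orbitBases⁻ {x = y} {g} p)
          index≡ : index (pos (last j)) ≡ pred m
          index≡ = index-unique (pos (last j)) (pred m)
            (subst (λ k → pred m < multiplicity y g (pos k)) (≡.sym rep≡) (ℕₚ.≤-reflexive suc-pred))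
            (subst (λ k → SameCycle y (iterL g (pos k) (pred m)) (pos (last j))) (≡.sym rep≡) a-last)
          closes : suc (index (pos (last j))) ≡ mult (pos (last j))
          closes = ≡.trans (cong suc index≡) (≡.trans suc-pred (cong (λ k → multiplicity y g (pos k)) (≡.sym rep≡)))

    omega≈Ω : omega K ζ η y g ≈ Ω y g
    omega≈Ω = trans product-closing closing-orbits

open import Data.Integer using (ℤ; +_; -[1+_])

any-false : ∀ {a} {A : Set a} (p : A → Bool) {xs} → any p xs ≡ false → ∀ {x} → x ∈ xs → p x ≡ false
any-false p {xs} e {x} q with p x in eq
... | false = ≡.refl
... | true  = ⊥-elim (false≢true (≡.trans (≡.sym e) (any-true p q eq)))

module _ {n : ℕ} where

  -- Conjugation

  conj⁻¹ : SP n → SP n → SP n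
  conj⁻¹ h x = conjB (invB h) x

  -- Avoiding the inverse of h lets the relation compose and pass to iterates letter by letter.
  record Intertwines (h x x′ : SP n) : Set where
    constructor intertwining
    field
      intertwines : ∀ a → apply x′ (apply h a) ≡ apply h (apply x a)
  open Intertwines public

  Commute⇒Intertwines : ∀ {x z : SP n} → Commute x z → Intertwines z x x
  Commute⇒Intertwines c = intertwining (apply-comm c)

  Intertwines⇒Commute : ∀ {x z : SP n} → Intertwines z x x → Commute x z
  Intertwines⇒Commute i = commuting (intertwines i)

  Intertwines-conj : ∀ {h : SP n} → Perm h → ∀ x → Intertwines h x (conjB h x)
  Intertwines-conj {h} ph x = intertwining λ a → ≡.trans (apply-conj h x (apply h a)) (cong (λ b → apply h (apply x b)) (inverseˡ ph a))

  Intertwines-inv : ∀ {h x x′ : SP n} → Perm h → Intertwines h x x′ → Intertwines (invB h) x′ x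
  Intertwines-inv {h} {x} {x′} ph i = intertwining λ a → apply-injective ph (≡.trans (≡.sym (intertwines i (apply (invB h) a)))
    (≡.trans (cong (apply x′) (inverseʳ ph a)) (≡.sym (inverseʳ ph (apply x′ a)))))

  Intertwines-inv⁻ : ∀ {h x x′ : SP n} → Perm h → Intertwines (invB h) x x′ → Intertwines h x′ x
  Intertwines-inv⁻ {h} {x} {x′} ph i = intertwining λ a → begin
      apply x (apply h a)                                 ≡⟨ inverseʳ ph (apply x (apply h a)) ⟨
      apply h (apply (invB h) (apply x (apply h a)))      ≡⟨ cong (apply h) (intertwines i (apply h a)) ⟨
      apply h (apply x′ (apply (invB h) (apply h a)))     ≡⟨ cong (λ b → apply h (apply x′ b)) (inverseˡ ph a) ⟩
      apply h (apply x′ a)                                ∎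
    where open ≡.≡-Reasoning

  Intertwines⇒conj : ∀ {h x x′ : SP n} → Perm h → Intertwines h x x′ → conjB h x ≡ x′
  Intertwines⇒conj {h} {x} {x′} ph i = apply-ext λ a → ≡.trans (apply-conj h x a)
    (≡.trans (≡.sym (intertwines i (apply (invB h) a))) (cong (apply x′) (inverseʳ ph a)))

  conj⇒Intertwines : ∀ {h x x′ : SP n} → Perm h → conjB h x ≡ x′ → Intertwines h x x′
  conj⇒Intertwines {h} {x} ph e = subst (Intertwines h x) e (Intertwines-conj ph x)

  Intertwines-∘ : ∀ {h h′ x x′ x″ : SP n} → Intertwines h x x′ → Intertwines h′ x′ x″ → Intertwines (h′ ∘B h) x x″
  Intertwines-∘ {h} {h′} {x} {x′} {x″} i i′ = intertwining λ a → ≡.trans (cong (apply x″) (apply-∘ h′ h a))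
    (≡.trans (intertwines i′ (apply h a)) (≡.trans (cong (apply h′) (intertwines i a)) (≡.sym (apply-∘ h′ h (apply x a)))))

  Intertwines-iterL : ∀ {h x x′ : SP n} → Intertwines h x x′ → ∀ a t → iterL x′ (apply h a) t ≡ apply h (iterL x a t)
  Intertwines-iterL i a zero = ≡.refl
  Intertwines-iterL {h} {x} {x′} i a (suc t) = ≡.trans (cong (apply x′) (Intertwines-iterL i a t)) (intertwines i (iterL x a t))

  Intertwines-Commute : ∀ {h x x′ z z′ : SP n} → Perm h → Intertwines h x x′ → Intertwines h z z′ → Commute x z → Commute x′ z′
  Intertwines-Commute {h} {x} {x′} {z} {z′} ph ix iz c = commuting λ a →
    subst (λ a → apply x′ (apply z′ a) ≡ apply z′ (apply x′ a)) (inverseʳ ph a) (on-image (apply (invB h) a))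
    where
    on-image : ∀ a → apply x′ (apply z′ (apply h a)) ≡ apply z′ (apply x′ (apply h a))
    on-image a = begin
        apply x′ (apply z′ (apply h a))    ≡⟨ cong (apply x′) (intertwines iz a) ⟩
        apply x′ (apply h (apply z a))     ≡⟨ intertwines ix (apply z a) ⟩
        apply h (apply x (apply z a))      ≡⟨ cong (apply h) (apply-comm c a) ⟩
        apply h (apply z (apply x a))      ≡⟨ intertwines iz (apply x a) ⟨
        apply z′ (apply h (apply x a))     ≡⟨ cong (apply z′) (intertwines ix a) ⟨
        apply z′ (apply x′ (apply h a))    ∎
      where open ≡.≡-Reasoning

  Intertwines-powB : ∀ {h x x′ : SP n} → Perm h → Intertwines h x x′ → ∀ k → powB x k ≡ idB → powB x′ k ≡ idB
  Intertwines-powB {h} {x} {x′} ph i k e = apply-ext λ a → begin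
      apply (powB x′ k) a                      ≡⟨ apply-powB x′ k a ⟩
      iterL x′ a k                             ≡⟨ cong (λ a → iterL x′ a k) (inverseʳ ph a) ⟨
      iterL x′ (apply h (apply (invB h) a)) k  ≡⟨ Intertwines-iterL i (apply (invB h) a) k ⟩
      apply h (iterL x (apply (invB h) a) k)   ≡⟨ cong (apply h) (≡.trans (≡.sym (apply-powB x k (apply (invB h) a)))
                                                    (≡.trans (cong (λ w → apply w (apply (invB h) a)) e) (apply-id (apply (invB h) a)))) ⟩
      apply h (apply (invB h) a)               ≡⟨ inverseʳ ph a ⟩
      a                                        ≡⟨ apply-id a ⟨
      apply idB a                              ∎
    where open ≡.≡-Reasoning

  conjugate-sound : ∀ x y → conjugate x y ≡ true → ∃ λ h → Perm h × Intertwines h x y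
  conjugate-sound x y e with any-witness (λ h → spEq (conjB h x) y) (Bn n) e
  ... | h , h∈ , e′ = h , ∈-Bn⁻ h∈ , conj⇒Intertwines (∈-Bn⁻ h∈) (does⇒ (conjB h x ≟W y) e′)

  conjugate-complete : ∀ {h x y} → Perm h → Intertwines h x y → conjugate x y ≡ true
  conjugate-complete {h} {x} {y} ph i = any-true (λ h → spEq (conjB h x) y) (∈-Bn⁺ ph) (dec-true (conjB h x ≟W y) (Intertwines⇒conj ph i))

  conjugate-refl : ∀ x → conjugate x x ≡ true
  conjugate-refl x = conjugate-complete {idB} {x} {x} Perm-id (intertwining λ a → ≡.trans (cong (apply x) (apply-id a)) (≡.sym (apply-id (apply x a))))

  conjugate-sym : ∀ x y → conjugate x y ≡ true → conjugate y x ≡ true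
  conjugate-sym x y e = let h , ph , i = conjugate-sound x y e in conjugate-complete (Perm-inv ph) (Intertwines-inv ph i)

  conjugate-trans : ∀ x y z → conjugate x y ≡ true → conjugate y z ≡ true → conjugate x z ≡ true
  conjugate-trans x y z e e′ =
    let h , ph , i = conjugate-sound x y e
        h′ , ph′ , i′ = conjugate-sound y z e′
    in conjugate-complete (Perm-∘ ph′ ph) (Intertwines-∘ {h} {h′} {x} {y} {z} i i′)

  -- Integer exponents

  exponent : ℤ → ℕ
  exponent (+ m)    = m
  -- Every order is at most 2n and so divides (2n)!; hence x to the power (2n)! - 1 is the inverse
  -- of x.
  exponent -[1+ m ] = suc m *ℕ pred ((2 *ℕ n) !)

  order-factorial : ∀ {x : SP n} → Perm x → ∀ a → iterL x a ((2 *ℕ n) !) ≡ a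
  order-factorial {x} px a = ⇒order i (∣-trans (n∣n! (positive i)) (m≤n⇒m!∣n! o≤2n))
    where
    i = proj₁ (orbitSize-IsOrder px a)
    o≤2n = proj₂ (orbitSize-IsOrder px a)
    n∣n! : ∀ {o} → 0 < o → o ∣ o !
    n∣n! {suc o} _ = m∣m*n (o !)

  invB-iterL : ∀ {x : SP n} → Perm x → ∀ a → apply (invB x) a ≡ iterL x a (pred ((2 *ℕ n) !))
  invB-iterL {x} px a = apply-injective px (≡.trans (inverseʳ px a)
    (≡.sym (≡.trans (cong (iterL x a) (ℕₚ.suc-pred ((2 *ℕ n) !) {{ℕₚ._!≢0 (2 *ℕ n)}})) (order-factorial px a))))

  zpowB≡powB : ∀ {x : SP n} → Perm x → ∀ k → zpowB x k ≡ powB x (exponent k)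
  zpowB≡powB px (+ m) = ≡.refl
  zpowB≡powB {x} px -[1+ m ] = apply-ext λ a → ≡.trans (apply-powB (invB x) (suc m) a)
    (≡.trans (go (suc m) a) (≡.sym (apply-powB x (suc m *ℕ pred ((2 *ℕ n) !)) a)))
    where
    e = pred ((2 *ℕ n) !)
    go : ∀ t a → iterL (invB x) a t ≡ iterL x a (t *ℕ e)
    go zero a = ≡.refl
    go (suc t) a = ≡.trans (cong (apply (invB x)) (go t a)) (≡.trans (invB-iterL px (iterL x a (t *ℕ e))) (≡.sym (iterL-+ x a e (t *ℕ e))))

-- Conjugation invariance of the orbit product

module ClassSum {c ℓ} (K : CharZeroField c ℓ) (n : ℕ) (ζ η : ℕ → CharZeroField.Carrier K)
  (ζ-primitive : ∀ i → 1 ≤ i → i ≤ n → Primitive K i (ζ i))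
  (η-primitive : ∀ i → 1 ≤ i → i ≤ n → Primitive K (2 *ℕ i) (η i)) where

  open CharZeroField K
  open FieldLemmas K
  open Characters K n ζ η ζ-primitive η-primitive
  open Omega K n ζ η ζ-primitive η-primitive

  module _ {x g : SP n} (px : Perm x) (pg : Perm g) (com : Commute x g) where

    F-apply-x : ∀ a → F x g a ≡ F x g (apply x a)
    F-apply-x a = F-transfer (apply x) (apply-injective px) (apply-neg x) a
      (λ p → iterL-sucʳ x a p) (λ p → ≡.sym (iterL-apply (Commute-sym com) a p))

    F-apply-g : ∀ a → F x g a ≡ F x g (apply g a)
    F-apply-g a = F-transfer (apply g) (apply-injective pg) (apply-neg g) a
      (λ p → ≡.sym (iterL-apply com a p)) (λ p → iterL-sucʳ g a p)

    F-neg : ∀ a → F x g a ≡ F x g (negL a)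
    F-neg a = F-transfer negL negL-injective (λ _ → ≡.refl) a (λ p → ≡.sym (iterL-neg x a p)) (λ p → ≡.sym (iterL-neg g a p))

    -- The maps x, g and -1, which generate the orbit, commute with x and g, so each of them can
    -- serve as the map in `F-transfer`.
    F-Orbit : ∀ {a b} → Orbit x g a b → F x g a ≡ F x g b
    F-Orbit {a} {b} (q , p , e) = ≡.trans (g-iterates q) (≡.trans (x-iterates p) (sign (idx-≡ {n} {d} {b} e)))
      where
      d : Letter n
      d = iterL x (iterL g a q) p
      g-iterates : ∀ q → F x g a ≡ F x g (iterL g a q)
      g-iterates zero = ≡.refl
      g-iterates (suc q) = ≡.trans (g-iterates q) (F-apply-g (iterL g a q))
      x-iterates : ∀ p → F x g (iterL g a q) ≡ F x g (iterL x (iterL g a q) p)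
      x-iterates zero = ≡.refl
      x-iterates (suc p) = ≡.trans (x-iterates p) (F-apply-x (iterL x (iterL g a q) p))
      sign : d ≡ b ⊎ d ≡ negL b → F x g d ≡ F x g b
      sign (inj₁ e) = cong (F x g) e
      sign (inj₂ e) = ≡.trans (cong (F x g) e) (≡.sym (F-neg b))

  Orbit-Intertwines : ∀ {h x x′ g g′ : SP n} → Perm h → Intertwines h x x′ → Intertwines h g g′ →
                      ∀ {a b} → Orbit x g a b → Orbit x′ g′ (apply h a) (apply h b)
  Orbit-Intertwines {h} {x} {x′} {g} {g′} ph ix ig {a} {b} (q , p , e) = q , p ,
    ≡.trans (cong idx (≡.trans (cong (λ d → iterL x′ d p) (Intertwines-iterL ig a q)) (Intertwines-iterL ix (iterL g a q) p)))
      (idx-iterL h {iterL x (iterL g a q) p} {b} 1 e)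

  module _ {h x x′ g g′ : SP n} (ph : Perm h) (px : Perm x) (pg : Perm g) (com : Commute x g)
           (px′ : Perm x′) (pg′ : Perm g′) (com′ : Commute x′ g′) (ix : Intertwines h x x′) (ig : Intertwines h g g′) where

    private
      φ ψ : Fin n → Fin n
      φ i = rep x′ g′ (idx (apply h (pos i)))
      ψ k = rep x g (idx (apply (invB h) (pos k)))

      φ-Orbit : ∀ i → Orbit x′ g′ (apply h (pos i)) (pos (φ i))
      φ-Orbit i = Orbit-resp ≡.refl ≡.refl
        (rep-Orbit px′ pg′ com′ (idx (apply h (pos i))))

      ψ-Orbit : ∀ k → Orbit x g (apply (invB h) (pos k)) (pos (ψ k))
      ψ-Orbit k = Orbit-resp ≡.refl ≡.refl
        (rep-Orbit px pg com (idx (apply (invB h) (pos k))))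

      ψφ : ∀ i → rep x g i ≡ i → ψ (φ i) ≡ i
      ψφ i e = ≡.trans (≡.sym (rep-cong px pg com i (idx (apply (invB h) (pos (φ i))))
        (Orbit-resp
          (cong idx (inverseˡ ph (pos i))) ≡.refl
          (Orbit-Intertwines (Perm-inv ph) (Intertwines-inv {h = h} {x} {x′} ph ix) (Intertwines-inv {h = h} {g} {g′} ph ig) (φ-Orbit i))))) e

      φψ : ∀ k → rep x′ g′ k ≡ k → φ (ψ k) ≡ k
      φψ k e = ≡.trans (≡.sym (rep-cong px′ pg′ com′ k (idx (apply h (pos (ψ k))))
        (Orbit-resp
          (cong idx (inverseʳ ph (pos k))) ≡.refl
          (Orbit-Intertwines ph ix ig (ψ-Orbit k))))) e

    -- Orbits go to orbits under h, but bases need not go to bases. The image of a base is replaced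
    -- by the base of its orbit, where F has the same value.
    Ω-equivariant : Ω x g ≈ Ω x′ g′
    Ω-equivariant = P.∑-bij Finₚ._≟_ {f = λ i → F x g (pos i)} {h = λ k → F x′ g′ (pos k)} (orbitBases-unique x g) (orbitBases-unique x′ g′) φ ψ
      (λ {i} p → ∈-orbitBases⁺ {x = x′} {g′} (rep-idem px′ pg′ com′ (idx (apply h (pos i)))) , ψφ i (∈-orbitBases⁻ {x = x} {g} p))
      (λ {k} p → ∈-orbitBases⁺ {x = x} {g} (rep-idem px pg com (idx (apply (invB h) (pos k)))) , φψ k (∈-orbitBases⁻ {x = x′} {g′} p))
      (λ {i} _ → reflexive (≡.trans (F-transfer (apply h) (apply-injective ph) (apply-neg h) (pos i)
                   (λ p → ≡.sym (Intertwines-iterL ix (pos i) p)) (λ p → ≡.sym (Intertwines-iterL ig (pos i) p)))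
                 (F-Orbit px′ pg′ com′ (φ-Orbit i))))

-- Class representatives and the average over B_n

countL-positive : ∀ {A : Set} (p : A → Bool) {xs x} → x ∈ xs → p x ≡ true → 0 < countL p xs
countL-positive p {x ∷ xs} (here ≡.refl) e rewrite e = s≤s z≤n
countL-positive p {x ∷ xs} (there q) e with p x
... | true  = s≤s z≤n
... | false = countL-positive p q e

countL-cong : ∀ {A : Set} {p q : A → Bool} (xs : List A) → (∀ {x} → x ∈ xs → p x ≡ q x) → countL p xs ≡ countL q xs
countL-cong [] e = ≡.refl
countL-cong {p = p} {q} (x ∷ xs) e rewrite e (here ≡.refl) with q x
... | true  = cong suc (countL-cong xs (λ m → e (there m)))
... | false = countL-cong xs (λ m → e (there m))

∈-firstsOf⁻ : ∀ {A : Set} (r : A → A → Bool) seen xs {x} → x ∈ firstsOf r seen xs → x ∈ xs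
∈-firstsOf⁻ r seen (x ∷ xs) m with any (λ y → r y x) seen
... | true = there (∈-firstsOf⁻ r seen xs m)
∈-firstsOf⁻ r seen (x ∷ xs) (here e) | false = here e
∈-firstsOf⁻ r seen (x ∷ xs) (there m) | false = there (∈-firstsOf⁻ r (x ∷ seen) xs m)

module RootCount {c ℓ} (K : CharZeroField c ℓ) (n : ℕ) (ζ η : ℕ → CharZeroField.Carrier K)
  (ζ-primitive : ∀ i → 1 ≤ i → i ≤ n → Primitive K i (ζ i))
  (η-primitive : ∀ i → 1 ≤ i → i ≤ n → Primitive K (2 *ℕ i) (η i)) where

  open CharZeroField K
  open FieldLemmas K
  open Characters K n ζ η ζ-primitive η-primitive
  open Omega K n ζ η ζ-primitive η-primitive
  open ClassSum K n ζ η ζ-primitive η-primitive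

  module Representatives {A : Set} (r : A → A → Bool) (r-refl : ∀ x → r x x ≡ true)
           (r-sym : ∀ x y → r x y ≡ true → r y x ≡ true) (r-trans : ∀ x y z → r x y ≡ true → r y z ≡ true → r x z ≡ true)
           (y : A) (v : Carrier) where

    private
      term : A → Carrier
      term x = if r x y then v else 0#

    -- A kept entry related to y would be related to s as well, and `firstsOf` would have dropped
    -- it.
    ∑-firstsOf-seen : ∀ {seen} xs {s} → s ∈ seen → r s y ≡ true → S.∑ (firstsOf r seen xs) term ≈ 0#
    ∑-firstsOf-seen [] m e = refl
    ∑-firstsOf-seen {seen} (x ∷ xs) {s} m e with any (λ y → r y x) seen in eq
    ... | true  = ∑-firstsOf-seen xs m e
    ... | false with r x y in eq′
    ...   | false = trans (+-identityˡ _) (∑-firstsOf-seen xs (there m) e)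
    ...   | true  = ⊥-elim (false≢true (≡.trans (≡.sym (any-false (λ y → r y x) eq m)) (r-trans s y x e (r-sym x y eq′))))

    -- The first entry related to y is kept, because nothing seen before is related to y; it
    -- contributes v, and `∑-firstsOf-seen` disposes of the rest.
    ∑-firstsOf : ∀ {seen} xs → y ∈ xs → (∀ {s} → s ∈ seen → r s y ≡ false) → S.∑ (firstsOf r seen xs) term ≈ v
    ∑-firstsOf {seen} (x ∷ xs) m unseen with any (λ y → r y x) seen in eq
    ∑-firstsOf {seen} (x ∷ xs) (there m) unseen | true = ∑-firstsOf xs m unseen
    ∑-firstsOf {seen} (x ∷ xs) (here ≡.refl) unseen | true with any-witness (λ z → r z x) seen eq
    ... | s , s∈ , e = ⊥-elim (false≢true (≡.trans (≡.sym (unseen s∈)) e))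
    ∑-firstsOf {seen} (x ∷ xs) m unseen | false with r x y in eq′
    ... | true  = trans (+-congˡ (∑-firstsOf-seen xs (here ≡.refl) eq′)) (+-identityʳ v)
    ... | false = trans (+-identityˡ _) (∑-firstsOf xs (tail m) λ { (here ≡.refl) → eq′ ; (there p) → unseen p })
      where
      tail : y ∈ x ∷ xs → y ∈ xs
      tail (here ≡.refl) = ⊥-elim (false≢true (≡.trans (≡.sym eq′) (r-refl x)))
      tail (there p) = p

  ∑-filter-const : ∀ {A : Set} {Q : A → Set} (Q? : ∀ x → Dec (Q x)) xs v →
                   S.∑ (filter Q? xs) (λ _ → v) ≈ fromℕK K (countL (λ x → does (Q? x)) xs) * v
  ∑-filter-const Q? [] v = sym (zeroˡ v)
  ∑-filter-const Q? (x ∷ xs) v with does (Q? x)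
  ... | true  = trans (+-cong (sym (*-identityˡ v)) (∑-filter-const Q? xs v)) (sym (distribʳ v 1# _))
  ... | false = ∑-filter-const Q? xs v

  module _ (kℤ : ℤ) {g : SP n} (pg : Perm g) where

    private
      k : ℕ
      k = exponent {n} kℤ

      Φ : SP n → Carrier
      Φ y = if does (commute? y g) then (if does (powB y k ≟W idB) then Ω y g else 0#) else 0#

      Φ-vanish : ∀ y → powB y k ≢ idB → Φ y ≈ 0#
      Φ-vanish y ne with does (commute? y g)
      ... | true  = S.if-no (powB y k ≟W idB) ne
      ... | false = refl

    classPowTrivial⇒ : ∀ {x} → Perm x → classPowTrivial kℤ x ≡ true → powB x k ≡ idB
    classPowTrivial⇒ {x} px e = Intertwines-powB (Perm-inv Perm-id) (Intertwines-inv Perm-id (Intertwines-conj Perm-id x)) k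
      (≡.trans (≡.sym (zpowB≡powB (Perm-conj Perm-id px) kℤ))
        (does⇒ (zpowB (conjB idB x) kℤ ≟W idB) (all-lookup (λ h → spEq (zpowB (conjB h x) kℤ) idB) e (∈-Bn⁺ Perm-id))))

    ⇒classPowTrivial : ∀ {x} → Perm x → powB x k ≡ idB → classPowTrivial kℤ x ≡ true
    ⇒classPowTrivial {x} px e = all-true (λ h → spEq (zpowB (conjB h x) kℤ) idB) (Bn n) λ {h} h∈ →
      dec-true (zpowB (conjB h x) kℤ ≟W idB) (≡.trans (zpowB≡powB (Perm-conj (∈-Bn⁻ h∈) px) kℤ)
        (Intertwines-powB (∈-Bn⁻ h∈) (Intertwines-conj (∈-Bn⁻ h∈) x) k e))

    module _ {x : SP n} (px : Perm x) where

      private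
        |Z| : Carrier
        |Z| = fromℕK K (centralizerSize K ζ η x)

        classTerm : SP n → Carrier
        classTerm y = if conjugate x y then Φ y else 0#

      private
        conjugator? : ∀ y h → Dec (conj⁻¹ h x ≡ y)
        conjugator? y h = conj⁻¹ h x ≟W y

        conjugators : SP n → List (SP n)
        conjugators y = filter (conjugator? y) (Bn n)

        ∈-conjugators⁻ : ∀ y {h} → h ∈ conjugators y → Perm h × Intertwines h y x × conj⁻¹ h x ≡ y
        ∈-conjugators⁻ y {h} p =
          let h∈ , e = ∈-filter⁻ (conjugator? y) {xs = Bn n} p
              ph = ∈-Bn⁻ h∈
          in ph , Intertwines-inv⁻ ph (conj⇒Intertwines (Perm-inv ph) e) , e

        ∈-conjugators⁺ : ∀ y {h} → Perm h → Intertwines h y x → h ∈ conjugators y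
        ∈-conjugators⁺ y {h} ph i = ∈-filter⁺ (conjugator? y) (∈-Bn⁺ ph) (Intertwines⇒conj (Perm-inv ph) (Intertwines-inv ph i))

        -- The elements conjugating y to x form the coset Z(x) h₀⁻¹.
        conjugators≅centralizer : ∀ {y h₀} → Perm h₀ → Intertwines h₀ x y →
                                  S.∑ (conjugators y) (λ _ → Φ y) ≈ S.∑ (filter (commute? x) (Bn n)) (λ _ → Φ y)
        conjugators≅centralizer {y} {h₀} ph₀ i₀ = S.∑-bij _≟W_ {f = λ _ → Φ y} {h = λ _ → Φ y}
            (Unique-filter⁺ (conjugator? y) (Bn-unique n)) (Unique-filter⁺ (commute? x) (Bn-unique n))
            (λ h → h ∘B h₀) (λ z → z ∘B invB h₀) to from (λ _ → refl)
          where
          to : ∀ {h} → h ∈ conjugators y → h ∘B h₀ ∈ filter (commute? x) (Bn n) × (h ∘B h₀) ∘B invB h₀ ≡ h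
          to {h} p = ∈-filter⁺ (commute? x) {x = h ∘B h₀} (∈-Bn⁺ (Perm-∘ ph ph₀)) (Commute⇒∘B {x = x} {h ∘B h₀} (Intertwines⇒Commute i)) ,
              apply-ext λ a → ≡.trans (apply-∘ (h ∘B h₀) (invB h₀) a) (≡.trans (apply-∘ h h₀ (apply (invB h₀) a)) (cong (apply h) (inverseʳ ph₀ a)))
            where
            ph : Perm h
            ph = proj₁ (∈-conjugators⁻ y p)
            i : Intertwines (h ∘B h₀) x x
            i = Intertwines-∘ i₀ (proj₁ (proj₂ (∈-conjugators⁻ y p)))
          from : ∀ {z} → z ∈ filter (commute? x) (Bn n) → z ∘B invB h₀ ∈ conjugators y × (z ∘B invB h₀) ∘B h₀ ≡ z
          from {z} p = ∈-conjugators⁺ y (Perm-∘ pz (Perm-inv ph₀)) i ,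
              apply-ext λ a → ≡.trans (apply-∘ (z ∘B invB h₀) h₀ a) (≡.trans (apply-∘ z (invB h₀) (apply h₀ a)) (cong (apply z) (inverseˡ ph₀ a)))
            where
            z∈ : z ∈ Bn n × x ∘B z ≡ z ∘B x
            z∈ = ∈-filter⁻ (commute? x) {xs = Bn n} p
            pz : Perm z
            pz = ∈-Bn⁻ (proj₁ z∈)
            i : Intertwines (z ∘B invB h₀) y x
            i = Intertwines-∘ (Intertwines-inv ph₀ i₀) (Commute⇒Intertwines (∘B⇒Commute {x = x} {z} (proj₂ z∈)))

      fibre-sum : ∀ y → S.∑ (conjugators y) (λ h → Φ (conj⁻¹ h x)) ≈ |Z| * classTerm y
      fibre-sum y = trans (S.∑-cong (conjugators y) (λ p → reflexive (cong Φ (proj₂ (proj₂ (∈-conjugators⁻ y p))))))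
          (go (conjugate x y) ≡.refl)
        where
        go : ∀ b → conjugate x y ≡ b → S.∑ (conjugators y) (λ _ → Φ y) ≈ |Z| * (if b then Φ y else 0#)
        go true e = let h₀ , ph₀ , i₀ = conjugate-sound x y e in
          trans (conjugators≅centralizer ph₀ i₀) (∑-filter-const (commute? x) (Bn n) (Φ y))
        go false e = trans (S.∑-ε (conjugators y) λ {h} p → let ph , i , _ = ∈-conjugators⁻ y p in
            ⊥-elim (false≢true (≡.trans (≡.sym e) (conjugate-complete (Perm-inv ph) (Intertwines-inv ph i)))))
          (sym (zeroʳ |Z|))

      -- Conjugation by h⁻¹ takes the pair of x and h g h⁻¹ to that of y = h⁻¹ x h and g. Least
      -- indices are not carried along, so the character is first rewritten as an orbit product.
      psi-term : powB x k ≡ idB → ∀ {h} → Perm h →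
                 (if commutes K ζ η x (conjB h g) then omega K ζ η x (conjB h g) else 0#) ≈ Φ (conj⁻¹ h x)
      psi-term triv {h} ph = go (commute? x g′)
        where
        g′ y : SP n
        g′ = conjB h g
        y = conj⁻¹ h x
        pg′ : Perm g′
        pg′ = Perm-conj ph pg
        py : Perm y
        py = Perm-conj (Perm-inv ph) px
        ix : Intertwines (invB h) x y
        ix = Intertwines-conj (Perm-inv ph) x
        ig : Intertwines (invB h) g′ g
        ig = Intertwines-inv ph (Intertwines-conj ph g)
        go : Dec (x ∘B g′ ≡ g′ ∘B x) → (if commutes K ζ η x g′ then omega K ζ η x g′ else 0#) ≈ Φ y
        go (yes e) =
          let c = ∘B⇒Commute e
              c′ = Intertwines-Commute (Perm-inv ph) ix ig c
          in trans (S.if-yes (commute? x g′) e) (trans (omega≈Ω px pg′ c)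
               (trans (Ω-equivariant (Perm-inv ph) px pg′ c py pg c′ ix ig)
                 (sym (trans (S.if-yes (commute? y g) (Commute⇒∘B c′)) (S.if-yes (powB y k ≟W idB) (Intertwines-powB (Perm-inv ph) ix k triv))))))
        go (no ne) = trans (S.if-no (commute? x g′) ne) (sym (S.if-no (commute? y g) λ e →
          ne (Commute⇒∘B (Intertwines-Commute ph (Intertwines-inv⁻ ph ix) (Intertwines-inv⁻ ph ig) (∘B⇒Commute e)))))

      -- Each conjugate of x arises from |Z(x)| elements h; this factor cancels the one in the
      -- induced character.
      conjugates-sum : S.∑ (Bn n) (λ h → Φ (conj⁻¹ h x)) ≈ |Z| * S.∑ (Bn n) classTerm
      conjugates-sum = trans (S.∑-fibre _≟W_ (λ h → conj⁻¹ h x) (Bn n) _ (Bn-unique n) (λ h∈ → ∈-Bn⁺ (Perm-conj (Perm-inv (∈-Bn⁻ h∈)) px)))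
        (trans (S.∑-cong (Bn n) (λ {y} _ → fibre-sum y)) (sym (∑-*ˡ (Bn n) |Z|)))

      |Z|-Unit : ¬ |Z| ≈ 0#
      |Z|-Unit e with centralizerSize K ζ η x | countL-positive (commutes K ζ η x) (∈-Bn⁺ Perm-id) (dec-true (commute? x idB) (Commute⇒∘B (Commute-id x)))
      ... | suc m | _ = charZero m e

      class-term : (if classPowTrivial kℤ x then psi K ζ η x g else 0#) ≈ S.∑ (Bn n) classTerm
      class-term with classPowTrivial kℤ x in eq
      ... | true = begin
          inv |Z| * S.∑ (Bn n) (λ h → if commutes K ζ η x (conjB h g) then omega K ζ η x (conjB h g) else 0#)
            ≈⟨ *-congˡ (trans (S.∑-cong (Bn n) (λ h∈ → psi-term (classPowTrivial⇒ px eq) (∈-Bn⁻ h∈))) conjugates-sum) ⟩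
          inv |Z| * (|Z| * S.∑ (Bn n) classTerm)     ≈⟨ *-assoc _ _ _ ⟨
          inv |Z| * |Z| * S.∑ (Bn n) classTerm       ≈⟨ *-congʳ (trans (*-comm _ _) (inv-law |Z| |Z|-Unit)) ⟩
          1# * S.∑ (Bn n) classTerm                  ≈⟨ *-identityˡ _ ⟩
          S.∑ (Bn n) classTerm                       ∎
        where open import Relation.Binary.Reasoning.Setoid setoid
      -- Triviality of the k-th power passes between conjugates, so here Φ vanishes on the whole
      -- class of x.
      ... | false = sym (S.∑-ε (Bn n) λ {y} _ → vanish y)
        where
        vanish : ∀ y → classTerm y ≈ 0#
        vanish y with conjugate x y in eq′
        ... | false = refl
        ... | true  = Φ-vanish y λ e →
          let h , ph , i = conjugate-sound x y eq′
          in false≢true (≡.trans (≡.sym eq) (⇒classPowTrivial px (Intertwines-powB (Perm-inv ph) (Intertwines-inv ph i) k e)))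

    -- Each y in B_n is conjugate to exactly one representative, so exchanging the two sums leaves Φ
    -- y once.
    rhs≈ : rhs K ζ η kℤ g ≈ S.∑ (Bn n) Φ
    rhs≈ = trans (S.∑-cong (classReps n) (λ x∈ → class-term (∈-Bn⁻ (∈-firstsOf⁻ conjugate [] (Bn n) x∈))))
      (trans (S.∑-swap (classReps n) (Bn n) (λ x y → if conjugate x y then Φ y else 0#))
        (S.∑-cong (Bn n) (λ {y} y∈ → Representatives.∑-firstsOf conjugate conjugate-refl conjugate-sym conjugate-trans y (Φ y) (Bn n) y∈ λ ())))

    roots≈rhs : fromℕK K (rootsB kℤ g) ≈ rhs K ζ η kℤ g
    roots≈rhs = begin
        fromℕK K (rootsB kℤ g)
          ≡⟨ cong (fromℕK K) (countL-cong (Bn n) (λ {h} h∈ → cong (λ w → spEq w g) (zpowB≡powB (∈-Bn⁻ h∈) kℤ))) ⟩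
        fromℕK K (countL (λ y → does (powB y k ≟W g)) (Bn n))
          ≈⟨ roots-sum ⟩
        S.∑ centralizer (λ y → if does (powB y k ≟W idB) then Ω y g else 0#)
          ≈⟨ S.∑-filter (λ y → commute? y g) (Bn n) _ ⟩
        S.∑ (Bn n) Φ
          ≈⟨ rhs≈ ⟨
        rhs K ζ η kℤ g ∎
      where
      open import Relation.Binary.Reasoning.Setoid setoid
      open Hybrid K n ζ η ζ-primitive η-primitive k pg

open import Data.Nat using (_*_)

theorem1p5 : ∀ {c ℓ} (K : CharZeroField c ℓ) (k : ℤ) (n : ℕ) → 0 < n →
    (ζ η : ℕ → CharZeroField.Carrier K) →
    (∀ i → 1 ≤ i → i ≤ n → Primitive K i (ζ i)) →
    (∀ i → 1 ≤ i → i ≤ n → Primitive K (2 * i) (η i)) →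
    (g : SP n) → T (isSignedPerm g) →
    CharZeroField._≈_ K (fromℕK K (rootsB k g)) (rhs K ζ η k g)
theorem1p5 K k n _ ζ η ζ-primitive η-primitive g g-signed =
  RootCount.roots≈rhs K n ζ η ζ-primitive η-primitive k (isSignedPerm⇒Perm g (T⇒true g-signed))
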